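{- Let $\alpha>0$ be fixed. As $Q\to\infty$, for all but $Q^{o(1)}$ primes $p\in[Q,2Q]$ we have $$M_\alpha^*(p)\le p^{2+o(1)}.$$
   Context: An integer $n$ is $y$-smooth if all prime divisors of $n$ do not exceed $y$; it is square-free if it is not divisible by the square of a prime. For a real $\alpha>0$ and an integer $q$, $M_\alpha^*(q)$ denotes the smallest integer $M$ such that every reduced residue class modulo $q$ (i.e. every class $a \bmod q$ with $\gcd(a,q)=1$) contains a $q^\alpha$-smooth square-free positive representative $k\le M$; $M_\alpha^*(q)=\infty$ if no such $M$ exists. Each $o(1)$ denotes a quantity tending to $0$ as $Q\to\infty$, possibly depending on $\alpha$; that is, for every $\delta,\kappa>0$ and all sufficiently large $Q$, the inequality $M_\alpha^*(p)\le p^{2+\delta}$ holds for all but at most $Q^{\kappa}$ primes $p\in[Q,2Q]$. -}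

module Defs where

open import Algebra.Definitions.RawSemiring as RawSemiringDefs using ()
open import Data.Integer.Base as ℤ using (ℤ; +_)
import Data.Integer.Coprimality as ℤ
import Data.Integer.Divisibility as ℤ
open import Data.Nat.Base as ℕ using (ℕ)
import Data.Nat.Divisibility as ℕ
open import Data.Nat.Primality using (Prime)
open import Data.Product.Base using (_×_; _,_; ∃; ∃-syntax)
open import Data.Rational.Base
open import Data.Rational.Properties
open import Data.Sum.Base using (_⊎_; inj₁; inj₂)
open import Function.Bundles using (_⇔_; mk⇔; module Equivalence)
open import Relation.Binary.Definitions using (tri<; tri≈; tri>)
open import Relation.Binary.PropositionalEquality
open import Relation.Nullary.Negation using (¬_)

open RawSemiringDefs +-*-rawSemiring using (_^_)

-- Dedekind reals: `Lower q` means q < x and `Upper q` means x < q.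
record ℝ : Set₁ where
  field
    Lower          : ℚ → Set
    Upper          : ℚ → Set
    inhabited-low  : ∃ Lower
    inhabited-up   : ∃ Upper
    rounded-low    : ∀ q → Lower q ⇔ (∃[ r ] q < r × Lower r)
    rounded-up     : ∀ q → Upper q ⇔ (∃[ r ] r < q × Upper r)
    disjoint       : ∀ q → ¬ (Lower q × Upper q)
    located        : ∀ {q r} → q < r → Lower q ⊎ Upper r

open ℝ

infix 4 _<ᵣ_ _≤ᵣ_ _≤_^ᵣ_

_<ᵣ_ : ℝ → ℝ → Set
x <ᵣ y = ∃[ q ] Upper x q × Lower y q

_≤ᵣ_ : ℝ → ℝ → Set
x ≤ᵣ y = ∀ q → Lower x q → Lower y q

fromℚ : ℚ → ℝ
fromℚ x .Lower q = q < x
fromℚ x .Upper q = x < q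
fromℚ x .inhabited-low = x - 1ℚ ,
  subst (x - 1ℚ <_) (+-identityʳ x) (+-monoʳ-< x (negative⁻¹ (- 1ℚ)))
fromℚ x .inhabited-up = x + 1ℚ ,
  subst (_< x + 1ℚ) (+-identityʳ x) (+-monoʳ-< x (positive⁻¹ 1ℚ))
fromℚ x .rounded-low q = mk⇔ <-dense (λ { (r , q<r , r<x) → <-trans q<r r<x })
fromℚ x .rounded-up q = mk⇔
  (λ x<q → let r , x<r , r<q = <-dense x<q in r , r<q , x<r)
  (λ { (r , r<q , x<r) → <-trans x<r r<q })
fromℚ x .disjoint q (q<x , x<q) = <-asym q<x x<q
fromℚ x .located {q} {r} q<r with <-cmp q x
... | tri< q<x _ _ = inj₁ q<x
... | tri≈ _ q≡x _ = inj₂ (subst (_< r) q≡x q<r)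
... | tri> _ _ x<q = inj₂ (<-trans x<q q<r)

fromℕ : ℕ → ℝ
fromℕ n = fromℚ (+ n / 1)

0ᵣ : ℝ
0ᵣ = fromℚ 0ℚ

2ℚ : ℚ
2ℚ = + 2 / 1

-- The image of x under an increasing bijection f of ℚ, whose inverse is g.
transport : (f g : ℚ → ℚ) →
            (∀ {p q} → p < q → f p < f q) → (∀ {p q} → p < q → g p < g q) →
            (∀ q → f (g q) ≡ q) → (∀ q → g (f q) ≡ q) → ℝ → ℝ
transport f g f-mono g-mono fg gf x = λ where
    .Lower q → Lower x (g q)
    .Upper q → Upper x (g q)
    .inhabited-low → let q , l = inhabited-low x in f q , subst (Lower x) (sym (gf q)) l
    .inhabited-up → let q , u = inhabited-up x in f q , subst (Upper x) (sym (gf q)) u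
    .rounded-low q → mk⇔
      (λ l → let r , gq<r , l′ = Equivalence.to (rounded-low x (g q)) l in
        f r , subst (_< f r) (fg q) (f-mono gq<r) , subst (Lower x) (sym (gf r)) l′)
      (λ { (r , q<r , l) → Equivalence.from (rounded-low x (g q)) (g r , g-mono q<r , l) })
    .rounded-up q → mk⇔
      (λ u → let r , r<gq , u′ = Equivalence.to (rounded-up x (g q)) u in
        f r , subst (f r <_) (fg q) (f-mono r<gq) , subst (Upper x) (sym (gf r)) u′)
      (λ { (r , r<q , u) → Equivalence.from (rounded-up x (g q)) (g r , g-mono r<q , u) })
    .disjoint q → disjoint x (g q)
    .located q<r → located x (g-mono q<r)

infixl 6 _+ᵣ_
infixl 7 _*ᵣ_

_+ᵣ_ : ℚ → ℝ → ℝ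
c +ᵣ x = transport (_+ c) (_- c) (+-monoˡ-< c) (+-monoˡ-< (- c))
  (λ q → trans (+-assoc q (- c) c) (trans (cong (_+_ q) (+-inverseˡ c)) (+-identityʳ q)))
  (λ q → trans (+-assoc q c (- c)) (trans (cong (_+_ q) (+-inverseʳ c)) (+-identityʳ q)))
  x

_*ᵣ_ : (c : ℚ) .{{_ : Positive c}} → ℝ → ℝ
c *ᵣ x = transport (_* c) (_* 1/c) (*-monoˡ-<-pos c) (*-monoˡ-<-pos 1/c {{1/pos⇒pos c}})
  (λ q → trans (*-assoc q 1/c c) (trans (cong (_*_ q) (*-inverseˡ c)) (*-identityʳ q)))
  (λ q → trans (*-assoc q c 1/c) (trans (cong (_*_ q) (*-inverseʳ c)) (*-identityʳ q)))
  x
  where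
  instance
    c≢0 : NonZero c
    c≢0 = pos⇒nonZero c
  1/c : ℚ
  1/c = 1/ c

-- n ≤ x ^ α for real x ≥ 1 and α > 0, where x ^ α is the infimum of the powers
-- s ^ (a / b) over rationals s > x and a / b > α, and n ≤ s ^ (a / b) is
-- written n ^ b ≤ s ^ a.
_≤_^ᵣ_ : ℕ → ℝ → ℝ → Set
n ≤ x ^ᵣ α = ∀ (s : ℚ) (a b : ℕ) .{{_ : ℕ.NonZero b}} →
  Upper x s → Upper α (+ a / b) → (+ n / 1) ^ b ≤ s ^ a

-- k is q^α-smooth.
Smooth : ℝ → ℕ → ℕ → Set
Smooth α q k = ∀ {r} → Prime r → r ℕ.∣ k → r ≤ fromℕ q ^ᵣ α

SquareFree : ℕ → Set
SquareFree k = ∀ {r} → Prime r → ¬ (r ℕ.* r ℕ.∣ k)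

-- Every reduced residue class modulo q has a q^α-smooth square-free
-- representative k with 1 ≤ k ≤ M.
Represents : ℝ → ℕ → ℕ → Set
Represents α q M = ∀ (a : ℤ) → ℤ.Coprime a (+ q) →
  ∃[ k ] 1 ℕ.≤ k × k ℕ.≤ M × Smooth α q k × SquareFree k × (+ q) ℤ.∣ (+ k ℤ.- a)

-- M = M*_α(q), as a relation since M*_α(q) = ∞ when no such M exists.
IsM* : ℝ → ℕ → ℕ → Set
IsM* α q M = Represents α q M × (∀ M′ → Represents α q M′ → M ℕ.≤ M′)

-- M*_α(q) ≤ q ^ β; in particular M*_α(q) is finite.
M*[_,_]≤^_ : ℝ → ℕ → ℝ → Set
M*[ α , q ]≤^ β = ∃[ M ] IsM* α q M × M ≤ fromℕ q ^ᵣ β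

-- p is a prime in [Q, 2Q] for which M*_α(p) ≤ p ^ (2 + δ) fails.
Exceptional : (α δ Q : ℝ) → ℕ → Set
Exceptional α δ Q p =
  Prime p × Q ≤ᵣ fromℕ p × fromℕ p ≤ᵣ 2ℚ *ᵣ Q × ¬ (M*[ α , p ]≤^ (2ℚ +ᵣ δ))

{-# OPTIONS --safe #-}
-- Fix D with 1/D < α, δ, κ, let y be the power of 2 with y^D < n ≤ (2y)^D, where n is the least
-- exceptional prime, and put some of the primes up to y into 2D + 1 disjoint blocks of equal size.
-- A product k = u l v of one prime from each block (u and v taking D primes each, l ∈ P one) is
-- square-free, y-smooth and at most y^(2D+1). If no such k lies in the class of a mod p, then the
-- balanced indicator f of the set a V⁻¹ is -|V| at all the points l u, so the dilation operator
-- T f x = Σ_{l ∈ P} f (l x) has ‖T f‖² / ‖f‖² only polylogarithmically below |P|². Since T is normal,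
-- j ↦ ‖T^j f‖² is log-convex, hence ‖T^R f‖² is just as large for R = 2D + 1. In other words, the
-- products of R primes from P correlate with a function of mean 0 modulo p. Functions of mean 0 to
-- distinct prime moduli p, q ≤ 2n are almost orthogonal on [0, y^R], since complete periods p q
-- contribute nothing, so this duality form of the large sieve leaves at most polylogarithmically many
-- such p. Polylogarithmic losses suffice throughout by Chebyshev's bound π(y) ≥ y / (2 log₂ y), which
-- follows from the divisibility (i + j + 1) (i + j choose i) ∣ lcm(1, …, i + j + 1).
module Submission where

-- No power of p may be lost at the first application of T, since a loss there is raised to the
-- power R. Products of D primes from the blocks lie below p and, up to logarithms, are as numerous
-- as the residues, so |U| and |V| are of order p up to logarithms and T f takes the value -|P| |V|
-- on a set of comparable size. Powers of T enter because a missed class concerns a single factor l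
-- ≤ y, far too short a range for a sieve with moduli near y^D. For two moduli the sieve error is
-- their product, of order y^(2D), while the range is y^R; R = 2D + 1 is the first exponent at which
-- the range wins, by a factor y. The number of blocks is also 2D + 1, but for another reason: D
-- primes for u, D for v and the one over which T sums. The blocks are the same for all exceptional
-- primes, whereas the missed class and f vary with p; only so can all the functions be tested on
-- the same products. Inner products over a residue system replace characters, everything stays in
-- the integers, and ratios appear cross-multiplied.

open import Defs
open import Data.List.Base using (List; length)
open import Data.List.Relation.Unary.All using (All)
open import Data.List.Relation.Unary.Unique.Propositional using (Unique)
open import Data.Nat.Base using (ℕ)
open import Data.Product.Base using (∃-syntax; _,_)

-- Finite sums of integers and the Cauchy-Schwarz inequality.

module FiniteSums where

  open import Data.Integer.Base
  open import Data.Integer.Properties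
  open import Data.Integer.Tactic.RingSolver using (solve-∀)
  open import Data.List.Base using (List; []; _∷_; _++_; map; length; cartesianProductWith)
  open import Data.List.Membership.Propositional using (_∈_)
  open import Data.List.Relation.Binary.Permutation.Propositional
    using (_↭_; refl; prep; swap; trans)
  open import Data.List.Relation.Unary.Any using (here; there)
  import Data.Nat.Base as ℕ
  open import Function.Base using (_∘_)
  open import Relation.Binary.PropositionalEquality using (_≡_; refl; sym; cong; cong₂; subst; module ≡-Reasoning) renaming (trans to ≡-trans)

  infixl 8 _²

  _² : ℤ → ℤ
  i ² = i * i

  0≤i² : ∀ i → 0ℤ ≤ i ²
  0≤i² (+ n) = subst (0ℤ ≤_) (pos-* n n) (+≤+ ℕ.z≤n)
  0≤i² -[1+ n ] = +≤+ ℕ.z≤n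

  0≤i*j : ∀ {i j} → 0ℤ ≤ i → 0ℤ ≤ j → 0ℤ ≤ i * j
  0≤i*j {+ m} {+ n} _ _ = subst (0ℤ ≤_) (pos-* m n) (+≤+ ℕ.z≤n)

  *-monoʳ-≤-0≤ : ∀ {i j k} → 0ℤ ≤ i → j ≤ k → i * j ≤ i * k
  *-monoʳ-≤-0≤ {i} 0≤i = *-monoˡ-≤-nonNeg i {{nonNegative 0≤i}}

  *-mono-≤-0≤ : ∀ {i j k l} → 0ℤ ≤ i → 0ℤ ≤ l → i ≤ j → k ≤ l → i * k ≤ j * l
  *-mono-≤-0≤ {i} {j} {k} {l} 0≤i 0≤l i≤j k≤l =
    ≤-trans (*-monoʳ-≤-0≤ 0≤i k≤l) (*-monoʳ-≤-nonNeg l {{nonNegative 0≤l}} i≤j)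

  -i≤j≤i⇒j²≤i² : ∀ {i j} → - i ≤ j → j ≤ i → j ² ≤ i ²
  -i≤j≤i⇒j²≤i² {i} {j} -i≤j j≤i = 0≤i-j⇒j≤i (subst (0ℤ ≤_) (lemma i j)
    (0≤i*j (i≤j⇒0≤j-i j≤i) (i≤j⇒0≤j-i -i≤j)))
    where
    lemma : ∀ i j → (i - j) * (j - (- i)) ≡ i * i - j * j
    lemma = solve-∀

  -- AM-GM, `2 i j ≤ i² + j²`: a correlation is controlled by bounds on squares alone.
  i*j≤k : ∀ {i j k} → i ² ≤ k → j ² ≤ k → i * j ≤ k
  i*j≤k {i} {j} {k} i²≤k j²≤k = *-cancelˡ-≤-pos (i * j) k (+ 2) (begin
    + 2 * (i * j)  ≤⟨ 0≤i-j⇒j≤i (subst (0ℤ ≤_) (lemma i j) (0≤i² (i - j))) ⟩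
    i ² + j ²      ≤⟨ +-mono-≤ i²≤k j²≤k ⟩
    k + k          ≡⟨ lemma₂ k ⟩
    + 2 * k        ∎)
    where
    open ≤-Reasoning
    lemma : ∀ i j → (i - j) * (i - j) ≡ (i * i + j * j) - + 2 * (i * j)
    lemma = solve-∀
    lemma₂ : ∀ k → k + k ≡ + 2 * k
    lemma₂ = solve-∀

  private
    variable
      A B C : Set

  ∑ : List A → (A → ℤ) → ℤ
  ∑ []       f = 0ℤ
  ∑ (x ∷ xs) f = f x + ∑ xs f

  ∑-cong-∈ : ∀ (xs : List A) {f g : A → ℤ} → (∀ {x} → x ∈ xs → f x ≡ g x) → ∑ xs f ≡ ∑ xs g
  ∑-cong-∈ []       f≡g = refl
  ∑-cong-∈ (x ∷ xs) f≡g = cong₂ _+_ (f≡g (here refl)) (∑-cong-∈ xs (f≡g ∘ there))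

  ∑-cong : ∀ (xs : List A) {f g : A → ℤ} → (∀ x → f x ≡ g x) → ∑ xs f ≡ ∑ xs g
  ∑-cong xs f≡g = ∑-cong-∈ xs (λ {x} _ → f≡g x)

  ∑-mono-∈ : ∀ (xs : List A) {f g : A → ℤ} → (∀ {x} → x ∈ xs → f x ≤ g x) → ∑ xs f ≤ ∑ xs g
  ∑-mono-∈ []       f≤g = ≤-refl
  ∑-mono-∈ (x ∷ xs) f≤g = +-mono-≤ (f≤g (here refl)) (∑-mono-∈ xs (f≤g ∘ there))

  ∑-mono : ∀ (xs : List A) {f g : A → ℤ} → (∀ x → f x ≤ g x) → ∑ xs f ≤ ∑ xs g
  ∑-mono xs f≤g = ∑-mono-∈ xs (λ {x} _ → f≤g x)

  ∑-const : ∀ (xs : List A) c → ∑ xs (λ _ → c) ≡ + length xs * c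
  ∑-const []       c = sym (*-zeroˡ c)
  ∑-const (x ∷ xs) c = begin
    c + ∑ xs (λ _ → c)      ≡⟨ cong (_+_ c) (∑-const xs c) ⟩
    c + + length xs * c     ≡⟨ suc-* (+ length xs) c ⟨
    + ℕ.suc (length xs) * c ∎
    where open ≡-Reasoning

  ∑-0 : ∀ (xs : List A) → ∑ xs (λ _ → 0ℤ) ≡ 0ℤ
  ∑-0 xs = ≡-trans (∑-const xs 0ℤ) (*-zeroʳ (+ length xs))

  ∑-0≤ : ∀ (xs : List A) {f : A → ℤ} → (∀ x → 0ℤ ≤ f x) → 0ℤ ≤ ∑ xs f
  ∑-0≤ xs {f} 0≤f = subst (_≤ ∑ xs f) (∑-0 xs) (∑-mono xs 0≤f)

  ∑-+ : ∀ (xs : List A) (f g : A → ℤ) → ∑ xs (λ x → f x + g x) ≡ ∑ xs f + ∑ xs g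
  ∑-+ []       f g = refl
  ∑-+ (x ∷ xs) f g rewrite ∑-+ xs f g = lemma (f x) (g x) (∑ xs f) (∑ xs g)
    where
    lemma : ∀ a b c d → (a + b) + (c + d) ≡ (a + c) + (b + d)
    lemma = solve-∀

  ∑-*ˡ : ∀ (xs : List A) c (f : A → ℤ) → ∑ xs (λ x → c * f x) ≡ c * ∑ xs f
  ∑-*ˡ []       c f = sym (*-zeroʳ c)
  ∑-*ˡ (x ∷ xs) c f rewrite ∑-*ˡ xs c f = sym (*-distribˡ-+ c (f x) (∑ xs f))

  ∑-*ʳ : ∀ (xs : List A) c (f : A → ℤ) → ∑ xs (λ x → f x * c) ≡ ∑ xs f * c
  ∑-*ʳ xs c f = begin
    ∑ xs (λ x → f x * c) ≡⟨ ∑-cong xs (λ x → *-comm (f x) c) ⟩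
    ∑ xs (λ x → c * f x) ≡⟨ ∑-*ˡ xs c f ⟩
    c * ∑ xs f           ≡⟨ *-comm c (∑ xs f) ⟩
    ∑ xs f * c           ∎
    where open ≡-Reasoning

  ∑-swap : ∀ (xs : List A) (ys : List B) (f : A → B → ℤ) →
           ∑ xs (λ x → ∑ ys (f x)) ≡ ∑ ys (λ y → ∑ xs (λ x → f x y))
  ∑-swap []       ys f = sym (∑-0 ys)
  ∑-swap (x ∷ xs) ys f rewrite ∑-swap xs ys f = sym (∑-+ ys (f x) _)

  ∑-*-∑ : ∀ (xs : List A) (ys : List B) (f : A → ℤ) (g : B → ℤ) →
          ∑ xs f * ∑ ys g ≡ ∑ xs (λ x → ∑ ys (λ y → f x * g y))
  ∑-*-∑ xs ys f g = begin
    ∑ xs f * ∑ ys g                    ≡⟨ ∑-*ʳ xs (∑ ys g) f ⟨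
    ∑ xs (λ x → f x * ∑ ys g)          ≡⟨ ∑-cong xs (λ x → sym (∑-*ˡ ys (f x) g)) ⟩
    ∑ xs (λ x → ∑ ys (λ y → f x * g y)) ∎
    where open ≡-Reasoning

  ∑-++ : ∀ (xs ys : List A) (f : A → ℤ) → ∑ (xs ++ ys) f ≡ ∑ xs f + ∑ ys f
  ∑-++ []       ys f = sym (+-identityˡ (∑ ys f))
  ∑-++ (x ∷ xs) ys f rewrite ∑-++ xs ys f = sym (+-assoc (f x) (∑ xs f) (∑ ys f))

  ∑-map : ∀ (xs : List A) (g : A → B) (f : B → ℤ) → ∑ (map g xs) f ≡ ∑ xs (f ∘ g)
  ∑-map []       g f = refl
  ∑-map (x ∷ xs) g f = cong (_+_ (f (g x))) (∑-map xs g f)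

  ∑-cartesianProductWith : ∀ (_∙_ : A → B → C) xs ys (f : C → ℤ) →
    ∑ (cartesianProductWith _∙_ xs ys) f ≡ ∑ xs (λ x → ∑ ys (λ y → f (x ∙ y)))
  ∑-cartesianProductWith _∙_ []       ys f = refl
  ∑-cartesianProductWith _∙_ (x ∷ xs) ys f = begin
    ∑ (map (x ∙_) ys ++ cartesianProductWith _∙_ xs ys) f
      ≡⟨ ∑-++ (map (x ∙_) ys) _ f ⟩
    ∑ (map (x ∙_) ys) f + ∑ (cartesianProductWith _∙_ xs ys) f
      ≡⟨ cong₂ _+_ (∑-map ys (x ∙_) f) (∑-cartesianProductWith _∙_ xs ys f) ⟩
    ∑ (x ∷ xs) (λ x → ∑ ys (λ y → f (x ∙ y))) ∎
    where open ≡-Reasoning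

  ∑-↭ : ∀ {xs ys : List A} → xs ↭ ys → ∀ f → ∑ xs f ≡ ∑ ys f
  ∑-↭ refl             f = refl
  ∑-↭ (prep x p)       f = cong (_+_ (f x)) (∑-↭ p f)
  ∑-↭ (swap {xs} {ys} x y p) f rewrite ∑-↭ p f = lemma (f x) (f y) (∑ ys f)
    where
    lemma : ∀ a b c → a + (b + c) ≡ b + (a + c)
    lemma = solve-∀
  ∑-↭ (trans p q)      f = ≡-trans (∑-↭ p f) (∑-↭ q f)

  -- Lagrange's identity makes the gap half of a double sum of squares.
  cauchy-schwarz : ∀ (xs : List A) (f g : A → ℤ) →
                   (∑ xs (λ x → f x * g x)) ² ≤ ∑ xs (λ x → f x ²) * ∑ xs (λ x → g x ²)
  cauchy-schwarz {A = A} xs f g = *-cancelˡ-≤-pos (S ²) (F * G) (+ 2) (0≤i-j⇒j≤i (subst (0ℤ ≤_) eq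
    (∑-0≤ xs λ x → ∑-0≤ xs λ y → 0≤i² (f x * g y - f y * g x))))
    where
    open ≡-Reasoning
    S = ∑ xs (λ x → f x * g x)
    F = ∑ xs (λ x → f x ²)
    G = ∑ xs (λ x → g x ²)
    expand : ∀ a b c d → (a * d - c * b) * (a * d - c * b) ≡
             (a * a) * (d * d) + ((b * b) * (c * c) + (- (+ 2)) * ((a * b) * (c * d)))
    expand = solve-∀
    collect : ∀ s f g → f * g + (g * f + (- (+ 2)) * (s * s)) ≡ + 2 * (f * g) - + 2 * (s * s)
    collect = solve-∀
    combine : ∀ c (f g h : A → ℤ) →
                ∑ xs (λ x → f x + (g x + c * h x)) ≡ ∑ xs f + (∑ xs g + c * ∑ xs h)
    combine c f g h = begin
        ∑ xs (λ x → f x + (g x + c * h x))       ≡⟨ ∑-+ xs f (λ x → g x + c * h x) ⟩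
        ∑ xs f + ∑ xs (λ x → g x + c * h x)      ≡⟨ cong (_+_ (∑ xs f)) (∑-+ xs g (λ x → c * h x)) ⟩
        ∑ xs f + (∑ xs g + ∑ xs (λ x → c * h x)) ≡⟨ cong (λ i → ∑ xs f + (∑ xs g + i)) (∑-*ˡ xs c h) ⟩
        ∑ xs f + (∑ xs g + c * ∑ xs h)           ∎
    u v w : A → A → ℤ
    u x y = f x ² * g y ²
    v x y = g x ² * f y ²
    w x y = (f x * g x) * (f y * g y)
    eq : ∑ xs (λ x → ∑ xs (λ y → (f x * g y - f y * g x) ²)) ≡ + 2 * (F * G) - + 2 * S ²
    eq = begin
      ∑ xs (λ x → ∑ xs (λ y → (f x * g y - f y * g x) ²))
        ≡⟨ ∑-cong xs (λ x → ∑-cong xs (λ y → expand (f x) (g x) (f y) (g y))) ⟩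
      ∑ xs (λ x → ∑ xs (λ y → u x y + (v x y + (- (+ 2)) * w x y)))
        ≡⟨ ∑-cong xs (λ x → combine (- (+ 2)) (u x) (v x) (w x)) ⟩
      ∑ xs (λ x → ∑ xs (u x) + (∑ xs (v x) + (- (+ 2)) * ∑ xs (w x)))
        ≡⟨ combine (- (+ 2)) (λ x → ∑ xs (u x)) (λ x → ∑ xs (v x)) (λ x → ∑ xs (w x)) ⟩
      ∑ xs (λ x → ∑ xs (u x)) + (∑ xs (λ x → ∑ xs (v x)) + (- (+ 2)) * ∑ xs (λ x → ∑ xs (w x)))
        ≡⟨ cong₂ _+_ (∑-*-∑ xs xs (λ x → f x ²) (λ y → g y ²))
             (cong₂ (λ i j → i + (- (+ 2)) * j) (∑-*-∑ xs xs (λ x → g x ²) (λ y → f y ²))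
               (∑-*-∑ xs xs (λ x → f x * g x) (λ y → f y * g y))) ⟨
      F * G + (G * F + (- (+ 2)) * S ²)
        ≡⟨ collect S F G ⟩
      + 2 * (F * G) - + 2 * S ² ∎

  ∑²≤length*∑² : ∀ (xs : List A) (f : A → ℤ) → (∑ xs f) ² ≤ + length xs * ∑ xs (λ x → f x ²)
  ∑²≤length*∑² xs f = begin
    (∑ xs f) ²                          ≡⟨ cong _² (∑-cong xs (λ x → sym (*-identityˡ (f x)))) ⟩
    (∑ xs (λ x → 1ℤ * f x)) ²           ≤⟨ cauchy-schwarz xs (λ _ → 1ℤ) f ⟩
    ∑ xs (λ _ → 1ℤ) * ∑ xs (λ x → f x ²) ≡⟨ cong (_* ∑ xs (λ x → f x ²)) (≡-trans (∑-const xs 1ℤ) (*-identityʳ (+ length xs))) ⟩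
    + length xs * ∑ xs (λ x → f x ²)    ∎
    where open ≤-Reasoning

-- Sums over residues: multiplicities, periodic functions, dilation by units.

module ResidueSums where

  open FiniteSums
  open import Data.Integer.Base hiding (suc; NonZero; ∣_∣; _%_; _/_)
  open import Data.Integer.Properties
  open import Data.Integer.Tactic.RingSolver using (solve-∀)
  open import Data.List.Base using (List; []; _∷_; [_]; _++_; map; length; upTo; applyUpTo)
  open import Data.List.Membership.Propositional using (_∈_)
  open import Data.List.Membership.Propositional.Properties
    using (∈-upTo⁺; ∈-∃++; ∈-++⁺ˡ; ∈-++⁺ʳ; ∈-++⁻; ∈-applyUpTo⁻)
  open import Data.List.Properties using (length-upTo; length-applyUpTo; map-upTo)
  open import Data.List.Relation.Binary.Permutation.Propositional
    using (_↭_; ↭-refl; ↭-prep; ↭-sym; ↭-trans)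
  open import Data.List.Relation.Binary.Permutation.Propositional.Properties using (↭-length; shift)
  open import Data.List.Relation.Binary.Subset.Propositional using (_⊆_)
  open import Data.List.Relation.Unary.All using (lookup)
  open import Data.List.Relation.Unary.AllPairs using ([]; _∷_)
  open import Data.List.Relation.Unary.Any using (here; there)
  open import Data.List.Relation.Unary.Unique.Propositional using (Unique)
  open import Data.List.Relation.Unary.Unique.Propositional.Properties using (applyUpTo⁺₁)
  open import Data.Nat.Base as ℕ using (ℕ; zero; suc)
  open import Data.Nat.Coprimality as Coprimality using (Coprime; coprime-divisor)
  open import Data.Nat.DivMod using (_%_; _/_; m≡m%n+[m/n]*n; m%n<n)
  open import Data.Nat.Divisibility using (_∣_; divides; ∣⇒≤; ∣m+n∣m⇒∣n)
  import Data.Nat.Properties as ℕ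
  open import Data.Nat.Tactic.RingSolver as ℕ-Solver using ()
  open import Data.Product.Base using (_,_)
  open import Data.Sum.Base using (inj₁; inj₂)
  open import Function.Base using (_∘_)
  open import Relation.Binary.PropositionalEquality
    using (_≡_; _≢_; refl; sym; trans; cong; cong₂; subst; module ≡-Reasoning)
  open import Relation.Nullary.Negation using (contradiction)

  ∑-upTo-suc : ∀ n f → ∑ (upTo (suc n)) f ≡ f 0 + ∑ (upTo n) (f ∘ suc)
  ∑-upTo-suc n f = cong (_+_ (f 0)) (trans
    (cong (λ xs → ∑ xs f) (sym (map-upTo suc n)))
    (∑-map (upTo n) suc f))

  ∑-upTo-+ : ∀ m n f → ∑ (upTo (m ℕ.+ n)) f ≡ ∑ (upTo m) f + ∑ (upTo n) (λ i → f (m ℕ.+ i))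
  ∑-upTo-+ zero    n f = sym (+-identityˡ _)
  ∑-upTo-+ (suc m) n f = begin
    ∑ (upTo (suc (m ℕ.+ n))) f
      ≡⟨ ∑-upTo-suc (m ℕ.+ n) f ⟩
    f 0 + ∑ (upTo (m ℕ.+ n)) (f ∘ suc)
      ≡⟨ cong (_+_ (f 0)) (∑-upTo-+ m n (f ∘ suc)) ⟩
    f 0 + (∑ (upTo m) (f ∘ suc) + rest)
      ≡⟨ +-assoc (f 0) _ _ ⟨
    f 0 + ∑ (upTo m) (f ∘ suc) + rest
      ≡⟨ cong (_+ rest) (∑-upTo-suc m f) ⟨
    ∑ (upTo (suc m)) f + rest ∎
    where
    open ≡-Reasoning
    rest = ∑ (upTo n) (λ i → f (suc m ℕ.+ i))

  ∑-upTo-* : ∀ m n f → ∑ (upTo (m ℕ.* n)) f ≡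
             ∑ (upTo m) (λ i → ∑ (upTo n) (λ j → f (i ℕ.* n ℕ.+ j)))
  ∑-upTo-* zero    n f = refl
  ∑-upTo-* (suc m) n f = begin
    ∑ (upTo (n ℕ.+ m ℕ.* n)) f
      ≡⟨ ∑-upTo-+ n (m ℕ.* n) f ⟩
    ∑ (upTo n) f + ∑ (upTo (m ℕ.* n)) (λ i → f (n ℕ.+ i))
      ≡⟨ cong (_+_ (∑ (upTo n) f)) (∑-upTo-* m n (λ i → f (n ℕ.+ i))) ⟩
    ∑ (upTo n) f + ∑ (upTo m) (λ i → ∑ (upTo n) (λ j → f (n ℕ.+ (i ℕ.* n ℕ.+ j))))
      ≡⟨ cong (_+_ (∑ (upTo n) f)) (∑-cong (upTo m) (λ i → ∑-cong (upTo n) (λ j →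
           cong f (sym (ℕ.+-assoc n (i ℕ.* n) j))))) ⟩
    ∑ (upTo n) f + ∑ (upTo m) (λ i → ∑ (upTo n) (λ j → f (suc i ℕ.* n ℕ.+ j)))
      ≡⟨ ∑-upTo-suc m (λ i → ∑ (upTo n) (λ j → f (i ℕ.* n ℕ.+ j))) ⟨
    ∑ (upTo (suc m)) (λ i → ∑ (upTo n) (λ j → f (i ℕ.* n ℕ.+ j))) ∎
    where open ≡-Reasoning

  -- Integer valued, so that the multiplicity of n in a list is `∑ xs (λ x → δ x n)` and can be
  -- interchanged with other sums.
  δ : ℕ → ℕ → ℤ
  δ zero    zero    = 1ℤ
  δ zero    (suc n) = 0ℤ
  δ (suc m) zero    = 0ℤ
  δ (suc m) (suc n) = δ m n

  0≤δ : ∀ m n → 0ℤ ≤ δ m n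
  0≤δ zero    zero    = +≤+ ℕ.z≤n
  0≤δ zero    (suc n) = ≤-refl
  0≤δ (suc m) zero    = ≤-refl
  0≤δ (suc m) (suc n) = 0≤δ m n

  δ≤1 : ∀ m n → δ m n ≤ 1ℤ
  δ≤1 zero    zero    = ≤-refl
  δ≤1 zero    (suc n) = +≤+ ℕ.z≤n
  δ≤1 (suc m) zero    = +≤+ ℕ.z≤n
  δ≤1 (suc m) (suc n) = δ≤1 m n

  δ-refl : ∀ n → δ n n ≡ 1ℤ
  δ-refl zero    = refl
  δ-refl (suc n) = δ-refl n

  δ-≢ : ∀ {m n} → m ≢ n → δ m n ≡ 0ℤ
  δ-≢ {zero}  {zero}  m≢n = contradiction refl m≢n
  δ-≢ {zero}  {suc n} m≢n = refl
  δ-≢ {suc m} {zero}  m≢n = refl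
  δ-≢ {suc m} {suc n} m≢n = δ-≢ (m≢n ∘ cong suc)

  ∑-δ : ∀ {m N} → m ℕ.< N → ∀ (G : ℕ → ℤ) → ∑ (upTo N) (λ n → δ m n * G n) ≡ G m
  ∑-δ {zero} {suc N} _ G = begin
    ∑ (upTo (suc N)) (λ n → δ 0 n * G n)        ≡⟨ ∑-upTo-suc N (λ n → δ 0 n * G n) ⟩
    1ℤ * G 0 + ∑ (upTo N) (λ n → 0ℤ * G (suc n)) ≡⟨ cong₂ _+_ (*-identityˡ (G 0))
      (trans (∑-cong (upTo N) (λ n → *-zeroˡ (G (suc n)))) (∑-0 (upTo N))) ⟩
    G 0 + 0ℤ                                     ≡⟨ +-identityʳ (G 0) ⟩
    G 0                                          ∎
    where open ≡-Reasoning
  ∑-δ {suc m} {suc N} (ℕ.s≤s m<N) G = begin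
    ∑ (upTo (suc N)) (λ n → δ (suc m) n * G n)          ≡⟨ ∑-upTo-suc N (λ n → δ (suc m) n * G n) ⟩
    0ℤ * G 0 + ∑ (upTo N) (λ n → δ m n * G (suc n))     ≡⟨ cong₂ _+_ (*-zeroˡ (G 0)) (∑-δ m<N (G ∘ suc)) ⟩
    0ℤ + G (suc m)                                      ≡⟨ +-identityˡ (G (suc m)) ⟩
    G (suc m)                                           ∎
    where open ≡-Reasoning

  -- Grouping the entries by value counts each n < N at most M times, and the terms are nonnegative.
  -- This replaces a sum over products of primes by one over all integers of an interval.
  ∑-≤-multiplicity : ∀ xs {M N G} → (∀ n → ∑ xs (λ x → δ x n) ≤ M) →
                     (∀ {x} → x ∈ xs → x ℕ.< N) → (∀ n → 0ℤ ≤ G n) →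
                     ∑ xs G ≤ M * ∑ (upTo N) G
  ∑-≤-multiplicity xs {M} {N} {G} mult x<N 0≤G = begin
    ∑ xs G
      ≡⟨ ∑-cong-∈ xs (λ x∈xs → sym (∑-δ (x<N x∈xs) G)) ⟩
    ∑ xs (λ x → ∑ (upTo N) (λ n → δ x n * G n))
      ≡⟨ ∑-swap xs (upTo N) (λ x n → δ x n * G n) ⟩
    ∑ (upTo N) (λ n → ∑ xs (λ x → δ x n * G n))
      ≡⟨ ∑-cong (upTo N) (λ n → ∑-*ʳ xs (G n) (λ x → δ x n)) ⟩
    ∑ (upTo N) (λ n → ∑ xs (λ x → δ x n) * G n)
      ≤⟨ ∑-mono (upTo N) (λ n → *-monoʳ-≤-nonNeg (G n) {{nonNegative (0≤G n)}} (mult n)) ⟩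
    ∑ (upTo N) (λ n → M * G n)
      ≡⟨ ∑-*ˡ (upTo N) M G ⟩
    M * ∑ (upTo N) G ∎
    where open ≤-Reasoning

  -- Pigeonhole: each entry of `xs` is removed from `ys` in turn, and the lengths leave nothing
  -- over.
  unique∧⊆⇒↭ : ∀ {A : Set} {xs ys : List A} → Unique xs → xs ⊆ ys →
               length ys ℕ.≤ length xs → xs ↭ ys
  unique∧⊆⇒↭ {xs = []} {[]} _ _ _ = ↭-refl
  unique∧⊆⇒↭ {xs = x ∷ xs} (x∉xs ∷ xs!) xs⊆ys len
    with as , bs , refl ← ∈-∃++ (xs⊆ys (here refl)) =
    ↭-trans (↭-prep x (unique∧⊆⇒↭ xs! xs⊆as++bs len′)) (↭-sym (shift x as bs))
    where
    len′ = ℕ.s≤s⁻¹ (subst (ℕ._≤ suc (length xs)) (↭-length (shift x as bs)) len)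
    xs⊆as++bs : xs ⊆ as ++ bs
    xs⊆as++bs {z} z∈xs with ∈-++⁻ as (xs⊆ys (there z∈xs))
    ... | inj₁ z∈as         = ∈-++⁺ˡ z∈as
    ... | inj₂ (here z≡x)   = contradiction (sym z≡x) (lookup x∉xs z∈xs)
    ... | inj₂ (there z∈bs) = ∈-++⁺ʳ as z∈bs

  -- The congruent numbers are written as x and x + d, which avoids subtraction.
  %≡%⇒∣-difference : ∀ {x d p} .{{_ : ℕ.NonZero p}} → (x ℕ.+ d) % p ≡ x % p → p ∣ d
  %≡%⇒∣-difference {x} {d} {p} eq = ∣m+n∣m⇒∣n
    (divides ((x ℕ.+ d) / p) (ℕ.+-cancelˡ-≡ (x % p) _ _ (begin
      x % p ℕ.+ (x / p ℕ.* p ℕ.+ d)         ≡⟨ ℕ.+-assoc (x % p) (x / p ℕ.* p) d ⟨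
      x % p ℕ.+ x / p ℕ.* p ℕ.+ d           ≡⟨ cong (ℕ._+ d) (m≡m%n+[m/n]*n x p) ⟨
      x ℕ.+ d                               ≡⟨ m≡m%n+[m/n]*n (x ℕ.+ d) p ⟩
      (x ℕ.+ d) % p ℕ.+ (x ℕ.+ d) / p ℕ.* p ≡⟨ cong (ℕ._+ (x ℕ.+ d) / p ℕ.* p) eq ⟩
      x % p ℕ.+ (x ℕ.+ d) / p ℕ.* p         ∎)))
    (divides (x / p) refl)
    where open ≡-Reasoning

  Periodic : ℕ → (ℕ → ℤ) → Set
  Periodic p f = ∀ x → f (p ℕ.+ x) ≡ f x

  module _ {p : ℕ} where

    periodic-*+ : ∀ {f} → Periodic p f → ∀ k x → f (k ℕ.* p ℕ.+ x) ≡ f x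
    periodic-*+ per zero    x = refl
    periodic-*+ {f} per (suc k) x = begin
      f (p ℕ.+ k ℕ.* p ℕ.+ x)   ≡⟨ cong f (ℕ.+-assoc p (k ℕ.* p) x) ⟩
      f (p ℕ.+ (k ℕ.* p ℕ.+ x)) ≡⟨ per (k ℕ.* p ℕ.+ x) ⟩
      f (k ℕ.* p ℕ.+ x)         ≡⟨ periodic-*+ per k x ⟩
      f x                       ∎
      where open ≡-Reasoning

    periodic-% : ∀ .{{_ : ℕ.NonZero p}} {f} → Periodic p f → ∀ x → f (x % p) ≡ f x
    periodic-% {f} per x = begin
      f (x % p)                   ≡⟨ periodic-*+ per (x / p) (x % p) ⟨
      f (x / p ℕ.* p ℕ.+ x % p)   ≡⟨ cong f (ℕ.+-comm (x / p ℕ.* p) (x % p)) ⟩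
      f (x % p ℕ.+ x / p ℕ.* p)   ≡⟨ cong f (m≡m%n+[m/n]*n x p) ⟨
      f x                         ∎
      where open ≡-Reasoning

    periodic-dilate : ∀ {f} → Periodic p f → ∀ l → Periodic p (λ x → f (l ℕ.* x))
    periodic-dilate {f} per l x = begin
      f (l ℕ.* (p ℕ.+ x))       ≡⟨ cong f (ℕ.*-distribˡ-+ l p x) ⟩
      f (l ℕ.* p ℕ.+ l ℕ.* x)   ≡⟨ periodic-*+ per l (l ℕ.* x) ⟩
      f (l ℕ.* x)               ∎
      where open ≡-Reasoning

    periodic-%≡0 : ∀ .{{_ : ℕ.NonZero p}} {f} → Periodic p f → ∀ {x} → p ∣ x → f x ≡ f 0
    periodic-%≡0 {f} per (divides q refl) =
      trans (cong f (sym (ℕ.+-identityʳ (q ℕ.* p)))) (periodic-*+ per q 0)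

    ∑-shift : ∀ {f} → Periodic p f → ∀ z → ∑ (upTo p) (λ x → f (z ℕ.+ x)) ≡ ∑ (upTo p) f
    ∑-shift per zero = refl
    ∑-shift {f} per (suc z) = trans (∑-shift₁ f′-per) (∑-shift per z)
      where
      f′-per : Periodic p (λ x → f (z ℕ.+ x))
      f′-per x = trans (cong f (lemma z p x)) (per (z ℕ.+ x))
        where
        lemma : ∀ z p x → z ℕ.+ (p ℕ.+ x) ≡ p ℕ.+ (z ℕ.+ x)
        lemma = ℕ-Solver.solve-∀
      -- A shift by one trades the first term for the equal term one period later; both sums are
      -- completed to the same p + 1 terms.
      ∑-shift₁ : Periodic p (λ x → f (z ℕ.+ x)) →
                 ∑ (upTo p) (λ x → f (suc (z ℕ.+ x))) ≡ ∑ (upTo p) (λ x → f (z ℕ.+ x))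
      ∑-shift₁ per′ = +-cancel (f (z ℕ.+ 0)) _ _ (begin
        f (z ℕ.+ 0) + ∑ (upTo p) (λ x → f (suc (z ℕ.+ x)))
          ≡⟨ cong (_+_ (f (z ℕ.+ 0))) (∑-cong (upTo p) (λ x → cong f (sym (ℕ.+-suc z x)))) ⟩
        f (z ℕ.+ 0) + ∑ (upTo p) (λ x → f (z ℕ.+ suc x))
          ≡⟨ ∑-upTo-suc p (λ x → f (z ℕ.+ x)) ⟨
        ∑ (upTo (suc p)) (λ x → f (z ℕ.+ x))
          ≡⟨ cong (λ n → ∑ (upTo n) (λ x → f (z ℕ.+ x))) (ℕ.+-comm p 1) ⟨
        ∑ (upTo (p ℕ.+ 1)) (λ x → f (z ℕ.+ x))
          ≡⟨ ∑-upTo-+ p 1 (λ x → f (z ℕ.+ x)) ⟩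
        ∑ (upTo p) (λ x → f (z ℕ.+ x)) + (f (z ℕ.+ (p ℕ.+ 0)) + 0ℤ)
          ≡⟨ cong (_+_ (∑ (upTo p) (λ x → f (z ℕ.+ x)))) (trans (+-identityʳ _) (per′ 0)) ⟩
        ∑ (upTo p) (λ x → f (z ℕ.+ x)) + f (z ℕ.+ 0)
          ≡⟨ +-comm _ (f (z ℕ.+ 0)) ⟩
        f (z ℕ.+ 0) + ∑ (upTo p) (λ x → f (z ℕ.+ x)) ∎)
        where
        open ≡-Reasoning
        +-cancel : ∀ i j k → i + j ≡ i + k → j ≡ k
        +-cancel i j k eq = trans (lemma i j) (trans (cong (_- i) eq) (sym (lemma i k)))
          where
          lemma : ∀ i j → j ≡ (i + j) - i
          lemma = solve-∀

    -- Multiplication by a unit permutes the residues: if l i ≡ l j with j = i + k, then p divides k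
    -- although 0 < k < p.
    ∑-dilate : ∀ .{{_ : ℕ.NonZero p}} {f l} → Periodic p f → Coprime p l →
               ∑ (upTo p) (λ x → f (l ℕ.* x)) ≡ ∑ (upTo p) f
    ∑-dilate {f} {l} per p⊥l = begin
      ∑ (upTo p) (λ x → f (l ℕ.* x))     ≡⟨ ∑-cong (upTo p) (λ x → sym (periodic-% per (l ℕ.* x))) ⟩
      ∑ (upTo p) (λ x → f (l ℕ.* x % p)) ≡⟨ ∑-map (upTo p) g f ⟨
      ∑ (map g (upTo p)) f               ≡⟨ cong (λ xs → ∑ xs f) (map-upTo g p) ⟩
      ∑ (applyUpTo g p) f                ≡⟨ ∑-↭ (unique∧⊆⇒↭ unique sub len) f ⟩
      ∑ (upTo p) f                       ∎
      where
      open ≡-Reasoning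
      g : ℕ → ℕ
      g x = l ℕ.* x % p
      unique : Unique (applyUpTo g p)
      unique = applyUpTo⁺₁ g p inj
        where
        inj : ∀ {i j} → i ℕ.< j → j ℕ.< p → g i ≢ g j
        inj {i} {j} i<j j<p gi≡gj with k , refl ← ℕ.m≤n⇒∃[o]m+o≡n (ℕ.<⇒≤ i<j) =
          ℕ.<⇒≱ (ℕ.≤-<-trans (ℕ.m≤n+m k i) j<p) (∣⇒≤ {{ℕ.≢-nonZero k≢0}} p∣k)
          where
          k≢0 : k ≢ 0
          k≢0 refl = ℕ.<-irrefl (sym (ℕ.+-identityʳ i)) i<j
          p∣k : p ∣ k
          p∣k = coprime-divisor p⊥l (%≡%⇒∣-difference {l ℕ.* i} {l ℕ.* k} (begin
            (l ℕ.* i ℕ.+ l ℕ.* k) % p ≡⟨ cong (_% p) (ℕ.*-distribˡ-+ l i k) ⟨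
            l ℕ.* (i ℕ.+ k) % p       ≡⟨ gi≡gj ⟨
            l ℕ.* i % p               ∎))
      sub : applyUpTo g p ⊆ upTo p
      sub x∈ with i , _ , refl ← ∈-applyUpTo⁻ g x∈ = ∈-upTo⁺ (m%n<n (l ℕ.* i) p)
      len : length (upTo p) ℕ.≤ length (applyUpTo g p)
      len = ℕ.≤-reflexive (trans (length-upTo p) (sym (length-applyUpTo g p)))

  -- Over a full period p q the Chinese remainder theorem decouples the two factors,
  -- so only an incomplete period contributes.
  ∑-periodic-*-periodic-≤ : ∀ {p q} .{{_ : ℕ.NonZero p}} .{{_ : ℕ.NonZero q}} {φ ψ B} →
    Coprime p q → Periodic p φ → Periodic q ψ → ∑ (upTo p) φ ≡ 0ℤ →
    (∀ n → φ n ² ≤ B) → (∀ n → ψ n ² ≤ B) →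
    ∀ N → ∑ (upTo N) (λ n → φ n * ψ n) ≤ + (p ℕ.* q) * B
  ∑-periodic-*-periodic-≤ {p} {q} {φ} {ψ} {B} p⊥q φ-per ψ-per ∑φ≡0 φ²≤B ψ²≤B N = begin
    ∑ (upTo N) F
      ≡⟨ cong (λ n → ∑ (upTo n) F) (trans (m≡m%n+[m/n]*n N pq) (ℕ.+-comm (N % pq) _)) ⟩
    ∑ (upTo (N / pq ℕ.* pq ℕ.+ N % pq)) F
      ≡⟨ ∑-upTo-+ (N / pq ℕ.* pq) (N % pq) F ⟩
    ∑ (upTo (N / pq ℕ.* pq)) F + ∑ (upTo (N % pq)) _
      ≡⟨ cong₂ _+_ full (∑-cong (upTo (N % pq)) (λ x → periodic-*+ {p = pq} F-per (N / pq) x)) ⟩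
    0ℤ + ∑ (upTo (N % pq)) F
      ≡⟨ +-identityˡ _ ⟩
    ∑ (upTo (N % pq)) F
      ≤⟨ ∑-mono (upTo (N % pq)) (λ n → i*j≤k {φ n} {ψ n} (φ²≤B n) (ψ²≤B n)) ⟩
    ∑ (upTo (N % pq)) (λ _ → B)
      ≡⟨ trans (∑-const (upTo (N % pq)) B) (cong (λ n → + n * B) (length-upTo (N % pq))) ⟩
    + (N % pq) * B
      ≤⟨ *-monoʳ-≤-nonNeg B {{nonNegative (≤-trans (0≤i² (φ 0)) (φ²≤B 0))}} (+≤+ (ℕ.<⇒≤ (m%n<n N pq))) ⟩
    + pq * B ∎
    where
    open ≤-Reasoning
    pq = p ℕ.* q
    instance
      pq≢0 : ℕ.NonZero (p ℕ.* q)
      pq≢0 = ℕ.m*n≢0 p q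
    F : ℕ → ℤ
    F n = φ n * ψ n
    F-per : Periodic pq F
    F-per x = cong₂ _*_
      (trans (cong φ (cong (ℕ._+ x) (ℕ.*-comm p q))) (periodic-*+ φ-per q x))
      (periodic-*+ ψ-per p x)
    -- With n = i q + j, the factor ψ depends on j alone, while for fixed j the numbers i q + j run
    -- through all residues modulo p, over which φ sums to 0.
    block : ∑ (upTo pq) F ≡ 0ℤ
    block = begin-equality
      ∑ (upTo pq) F
        ≡⟨ ∑-upTo-* p q F ⟩
      ∑ (upTo p) (λ i → ∑ (upTo q) (λ j → F (i ℕ.* q ℕ.+ j)))
        ≡⟨ ∑-swap (upTo p) (upTo q) (λ i j → F (i ℕ.* q ℕ.+ j)) ⟩
      ∑ (upTo q) (λ j → ∑ (upTo p) (λ i → F (i ℕ.* q ℕ.+ j)))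
        ≡⟨ ∑-cong (upTo q) inner ⟩
      ∑ (upTo q) (λ _ → 0ℤ)
        ≡⟨ ∑-0 (upTo q) ⟩
      0ℤ ∎
      where
      inner : ∀ j → ∑ (upTo p) (λ i → F (i ℕ.* q ℕ.+ j)) ≡ 0ℤ
      inner j = begin-equality
        ∑ (upTo p) (λ i → φ (i ℕ.* q ℕ.+ j) * ψ (i ℕ.* q ℕ.+ j))
          ≡⟨ ∑-cong (upTo p) (λ i → cong₂ _*_
               (cong φ (trans (ℕ.+-comm (i ℕ.* q) j) (cong (ℕ._+_ j) (ℕ.*-comm i q))))
               (periodic-*+ ψ-per i j)) ⟩
        ∑ (upTo p) (λ i → φ (j ℕ.+ q ℕ.* i) * ψ j)
          ≡⟨ ∑-*ʳ (upTo p) (ψ j) _ ⟩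
        ∑ (upTo p) (λ i → φ (j ℕ.+ q ℕ.* i)) * ψ j
          ≡⟨ cong (_* ψ j) (∑-dilate {f = λ x → φ (j ℕ.+ x)} shift-per p⊥q) ⟩
        ∑ (upTo p) (λ i → φ (j ℕ.+ i)) * ψ j
          ≡⟨ cong (_* ψ j) (trans (∑-shift φ-per j) ∑φ≡0) ⟩
        0ℤ * ψ j
          ≡⟨ *-zeroˡ (ψ j) ⟩
        0ℤ ∎
        where
        shift-per : Periodic p (λ x → φ (j ℕ.+ x))
        shift-per x = trans (cong φ (lemma j p x)) (φ-per (j ℕ.+ x))
          where
          lemma : ∀ j p x → j ℕ.+ (p ℕ.+ x) ≡ p ℕ.+ (j ℕ.+ x)
          lemma = ℕ-Solver.solve-∀
    full : ∑ (upTo (N / pq ℕ.* pq)) F ≡ 0ℤ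
    full = begin-equality
      ∑ (upTo (N / pq ℕ.* pq)) F
        ≡⟨ ∑-upTo-* (N / pq) pq F ⟩
      ∑ (upTo (N / pq)) (λ i → ∑ (upTo pq) (λ j → F (i ℕ.* pq ℕ.+ j)))
        ≡⟨ ∑-cong (upTo (N / pq)) (λ i → trans (∑-cong (upTo pq) (λ j → periodic-*+ {p = pq} F-per i j)) block) ⟩
      ∑ (upTo (N / pq)) (λ _ → 0ℤ)
        ≡⟨ ∑-0 (upTo (N / pq)) ⟩
      0ℤ ∎

-- The sieve inequality for almost orthogonal functions.

module LargeSieve where

  open FiniteSums
  open import Data.Integer.Base hiding (suc)
  open import Data.Integer.Properties
  open import Data.Integer.Tactic.RingSolver using (solve-∀)
  open import Data.List.Base using (List; []; _∷_; length)
  open import Data.List.Relation.Unary.All as All using (All; []; _∷_)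
  open import Data.List.Relation.Unary.AllPairs using (AllPairs; []; _∷_)
  open import Relation.Binary.PropositionalEquality using (_≡_; sym; cong)

  -- The square is expanded one function at a time. All functions enter with coefficient 1, so upper
  -- bounds on the correlations suffice.
  ∑-∑² : ∀ {A W : Set} (xs : List A) (φ : W → A → ℤ) {D E} → 0ℤ ≤ E → ∀ ws →
         All (λ w → ∑ xs (λ x → φ w x ²) ≤ D) ws →
         AllPairs (λ w v → ∑ xs (λ x → φ w x * φ v x) ≤ E) ws →
         ∑ xs (λ x → (∑ ws (λ w → φ w x)) ²) ≤ + length ws * D + + length ws * + length ws * E
  ∑-∑² xs φ {D} {E} 0≤E [] [] [] = ≤-reflexive (∑-0 xs)
  ∑-∑² xs φ {D} {E} 0≤E (w ∷ ws) (diag ∷ diags) (off ∷ offs) = begin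
    ∑ xs (λ x → (φ w x + S x) ²)
      ≡⟨ ∑-cong xs (λ x → square (φ w x) (S x)) ⟩
    ∑ xs (λ x → φ w x ² + ((+ 2) * (φ w x * S x) + S x ²))
      ≡⟨ ∑-+ xs (λ x → φ w x ²) (λ x → (+ 2) * (φ w x * S x) + S x ²) ⟩
    ∑ xs (λ x → φ w x ²) + ∑ xs (λ x → (+ 2) * (φ w x * S x) + S x ²)
      ≡⟨ cong (_+_ (∑ xs (λ x → φ w x ²))) (∑-+ xs (λ x → (+ 2) * (φ w x * S x)) (λ x → S x ²)) ⟩
    ∑ xs (λ x → φ w x ²) + (∑ xs (λ x → (+ 2) * (φ w x * S x)) + ∑ xs (λ x → S x ²))
      ≡⟨ cong (λ i → ∑ xs (λ x → φ w x ²) + (i + ∑ xs (λ x → S x ²))) (∑-*ˡ xs (+ 2) (λ x → φ w x * S x)) ⟩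
    ∑ xs (λ x → φ w x ²) + ((+ 2) * ∑ xs (λ x → φ w x * S x) + ∑ xs (λ x → S x ²))
      ≤⟨ +-mono-≤ diag (+-mono-≤ (*-monoˡ-≤-nonNeg (+ 2) cross) (∑-∑² xs φ 0≤E ws diags offs)) ⟩
    D + ((+ 2) * (T * E) + (T * D + T * T * E))
      -- A further E rounds T² + 2T up to (T + 1)².
      ≡⟨ +-identityʳ X ⟨
    D + ((+ 2) * (T * E) + (T * D + T * T * E)) + 0ℤ
      ≤⟨ +-monoʳ-≤ X 0≤E ⟩
    D + ((+ 2) * (T * E) + (T * D + T * T * E)) + E
      ≡⟨ collect T D E ⟩
    (1ℤ + T) * D + (1ℤ + T) * (1ℤ + T) * E ∎
    where
    open ≤-Reasoning
    T = + length ws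
    X = D + ((+ 2) * (T * E) + (T * D + T * T * E))
    S : _ → ℤ
    S x = ∑ ws (λ v → φ v x)
    square : ∀ a b → (a + b) * (a + b) ≡ a * a + (+ 2 * (a * b) + b * b)
    square = solve-∀
    collect : ∀ t d e → d + (+ 2 * (t * e) + (t * d + t * t * e)) + e ≡
              (1ℤ + t) * d + (1ℤ + t) * (1ℤ + t) * e
    collect = solve-∀
    cross : ∑ xs (λ x → φ w x * S x) ≤ T * E
    cross = begin
      ∑ xs (λ x → φ w x * S x)
        ≡⟨ ∑-cong xs (λ x → sym (∑-*ˡ ws (φ w x) (λ v → φ v x))) ⟩
      ∑ xs (λ x → ∑ ws (λ v → φ w x * φ v x))
        ≡⟨ ∑-swap xs ws (λ x v → φ w x * φ v x) ⟩
      ∑ ws (λ v → ∑ xs (λ x → φ w x * φ v x))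
        ≤⟨ ∑-mono-∈ ws (λ v∈ws → All.lookup off v∈ws) ⟩
      ∑ ws (λ _ → E)
        ≡⟨ ∑-const ws E ⟩
      T * E ∎

-- Products of one prime from each block: size, square-freeness, multiplicity.

module Choices where

  open import Data.Nat.Base
  open import Data.Nat.Coprimality as Coprimality using (Coprime; coprime-divisor)
  open import Data.Nat.Divisibility
  open import Data.Nat.ListAction using (product)
  open import Data.Nat.Primality
  open import Data.Nat.Primality.Factorisation using (factorisationHasAllPrimeFactors)
  open import Data.Nat.Properties
  open import Data.List.Base using (List; []; _∷_; _++_; concat; map; length; cartesianProductWith)
  open import Data.List.Membership.DecPropositional _≟_ using (_∈?_)
  open import Data.List.Membership.Propositional using (_∈_)
  open import Data.List.Membership.Propositional.Properties
    using (∈-cartesianProductWith⁺; ∈-cartesianProductWith⁻; ∈-++⁺ˡ; ∈-++⁺ʳ)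
  open import Data.List.Properties using (length-++; length-map)
  open import Data.List.Relation.Binary.Subset.Propositional using (_⊆_)
  open import Data.List.Relation.Unary.All as All using (All; []; _∷_)
  import Data.List.Relation.Unary.All.Properties as All
  open import Data.List.Relation.Unary.AllPairs using ([]; _∷_)
  open import Data.List.Relation.Unary.Any using (here; there)
  open import Data.List.Relation.Unary.Unique.Propositional using (Unique)
  import Data.Integer.Base as ℤ
  import Data.Integer.Properties as ℤ
  open import Data.Product.Base using (_×_; _,_; ∃-syntax)
  open import Data.Sum.Base using (inj₁; inj₂)
  open FiniteSums
  open import Function.Base using (_∘_)
  open import Relation.Binary.PropositionalEquality
    using (_≡_; _≢_; refl; sym; trans; cong; cong₂; subst)
  open import Relation.Nullary using (yes; no; ¬_; contradiction)
  open ResidueSums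

  prime∣prime⇒≡ : ∀ {p q} → Prime p → Prime q → p ∣ q → p ≡ q
  prime∣prime⇒≡ p-prime q-prime p∣q with prime⇒irreducible q-prime p∣q
  ... | inj₁ refl = contradiction p-prime ¬prime[1]
  ... | inj₂ p≡q  = p≡q

  prime∤⇒coprime : ∀ {p n} → Prime p → ¬ p ∣ n → Coprime p n
  prime∤⇒coprime p-prime p∤n {d} (d∣p , d∣n) with prime⇒irreducible p-prime d∣p
  ... | inj₁ d≡1  = d≡1
  ... | inj₂ refl = contradiction d∣n p∤n

  -- Values are repeated once for every way of choosing the factors; for `replicate r P` these are
  -- the ordered products of r entries of P.
  choices : List (List ℕ) → List ℕ
  choices []       = 1 ∷ []
  choices (B ∷ Bs) = cartesianProductWith _*_ B (choices Bs)

  length-cartesianProductWith : ∀ {A B C : Set} (f : A → B → C) xs ys →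
    length (cartesianProductWith f xs ys) ≡ length xs * length ys
  length-cartesianProductWith f []       ys = refl
  length-cartesianProductWith f (x ∷ xs) ys = trans (length-++ (map (f x) ys))
    (cong₂ _+_ (length-map (f x) ys) (length-cartesianProductWith f xs ys))

  length-choices : ∀ {b} Bs → All (λ B → length B ≡ b) Bs → length (choices Bs) ≡ b ^ length Bs
  length-choices []       []            = refl
  length-choices (B ∷ Bs) (refl ∷ lens) =
    trans (length-cartesianProductWith _*_ B (choices Bs)) (cong (length B *_) (length-choices Bs lens))

  choices-≤ : ∀ {y} Bs → All (All (_≤ y)) Bs → ∀ {n} → n ∈ choices Bs → n ≤ y ^ length Bs
  choices-≤ []       []           (here refl) = ≤-refl
  choices-≤ (B ∷ Bs) (B≤y ∷ Bs≤y) n∈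
    with l , t , l∈B , t∈ , refl ← ∈-cartesianProductWith⁻ _*_ B (choices Bs) n∈ =
    *-mono-≤ (All.lookup B≤y l∈B) (choices-≤ Bs Bs≤y t∈)

  choices-++ : ∀ As {Bs m n} → m ∈ choices As → n ∈ choices Bs → m * n ∈ choices (As ++ Bs)
  choices-++ []       {Bs} {n = n} (here refl) n∈ = subst (_∈ choices Bs) (sym (*-identityˡ n)) n∈
  choices-++ (A ∷ As) {Bs} {n = n} m∈ n∈
    with l , t , l∈A , t∈ , refl ← ∈-cartesianProductWith⁻ _*_ A (choices As) m∈ =
    subst (_∈ choices (A ∷ As ++ Bs)) (sym (*-assoc l t n))
      (∈-cartesianProductWith⁺ _*_ l∈A (choices-++ As t∈ n∈))

  unique-++⁻ʳ : ∀ {A : Set} (xs : List A) {ys} → Unique (xs ++ ys) → Unique ys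
  unique-++⁻ʳ []       u       = u
  unique-++⁻ʳ (x ∷ xs) (_ ∷ u) = unique-++⁻ʳ xs u

  unique-++⇒≢ : ∀ {A : Set} (xs : List A) {ys} → Unique (xs ++ ys) →
                ∀ {x y} → x ∈ xs → y ∈ ys → x ≢ y
  unique-++⇒≢ (x ∷ xs) (x∉ ∷ u) (here refl) y∈ = All.lookup x∉ (∈-++⁺ʳ xs y∈)
  unique-++⇒≢ (x ∷ xs) (x∉ ∷ u) (there x∈)  y∈ = unique-++⇒≢ xs u x∈ y∈

  -- Disjointness of the blocks makes the chosen factors distinct, which is the source of
  -- square-freeness.
  choices-factors : ∀ Bs → Unique (concat Bs) → ∀ {n} → n ∈ choices Bs →
                    ∃[ ls ] n ≡ product ls × Unique ls × ls ⊆ concat Bs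
  choices-factors []       _    (here refl) = [] , refl , [] , λ ()
  choices-factors (B ∷ Bs) uniq n∈
    with l , t , l∈B , t∈ , refl ← ∈-cartesianProductWith⁻ _*_ B (choices Bs) n∈
    with ls , refl , ls! , ls⊆ ← choices-factors Bs (unique-++⁻ʳ B uniq) t∈ =
    l ∷ ls , refl , All.tabulate (λ m∈ls → unique-++⇒≢ B uniq l∈B (ls⊆ m∈ls)) ∷ ls! , sub
    where
    sub : l ∷ ls ⊆ B ++ concat Bs
    sub (here refl) = ∈-++⁺ˡ l∈B
    sub (there m∈)  = ∈-++⁺ʳ B (ls⊆ m∈)

  -- If r equals the head l, the other factor r divides the remaining product and so reappears among
  -- primes different from l. Otherwise l is coprime to r² and can be stripped off.
  product-squareFree : ∀ {ls} → All Prime ls → Unique ls → ∀ {r} → Prime r → ¬ (r * r ∣ product ls)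
  product-squareFree [] [] {r} r-prime r²∣1 =
    contradiction (subst Prime (∣1⇒≡1 (∣-trans (m∣m*n r) r²∣1)) r-prime) ¬prime[1]
  product-squareFree {l ∷ ls} (l-prime ∷ ls-prime) (l∉ls ∷ ls!) {r} r-prime r²∣ with r ∣? l
  ... | yes r∣l with refl ← prime∣prime⇒≡ r-prime l-prime r∣l =
    All.lookup l∉ls (factorisationHasAllPrimeFactors r-prime
      (*-cancelˡ-∣ r {{prime⇒nonZero r-prime}} r²∣) ls-prime) refl
  ... | no r∤l = product-squareFree ls-prime ls! r-prime
    (coprime-divisor (Coprimality.sym (prime∤⇒coprime l-prime l∤r²)) r²∣)
    where
    l∤r : ¬ l ∣ r
    l∤r l∣r = r∤l (∣-reflexive (sym (prime∣prime⇒≡ l-prime r-prime l∣r)))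
    l∤r² : ¬ l ∣ r * r
    l∤r² l∣r² with euclidsLemma r r l-prime l∣r²
    ... | inj₁ l∣r = l∤r l∣r
    ... | inj₂ l∣r = l∤r l∣r

  private
    [_∣_] : ℕ → ℕ → ℤ.ℤ
    [ l ∣ n ] with l ∣? n
    ... | yes _ = ℤ.1ℤ
    ... | no  _ = ℤ.0ℤ

    [∣1]≡0 : ∀ {l} → Prime l → [ l ∣ 1 ] ≡ ℤ.0ℤ
    [∣1]≡0 {l} l-prime with l ∣? 1
    ... | yes l∣1 = contradiction (subst Prime (∣1⇒≡1 l∣1) l-prime) ¬prime[1]
    ... | no  _   = refl

    [∣]-prime : ∀ {l q} → Prime l → Prime q → [ l ∣ q ] ℤ.≤ δ l q
    [∣]-prime {l} {q} l-prime q-prime with l ∣? q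
    ... | yes l∣q rewrite prime∣prime⇒≡ l-prime q-prime l∣q = ℤ.≤-reflexive (sym (δ-refl q))
    ... | no  _   = 0≤δ l q

    [∣]-* : ∀ {l} → Prime l → ∀ m n → [ l ∣ m * n ] ℤ.≤ [ l ∣ m ] ℤ.+ [ l ∣ n ]
    [∣]-* {l} l-prime m n with l ∣? m * n | l ∣? m | l ∣? n
    ... | no  _ | yes _ | yes _ = ℤ.+≤+ z≤n
    ... | no  _ | yes _ | no  _ = ℤ.+≤+ z≤n
    ... | no  _ | no  _ | yes _ = ℤ.+≤+ z≤n
    ... | no  _ | no  _ | no  _ = ℤ.+≤+ z≤n
    ... | yes _ | yes _ | yes _ = ℤ.+≤+ (s≤s z≤n)
    ... | yes _ | yes _ | no  _ = ℤ.+≤+ (s≤s z≤n)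
    ... | yes _ | no  _ | yes _ = ℤ.+≤+ (s≤s z≤n)
    ... | yes l∣mn | no l∤m | no l∤n with euclidsLemma m n l-prime l∣mn
    ...   | inj₁ l∣m = contradiction l∣m l∤m
    ...   | inj₂ l∣n = contradiction l∣n l∤n

    ∑-δ-unique : ∀ {xs} → Unique xs → ∀ n → ∑ xs (λ x → δ x n) ℤ.≤ ℤ.1ℤ
    ∑-δ-unique {[]}     []           n = ℤ.+≤+ z≤n
    ∑-δ-unique {x ∷ xs} (x∉xs ∷ xs!) n with x ≟ n
    ... | no x≢n rewrite δ-≢ x≢n = subst (ℤ._≤ ℤ.1ℤ) (sym (ℤ.+-identityˡ _)) (∑-δ-unique xs! n)
    ... | yes refl rewrite δ-refl x = ℤ.≤-reflexive (cong (λ i → ℤ.1ℤ ℤ.+ i)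
      (trans (∑-cong-∈ xs (λ z∈xs → δ-≢ (All.lookup x∉xs z∈xs ∘ sym))) (∑-0 xs)))

    -- The prime-divisor counting function restricted to P.
    ω : List ℕ → ℕ → ℤ.ℤ
    ω P n = ∑ P (λ l → [ l ∣ n ])

  PrimeBlock : List ℕ → Set
  PrimeBlock P = Unique P × All Prime P

  private
    -- Each chosen prime q adds at most one divisor from P, namely q itself.
    ω-choices : ∀ {P} → PrimeBlock P → ∀ Bs → All PrimeBlock Bs → ∀ {n} → n ∈ choices Bs →
                ω P n ℤ.≤ ℤ.+ length Bs
    ω-choices {P} (_ , P-prime) [] [] (here refl) = ℤ.≤-reflexive
      (trans (∑-cong-∈ P (λ l∈P → [∣1]≡0 (All.lookup P-prime l∈P))) (∑-0 P))
    ω-choices {P} P-block@(P! , P-prime) (B ∷ Bs) ((_ , B-prime) ∷ blocks) n∈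
      with q , t , q∈B , t∈ , refl ← ∈-cartesianProductWith⁻ _*_ B (choices Bs) n∈ = begin
      ω P (q * t)
        ≤⟨ ∑-mono-∈ P (λ l∈P → ℤ.≤-trans ([∣]-* (All.lookup P-prime l∈P) q t)
             (ℤ.+-monoˡ-≤ _ ([∣]-prime (All.lookup P-prime l∈P) (All.lookup B-prime q∈B)))) ⟩
      ∑ P (λ l → δ l q ℤ.+ [ l ∣ t ])
        ≡⟨ ∑-+ P (λ l → δ l q) (λ l → [ l ∣ t ]) ⟩
      ∑ P (λ l → δ l q) ℤ.+ ω P t
        ≤⟨ ℤ.+-mono-≤ (∑-δ-unique P! q) (ω-choices P-block Bs blocks t∈) ⟩
      ℤ.1ℤ ℤ.+ ℤ.+ length Bs ∎
      where open ℤ.≤-Reasoning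

  -- With k blocks, at most k primes of the first one divide n, and each leaves a cofactor with at
  -- most (k - 1)! representations by the others. Blocks may coincide, so this covers the powers of
  -- T as well as U and V.
  choices-multiplicity : ∀ Bs → All PrimeBlock Bs → ∀ n →
                         ∑ (choices Bs) (λ t → δ t n) ℤ.≤ ℤ.+ (length Bs !)
  choices-multiplicity [] [] n = subst (ℤ._≤ ℤ.1ℤ) (sym (ℤ.+-identityʳ (δ 1 n))) (δ≤1 1 n)
  -- `ω-choices` applies only when n is itself a choice; otherwise the sum vanishes.
  choices-multiplicity (B ∷ Bs) (B-block@(_ , B-prime) ∷ blocks) n with n ∈? choices (B ∷ Bs)
  ... | no n∉ = subst (ℤ._≤ ℤ.+ (length (B ∷ Bs) !)) (sym (trans
    (∑-cong-∈ (choices (B ∷ Bs)) (λ {t} t∈ → δ-≢ {t} {n} (λ { refl → n∉ t∈ }))) (∑-0 (choices (B ∷ Bs)))))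
    (ℤ.+≤+ z≤n)
  ... | yes n∈ = begin
    ∑ (choices (B ∷ Bs)) (λ t → δ t n)
      ≡⟨ ∑-cartesianProductWith _*_ B (choices Bs) (λ t → δ t n) ⟩
    ∑ B (λ l → ∑ (choices Bs) (λ t → δ (l * t) n))
      ≤⟨ ∑-mono-∈ B (λ l∈B → fibre (All.lookup B-prime l∈B)) ⟩
    ∑ B (λ l → [ l ∣ n ] ℤ.* ℤ.+ (length Bs !))
      ≡⟨ ∑-*ʳ B (ℤ.+ (length Bs !)) (λ l → [ l ∣ n ]) ⟩
    ω B n ℤ.* ℤ.+ (length Bs !)
      ≤⟨ ℤ.*-monoʳ-≤-nonNeg (ℤ.+ (length Bs !)) (ω-choices B-block (B ∷ Bs) (B-block ∷ blocks) n∈) ⟩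
    ℤ.+ suc (length Bs) ℤ.* ℤ.+ (length Bs !)
      ≡⟨ ℤ.pos-* (suc (length Bs)) (length Bs !) ⟨
    ℤ.+ (suc (length Bs) !) ∎
    where
    open ℤ.≤-Reasoning
    fibre : ∀ {l} → Prime l → ∑ (choices Bs) (λ t → δ (l * t) n) ℤ.≤ [ l ∣ n ] ℤ.* ℤ.+ (length Bs !)
    fibre {l} l-prime with l ∣? n
    ... | no l∤n = ℤ.≤-reflexive (trans
      (∑-cong (choices Bs) (λ t → δ-≢ (λ lt≡n → l∤n (subst (l ∣_) lt≡n (m∣m*n t)))))
      (trans (∑-0 (choices Bs)) (sym (ℤ.*-zeroˡ (ℤ.+ (length Bs !))))))
    ... | yes (divides q refl) = begin
      ∑ (choices Bs) (λ t → δ (l * t) (q * l))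
        ≤⟨ ∑-mono (choices Bs) cancel ⟩
      ∑ (choices Bs) (λ t → δ t q)
        ≤⟨ choices-multiplicity Bs blocks q ⟩
      ℤ.+ (length Bs !)
        ≡⟨ ℤ.*-identityˡ (ℤ.+ (length Bs !)) ⟨
      ℤ.1ℤ ℤ.* ℤ.+ (length Bs !) ∎
      where
      cancel : ∀ t → δ (l * t) (q * l) ℤ.≤ δ t q
      cancel t with t ≟ q
      ... | yes refl rewrite δ-refl t = δ≤1 (l * t) (t * l)
      ... | no t≢q = subst (ℤ._≤ δ t q) (sym (δ-≢ (λ eq →
        t≢q (*-cancelˡ-≡ t q l {{prime⇒nonZero l-prime}} (trans eq (*-comm q l)))))) (0≤δ t q)

-- The dilation operator T and the growth of ‖T^j f‖².

module Dilations where

  open Choices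
  open import Data.Integer.Base hiding (suc; NonZero; ∣_∣; _/_; _%_)
  open import Data.Integer.Properties
  open import Data.Integer.Tactic.RingSolver using (solve-∀)
  open import Data.List.Base using (List; []; _∷_; length; replicate; upTo)
  open import Data.List.Membership.Propositional using (_∈_)
  open import Data.Nat.Base as ℕ using (ℕ; zero; suc)
  open import Data.Nat.Coprimality using (Coprime)
  open import Data.Nat.Divisibility using (_∣_; _∣?_; quotient; m∣n⇒n≡m*quotient; ∣n⇒∣m*n; ∣1⇒≡1)
  open import Data.Nat.Primality using (Prime; euclidsLemma; ¬prime[1])
  open import Data.List.Relation.Unary.All as All using (All; []; _∷_)
  open import Function.Base using (case_of_)
  open import Data.Nat.ListAction using (product)
  open import Data.Nat.ListAction.Properties using (∈⇒∣product)
  import Data.Nat.Properties as ℕ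
  open import Data.Nat.Tactic.RingSolver as ℕ-Solver using ()
  open import Data.Sum.Base using (inj₁; inj₂)
  open FiniteSums
  open import Relation.Binary.PropositionalEquality
    using (_≡_; refl; sym; trans; cong; cong₂; subst)
  open import Relation.Nullary using (yes; no; contradiction; ¬_)
  open ResidueSums

  -- dilations P f j = T^j f, where T f x = Σ_{l ∈ P} f (l x).
  dilations : List ℕ → (ℕ → ℤ) → ℕ → ℕ → ℤ
  dilations P f j x = ∑ (choices (replicate j P)) (λ t → f (t ℕ.* x))

  dilations-suc : ∀ P f j x → dilations P f (suc j) x ≡ ∑ P (λ l → dilations P f j (l ℕ.* x))
  dilations-suc P f j x = trans
    (∑-cartesianProductWith ℕ._*_ P (choices (replicate j P)) (λ t → f (t ℕ.* x)))
    (∑-cong P (λ l → ∑-cong (choices (replicate j P)) (λ t → cong f (lemma l t x))))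
    where
    lemma : ∀ l t x → l ℕ.* t ℕ.* x ≡ t ℕ.* (l ℕ.* x)
    lemma = ℕ-Solver.solve-∀

  dilations-periodic : ∀ {p f} → Periodic p f → ∀ P j → Periodic p (dilations P f j)
  dilations-periodic {p} {f} per P j x =
    ∑-cong (choices (replicate j P)) (λ t → periodic-dilate {p} {f} per t x)

  dilations-² : ∀ P {f B} → (∀ x → f x ² ≤ B) → ∀ j x →
                dilations P f j x ² ≤ (+ length (choices (replicate j P))) ² * B
  dilations-² P {f} {B} f²≤B j x = begin
    dilations P f j x ²
      ≤⟨ ∑²≤length*∑² ts (λ t → f (t ℕ.* x)) ⟩
    + length ts * ∑ ts (λ t → f (t ℕ.* x) ²)
      ≤⟨ *-monoˡ-≤-nonNeg (+ length ts) (∑-mono ts (λ t → f²≤B (t ℕ.* x))) ⟩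
    + length ts * ∑ ts (λ _ → B)
      ≡⟨ cong (+ length ts *_) (∑-const ts B) ⟩
    + length ts * (+ length ts * B)
      ≡⟨ *-assoc (+ length ts) (+ length ts) B ⟨
    (+ length ts) ² * B ∎
    where
    open ≤-Reasoning
    ts = choices (replicate j P)

  ²≤0⇒≡0 : ∀ i → i ² ≤ 0ℤ → i ≡ 0ℤ
  ²≤0⇒≡0 +0       _ = refl
  ²≤0⇒≡0 +[1+ n ] (+≤+ ())
  ²≤0⇒≡0 -[1+ n ] (+≤+ ())

  -- Multiplied by a, the claim reads `a c b ≤ q b² ≤ q a d`. If a = 0, then b² ≤ 0 forces b = 0.
  log-convex-step : ∀ {a b d c q} → 0ℤ ≤ a → 0ℤ ≤ b → 0ℤ ≤ d → 0ℤ ≤ q →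
                    c * a ≤ q * b → b ² ≤ a * d → c * b ≤ q * d
  log-convex-step {+0} {b} {d} {c} {q} _ _ 0≤d 0≤q _ b²≤0 = begin
    c * b   ≡⟨ cong (c *_) (²≤0⇒≡0 b (subst (b ² ≤_) (*-zeroˡ d) b²≤0)) ⟩
    c * 0ℤ  ≡⟨ *-zeroʳ c ⟩
    0ℤ      ≤⟨ 0≤i*j 0≤q 0≤d ⟩
    q * d   ∎
    where open ≤-Reasoning
  log-convex-step {a@(+[1+ _ ])} {b} {d} {c} {q} _ 0≤b _ 0≤q ca≤qb b²≤ad =
    *-cancelˡ-≤-pos (c * b) (q * d) a (begin
    a * (c * b)  ≡⟨ lemma₁ a c b ⟩
    c * a * b    ≤⟨ *-monoʳ-≤-nonNeg b {{nonNegative 0≤b}} ca≤qb ⟩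
    q * b * b    ≡⟨ *-assoc q b b ⟩
    q * b ²      ≤⟨ *-monoʳ-≤-0≤ 0≤q b²≤ad ⟩
    q * (a * d)  ≡⟨ lemma₂ q a d ⟩
    a * (q * d)  ∎)
    where
    open ≤-Reasoning
    lemma₁ : ∀ a b c → a * (b * c) ≡ b * a * c
    lemma₁ = solve-∀
    lemma₂ : ∀ a b c → a * (b * c) ≡ b * (a * c)
    lemma₂ = solve-∀

  -- The complementary divisor l ↦ (∏ P) / l stands in for inversion mod p, up to the unit ∏ P.
  cofactor : List ℕ → ℕ → ℕ
  cofactor P l with l ∣? product P
  ... | yes l∣Π = quotient l∣Π
  ... | no  _   = 0

  l*cofactor≡product : ∀ {P l} → l ∈ P → l ℕ.* cofactor P l ≡ product P
  l*cofactor≡product {P} {l} l∈P with l ∣? product P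
  ... | yes l∣Π = sym (m∣n⇒n≡m*quotient l∣Π)
  ... | no  l∤Π = contradiction (∈⇒∣product l∈P) l∤Π

  prime∤product : ∀ {p ls} → Prime p → All (λ l → ¬ p ∣ l) ls → ¬ p ∣ product ls
  prime∤product p-prime [] p∣1 = ¬prime[1] (subst Prime (∣1⇒≡1 p∣1) p-prime)
  prime∤product {ls = l ∷ ls} p-prime (p∤l ∷ p∤ls) p∣ with euclidsLemma l (product ls) p-prime p∣
  ... | inj₁ p∣l  = p∤l p∣l
  ... | inj₂ p∣ls = prime∤product p-prime p∤ls p∣ls

  module _ {p : ℕ} .{{_ : ℕ.NonZero p}} {P : List ℕ} (p-prime : Prime p) (p∤P : All (λ l → ¬ p ∣ l) P)
           {f : ℕ → ℤ} (f-per : Periodic p f) where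

    private
      h : ℕ → ℕ → ℤ
      h = dilations P f
      h-per : ∀ j → Periodic p (h j)
      h-per = dilations-periodic f-per P
      Π = product P
      R = upTo p
      p⊥ΠP : Coprime p Π
      p⊥ΠP = prime∤⇒coprime p-prime (prime∤product p-prime p∤P)
      p⊥l*m : ∀ {l m} → l ∈ P → m ∈ P → Coprime p (l ℕ.* m)
      p⊥l*m {l} {m} l∈P m∈P = prime∤⇒coprime p-prime λ p∣lm → case euclidsLemma l m p-prime p∣lm of λ where
        (inj₁ p∣l) → All.lookup p∤P l∈P p∣l
        (inj₂ p∣m) → All.lookup p∤P m∈P p∣m
      p⊥cofactor : ∀ {l} → l ∈ P → Coprime p (cofactor P l)
      p⊥cofactor {l} l∈P = prime∤⇒coprime p-prime λ p∣c → prime∤product p-prime p∤P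
        (subst (p ∣_) (l*cofactor≡product l∈P) (∣n⇒∣m*n l p∣c))

    -- The squared norm ‖T^j f‖² over one residue system.
    moment : ℕ → ℤ
    moment j = ∑ R (λ x → h j x ²)

    -- ⟨T g, T g⟩ = ⟨g, T* T g⟩ for g = T^j f, and ‖T* T g‖ = ‖T T g‖ because dilations commute.
    moment-log-convex : ∀ j → moment (suc j) ² ≤ moment j * moment (suc (suc j))
    moment-log-convex j = begin
      moment (suc j) ²
        ≡⟨ cong _² eq₁ ⟩
      (∑ R (λ x → h j (Π ℕ.* x) * k x)) ²
        ≤⟨ cauchy-schwarz R (λ x → h j (Π ℕ.* x)) k ⟩
      ∑ R (λ x → h j (Π ℕ.* x) ²) * ∑ R (λ x → k x ²)
        ≡⟨ cong₂ _*_ (∑-dilate {f = λ x → h j x ²} (λ x → cong _² (h-per j x)) p⊥ΠP) eq₂ ⟩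
      moment j * moment (suc (suc j)) ∎
      where
      open ≤-Reasoning
      c = cofactor P
      g = h (suc j)
      g-per = h-per (suc j)
      -- Modulo p, `c l` is Π divided by l, so `k x` is the value of T* g at Π x.
      k : ℕ → ℤ
      k x = ∑ P (λ l → g (c l ℕ.* x))
      -- For each l the substitution of `c l * x` for x turns l x into Π x, independent of l.
      eq₁ : moment (suc j) ≡ ∑ R (λ x → h j (Π ℕ.* x) * k x)
      eq₁ = begin-equality
        ∑ R (λ x → g x * g x)
          ≡⟨ ∑-cong R (λ x → trans (cong (_* g x) (dilations-suc P f j x))
               (sym (∑-*ʳ P (g x) (λ l → h j (l ℕ.* x))))) ⟩
        ∑ R (λ x → ∑ P (λ l → h j (l ℕ.* x) * g x))
          ≡⟨ ∑-swap R P (λ x l → h j (l ℕ.* x) * g x) ⟩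
        ∑ P (λ l → ∑ R (λ x → h j (l ℕ.* x) * g x))
          ≡⟨ ∑-cong-∈ P (λ {l} l∈P → sym (∑-dilate {f = λ x → h j (l ℕ.* x) * g x}
               (λ x → cong₂ _*_ (periodic-dilate {p} {h j} (h-per j) l x) (g-per x)) (p⊥cofactor l∈P)))
          ⟩
        ∑ P (λ l → ∑ R (λ x → h j (l ℕ.* (c l ℕ.* x)) * g (c l ℕ.* x)))
          ≡⟨ ∑-cong-∈ P (λ {l} l∈P → ∑-cong R (λ x → cong (λ y → h j y * g (c l ℕ.* x))
               (trans (sym (ℕ.*-assoc l (c l) x)) (cong (ℕ._* x) (l*cofactor≡product l∈P))))) ⟩
        ∑ P (λ l → ∑ R (λ x → h j (Π ℕ.* x) * g (c l ℕ.* x)))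
          ≡⟨ ∑-swap P R (λ l x → h j (Π ℕ.* x) * g (c l ℕ.* x)) ⟩
        ∑ R (λ x → ∑ P (λ l → h j (Π ℕ.* x) * g (c l ℕ.* x)))
          ≡⟨ ∑-cong R (λ x → ∑-*ˡ P (h j (Π ℕ.* x)) (λ l → g (c l ℕ.* x))) ⟩
        ∑ R (λ x → h j (Π ℕ.* x) * k x) ∎
      double : ∀ (a : ℕ → ℕ → ℤ) → ∑ R (λ x → ∑ P (λ l → a l x) ²) ≡
               ∑ P (λ l → ∑ P (λ m → ∑ R (λ x → a l x * a m x)))
      double a = begin-equality
        ∑ R (λ x → ∑ P (λ l → a l x) ²)
          ≡⟨ ∑-cong R (λ x → ∑-*-∑ P P (λ l → a l x) (λ m → a m x)) ⟩
        ∑ R (λ x → ∑ P (λ l → ∑ P (λ m → a l x * a m x)))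
          ≡⟨ ∑-swap R P (λ x l → ∑ P (λ m → a l x * a m x)) ⟩
        ∑ P (λ l → ∑ R (λ x → ∑ P (λ m → a l x * a m x)))
          ≡⟨ ∑-cong P (λ l → ∑-swap R P (λ x m → a l x * a m x)) ⟩
        ∑ P (λ l → ∑ P (λ m → ∑ R (λ x → a l x * a m x))) ∎
      -- Substituting l m x for x turns the arguments into m Π x and l Π x; the common unit Π is
      -- then dropped. The roles of l and m have been exchanged, which is harmless in the sum over
      -- all pairs.
      pair : ∀ {l m} → l ∈ P → m ∈ P →
             ∑ R (λ x → g (c l ℕ.* x) * g (c m ℕ.* x)) ≡ ∑ R (λ x → g (m ℕ.* x) * g (l ℕ.* x))
      pair {l} {m} l∈P m∈P = begin-equality
        ∑ R (λ x → g (c l ℕ.* x) * g (c m ℕ.* x))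
          ≡⟨ ∑-dilate {f = λ x → g (c l ℕ.* x) * g (c m ℕ.* x)}
               (λ x → cong₂ _*_ (periodic-dilate {p} {g} g-per (c l) x) (periodic-dilate {p} {g} g-per (c m) x))
               (p⊥l*m l∈P m∈P) ⟨
        ∑ R (λ x → g (c l ℕ.* (l ℕ.* m ℕ.* x)) * g (c m ℕ.* (l ℕ.* m ℕ.* x)))
          ≡⟨ ∑-cong R (λ x → cong₂ (λ y z → g y * g z)
               (trans (lemma₁ (c l) l m x) (cong (λ n → m ℕ.* (n ℕ.* x)) (l*cofactor≡product l∈P)))
               (trans (lemma₂ (c m) l m x) (cong (λ n → l ℕ.* (n ℕ.* x)) (l*cofactor≡product m∈P)))) ⟩
        ∑ R (λ x → g (m ℕ.* (Π ℕ.* x)) * g (l ℕ.* (Π ℕ.* x)))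
          ≡⟨ ∑-dilate {f = λ x → g (m ℕ.* x) * g (l ℕ.* x)}
               (λ x → cong₂ _*_ (periodic-dilate {p} {g} g-per m x) (periodic-dilate {p} {g} g-per l x)) p⊥ΠP ⟩
        ∑ R (λ x → g (m ℕ.* x) * g (l ℕ.* x)) ∎
        where
        lemma₁ : ∀ c l m x → c ℕ.* (l ℕ.* m ℕ.* x) ≡ m ℕ.* (l ℕ.* c ℕ.* x)
        lemma₁ = ℕ-Solver.solve-∀
        lemma₂ : ∀ c l m x → c ℕ.* (l ℕ.* m ℕ.* x) ≡ l ℕ.* (m ℕ.* c ℕ.* x)
        lemma₂ = ℕ-Solver.solve-∀
      eq₂ : ∑ R (λ x → k x ²) ≡ moment (suc (suc j))
      eq₂ = begin-equality
        ∑ R (λ x → k x ²)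
          ≡⟨ double (λ l x → g (c l ℕ.* x)) ⟩
        ∑ P (λ l → ∑ P (λ m → ∑ R (λ x → g (c l ℕ.* x) * g (c m ℕ.* x))))
          ≡⟨ ∑-cong-∈ P (λ l∈P → ∑-cong-∈ P (λ m∈P → pair l∈P m∈P)) ⟩
        ∑ P (λ l → ∑ P (λ m → ∑ R (λ x → g (m ℕ.* x) * g (l ℕ.* x))))
          ≡⟨ ∑-swap P P (λ l m → ∑ R (λ x → g (m ℕ.* x) * g (l ℕ.* x))) ⟩
        ∑ P (λ m → ∑ P (λ l → ∑ R (λ x → g (m ℕ.* x) * g (l ℕ.* x))))
          ≡⟨ double (λ l x → g (l ℕ.* x)) ⟨
        ∑ R (λ x → ∑ P (λ l → g (l ℕ.* x)) ²)
          ≡⟨ ∑-cong R (λ x → cong _² (sym (dilations-suc P f (suc j) x))) ⟩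
        moment (suc (suc j)) ∎

    0≤moment : ∀ j → 0ℤ ≤ moment j
    0≤moment j = ∑-0≤ R (λ x → 0≤i² (h j x))

    -- By log-convexity the ratios of consecutive moments do not decrease, so the first one bounds
    -- them all.
    moment-ratio : ∀ c {q} → 0ℤ ≤ q → c * moment 0 ≤ q * moment 1 →
                   ∀ j → c * moment j ≤ q * moment (suc j)
    moment-ratio c 0≤q base zero    = base
    moment-ratio c 0≤q base (suc j) = log-convex-step {c = c} (0≤moment j) (0≤moment (suc j)) (0≤moment (suc (suc j)))
      0≤q (moment-ratio c 0≤q base j) (moment-log-convex j)

    -- The ratios are multiplied up from `moment 1`, for which `c ≤ F * moment 1` is an absolute
    -- bound; hence j factors q for exponent j + 1.
    moment-lower-bound : ∀ {c q F} → 0ℤ ≤ c → 0ℤ ≤ q → 0ℤ ≤ F → c * moment 0 ≤ q * moment 1 →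
                         c ≤ F * moment 1 → ∀ j → c ^ suc j ≤ F * q ^ j * moment (suc j)
    moment-lower-bound {c} {q} {F} 0≤c 0≤q 0≤F ratio c≤Fm₁ zero = begin
      c * 1ℤ                ≡⟨ *-identityʳ c ⟩
      c                     ≤⟨ c≤Fm₁ ⟩
      F * moment 1          ≡⟨ cong (_* moment 1) (*-identityʳ F) ⟨
      F * 1ℤ * moment 1     ∎
      where open ≤-Reasoning
    moment-lower-bound {c} {q} {F} 0≤c 0≤q 0≤F ratio c≤Fm₁ (suc j) = begin
      c * c ^ suc j                              ≤⟨ *-monoʳ-≤-0≤ 0≤c (moment-lower-bound 0≤c 0≤q 0≤F ratio c≤Fm₁ j) ⟩
      c * (F * q ^ j * moment (suc j))           ≡⟨ lemma₁ c F (q ^ j) (moment (suc j)) ⟩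
      F * q ^ j * (c * moment (suc j))           ≤⟨ *-monoʳ-≤-0≤ (0≤i*j 0≤F (0≤^ j)) (moment-ratio c 0≤q ratio (suc j)) ⟩
      F * q ^ j * (q * moment (suc (suc j)))     ≡⟨ lemma₂ F (q ^ j) q (moment (suc (suc j))) ⟩
      F * (q * q ^ j) * moment (suc (suc j))     ∎
      where
      open ≤-Reasoning
      0≤^ : ∀ j → 0ℤ ≤ q ^ j
      0≤^ zero    = +≤+ ℕ.z≤n
      0≤^ (suc j) = 0≤i*j 0≤q (0≤^ j)
      lemma₁ : ∀ c F a m → c * (F * a * m) ≡ F * a * (c * m)
      lemma₁ = solve-∀
      lemma₂ : ∀ F a q m → F * a * (q * m) ≡ F * (q * a) * m
      lemma₂ = solve-∀

-- The balanced indicator of a V⁻¹ modulo p.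

module BalancedIndicator where

  open Choices
  open import Data.Integer.Base hiding (suc; NonZero; ∣_∣; _/_; _%_)
  open import Data.Integer.Properties
  open import Data.Integer.Tactic.RingSolver using (solve-∀)
  open import Data.List.Base using (List; length; upTo)
  open import Data.List.Membership.Propositional using (_∈_)
  open import Data.List.Membership.Propositional.Properties using (∈-upTo⁻)
  open import Data.List.Properties using (length-upTo)
  open import Data.List.Relation.Unary.All as All using (All)
  open import Data.Nat.Base as ℕ using (ℕ; zero; suc)
  open import Data.Nat.DivMod using (_%_; m<n⇒m%n≡m; [m+n]%n≡m%n)
  open import Data.Nat.Divisibility using (_∣_; _∣?_; ∣n⇒∣m*n; m%n≡0⇒n∣m)
  open import Data.Nat.Primality using (Prime; prime⇒nonZero)
  import Data.Nat.Properties as ℕ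
  open Dilations
  open FiniteSums
  open import Relation.Binary.PropositionalEquality
    using (_≡_; _≢_; refl; sym; trans; cong; cong₂; subst; module ≡-Reasoning)
  open import Relation.Nullary using (yes; no; ¬_)
  open ResidueSums

  δ-sym : ∀ m n → δ m n ≡ δ n m
  δ-sym zero    zero    = refl
  δ-sym zero    (suc n) = refl
  δ-sym (suc m) zero    = refl
  δ-sym (suc m) (suc n) = δ-sym m n

  residue : (p : ℕ) .{{_ : ℕ.NonZero p}} → ℕ → ℕ → ℤ
  residue p a x = δ (x % p) a

  residue-periodic : ∀ {p a} .{{_ : ℕ.NonZero p}} → Periodic p (residue p a)
  residue-periodic {p} {a} x =
    cong (λ y → δ y a) (trans (cong (_% p) (ℕ.+-comm p x)) ([m+n]%n≡m%n x p))

  ∑-residue : ∀ {p a} .{{_ : ℕ.NonZero p}} → a ℕ.< p → ∑ (upTo p) (residue p a) ≡ 1ℤ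
  ∑-residue {p} {a} a<p = begin
    ∑ (upTo p) (residue p a)         ≡⟨ ∑-cong-∈ (upTo p) (λ {x} x∈ → begin
      δ (x % p) a                       ≡⟨ cong (λ y → δ y a) (m<n⇒m%n≡m (∈-upTo⁻ x∈)) ⟩
      δ x a                             ≡⟨ δ-sym x a ⟩
      δ a x                             ≡⟨ *-identityʳ (δ a x) ⟨
      δ a x * 1ℤ                        ∎) ⟩
    ∑ (upTo p) (λ x → δ a x * 1ℤ)    ≡⟨ ∑-δ a<p (λ _ → 1ℤ) ⟩
    1ℤ                               ∎
    where open ≡-Reasoning

  ∑-upTo-const : ∀ n c → ∑ (upTo n) (λ _ → c) ≡ + n * c
  ∑-upTo-const n c = trans (∑-const (upTo n) c) (cong (λ m → + m * c) (length-upTo n))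

  module _ {p : ℕ} (p-prime : Prime p) where

    private
      instance
        p≢0 : ℕ.NonZero p
        p≢0 = prime⇒nonZero p-prime

    -- The number of v ∈ V with v x ≡ a (mod p), scaled by p - 1 and recentred on the nonzero
    -- residues, so that it has mean 0 and vanishes at 0.
    balanced : (V : List ℕ) (a : ℕ) → ℕ → ℤ
    balanced V a x = (+ p - 1ℤ) * ∑ V (λ v → residue p a (v ℕ.* x)) - + length V * (1ℤ - residue p 0 x)

    balanced-periodic : ∀ V a → Periodic p (balanced V a)
    balanced-periodic V a x = cong₂ (λ i j → (+ p - 1ℤ) * i - + length V * (1ℤ - j))
      (∑-cong V (λ v → periodic-dilate {p} {residue p a} (residue-periodic {p} {a}) v x))
      (residue-periodic {p} {0} x)

    module _ {V : List ℕ} {a : ℕ} (p∤V : All (λ v → ¬ p ∣ v) V) (0<a : 0 ℕ.< a) (a<p : a ℕ.< p) where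

      private
        f = balanced V a
        e : ℕ → ℤ
        e x = ∑ V (λ v → residue p a (v ℕ.* x))
        0<p : 0 ℕ.< p
        0<p = ℕ.<-trans 0<a a<p
        residue-0 : ∀ {x} → p ∣ x → residue p a x ≡ 0ℤ
        residue-0 p∣x = trans (periodic-%≡0 {p} {residue p a} (residue-periodic {p} {a}) p∣x)
          (δ-≢ (λ 0≡a → ℕ.<⇒≢ 0<a (trans (sym (m<n⇒m%n≡m 0<p)) 0≡a)))

      -- Each v is a unit, so v x ≡ a has exactly one solution x per period; this contributes (p -
      -- 1) |V|, which the p - 1 nonzero residues remove again.
      ∑-balanced : ∑ (upTo p) f ≡ 0ℤ
      ∑-balanced = begin
        ∑ (upTo p) f
          ≡⟨ ∑-cong (upTo p) (λ x → rearrange (+ p) (e x) (+ length V) (residue p 0 x)) ⟩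
        ∑ (upTo p) (λ x → (+ p - 1ℤ) * e x + (- + length V + + length V * residue p 0 x))
          ≡⟨ ∑-+ (upTo p) (λ x → (+ p - 1ℤ) * e x) _ ⟩
        ∑ (upTo p) (λ x → (+ p - 1ℤ) * e x) + ∑ (upTo p) (λ x → - + length V + + length V * residue p 0 x)
          ≡⟨ cong₂ _+_ (trans (∑-*ˡ (upTo p) (+ p - 1ℤ) e) (cong ((+ p - 1ℤ) *_) ∑e))
               (trans (∑-+ (upTo p) (λ _ → - + length V) (λ x → + length V * residue p 0 x))
                 (cong₂ _+_ (∑-upTo-const p (- + length V))
                   (trans (∑-*ˡ (upTo p) (+ length V) (residue p 0)) (cong (+ length V *_) (∑-residue 0<p))))) ⟩
        (+ p - 1ℤ) * + length V + (+ p * - + length V + + length V * 1ℤ)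
          ≡⟨ cancel (+ p) (+ length V) ⟩
        0ℤ ∎
        where
        open ≡-Reasoning
        rearrange : ∀ p e v z → (p - 1ℤ) * e - v * (1ℤ - z) ≡ (p - 1ℤ) * e + (- v + v * z)
        rearrange = solve-∀
        cancel : ∀ p v → (p - 1ℤ) * v + (p * - v + v * 1ℤ) ≡ 0ℤ
        cancel = solve-∀
        ∑e : ∑ (upTo p) e ≡ + length V
        ∑e = begin
          ∑ (upTo p) (λ x → ∑ V (λ v → residue p a (v ℕ.* x)))
            ≡⟨ ∑-swap (upTo p) V (λ x v → residue p a (v ℕ.* x)) ⟩
          ∑ V (λ v → ∑ (upTo p) (λ x → residue p a (v ℕ.* x)))
            ≡⟨ ∑-cong-∈ V (λ v∈V → trans (∑-dilate {f = residue p a} (residue-periodic {p} {a})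
                 (prime∤⇒coprime p-prime (All.lookup p∤V v∈V))) (∑-residue a<p)) ⟩
          ∑ V (λ _ → 1ℤ)
            ≡⟨ trans (∑-const V 1ℤ) (*-identityʳ (+ length V)) ⟩
          + length V ∎

      -- For x divisible by p, dilation by x is not a permutation of the residues; that f (n x)
      -- still sums to 0 over n rests on this vanishing.
      balanced-0 : ∀ {x} → p ∣ x → f x ≡ 0ℤ
      balanced-0 {x} p∣x = begin
        f x
          ≡⟨ cong₂ (λ i j → (+ p - 1ℤ) * i - + length V * (1ℤ - j))
               (trans (∑-cong V (λ v → residue-0 (∣n⇒∣m*n v p∣x))) (∑-0 V))
               (trans (periodic-%≡0 {p} {residue p 0} (residue-periodic {p} {0}) p∣x)
                 (cong (λ y → δ y 0) (m<n⇒m%n≡m 0<p))) ⟩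
        (+ p - 1ℤ) * 0ℤ - + length V * (1ℤ - 1ℤ)
          ≡⟨ lemma (+ p) (+ length V) ⟩
        0ℤ ∎
        where
        open ≡-Reasoning
        lemma : ∀ p v → (p - 1ℤ) * 0ℤ - v * (1ℤ - 1ℤ) ≡ 0ℤ
        lemma = solve-∀

      balanced-off-support : ∀ {x} → ¬ p ∣ x → (∀ {v} → v ∈ V → (v ℕ.* x) % p ≢ a) → f x ≡ - + length V
      balanced-off-support {x} p∤x off = begin
        f x
          ≡⟨ cong₂ (λ i j → (+ p - 1ℤ) * i - + length V * (1ℤ - j))
               (trans (∑-cong-∈ V (λ v∈V → δ-≢ (off v∈V))) (∑-0 V))
               (δ-≢ (λ x%p≡0 → p∤x (m%n≡0⇒n∣m x p x%p≡0))) ⟩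
        (+ p - 1ℤ) * 0ℤ - + length V * (1ℤ - 0ℤ)
          ≡⟨ lemma (+ p) (+ length V) ⟩
        - + length V ∎
        where
        open ≡-Reasoning
        lemma : ∀ p v → (p - 1ℤ) * 0ℤ - v * (1ℤ - 0ℤ) ≡ - v
        lemma = solve-∀

      module _ {F : ℕ} (V-mult : ∀ n → ∑ V (λ v → δ v n) ≤ + F)
               (V<p : ∀ {v} → v ∈ V → v ℕ.< p) where

        -- At most one residue v solves v x ≡ a, and entries of V are below p with multiplicity at
        -- most F, so e x ≤ F; in the same way |V| ≤ F p. Thus f lies between -|V| and (p - 1) F.
        balanced-² : ∀ x → f x ² ≤ (+ F * + p) ²
        balanced-² x = -i≤j≤i⇒j²≤i² lower upper
          where
          open ≤-Reasoning
          e≤F : e x ≤ + F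
          e≤F with p ∣? x
          ... | yes p∣x = subst (_≤ + F) (sym (trans (∑-cong V (λ v → residue-0 (∣n⇒∣m*n v p∣x))) (∑-0 V)))
            (+≤+ ℕ.z≤n)
          ... | no p∤x = begin
            ∑ V (λ v → residue p a (v ℕ.* x))
              ≤⟨ ∑-≤-multiplicity V {G = λ v → residue p a (v ℕ.* x)} V-mult V<p (λ n → 0≤δ (n ℕ.* x % p) a) ⟩
            + F * ∑ (upTo p) (λ n → residue p a (n ℕ.* x))
              ≡⟨ cong (+ F *_) (∑-cong (upTo p) (λ n → cong (residue p a) (ℕ.*-comm n x))) ⟩
            + F * ∑ (upTo p) (λ n → residue p a (x ℕ.* n))
              ≡⟨ cong (+ F *_) (trans (∑-dilate {f = residue p a} (residue-periodic {p} {a})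
                   (prime∤⇒coprime p-prime p∤x)) (∑-residue a<p)) ⟩
            + F * 1ℤ
              ≡⟨ *-identityʳ (+ F) ⟩
            + F ∎
          0≤e : 0ℤ ≤ e x
          0≤e = ∑-0≤ V (λ v → 0≤δ ((v ℕ.* x) % p) a)
          z = residue p 0 x
          0≤z : 0ℤ ≤ z
          0≤z = 0≤δ (x % p) 0
          z≤1 : z ≤ 1ℤ
          z≤1 = δ≤1 (x % p) 0
          0≤p-1 : 0ℤ ≤ + p - 1ℤ
          0≤p-1 = i≤j⇒0≤j-i (+≤+ 0<p)
          v≤Fp : + length V ≤ + F * + p
          v≤Fp = begin
            + length V                    ≡⟨ trans (∑-const V 1ℤ) (*-identityʳ (+ length V)) ⟨
            ∑ V (λ _ → 1ℤ)                ≤⟨ ∑-≤-multiplicity V {G = λ _ → 1ℤ} V-mult V<p (λ _ → +≤+ ℕ.z≤n) ⟩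
            + F * ∑ (upTo p) (λ _ → 1ℤ)   ≡⟨ cong (+ F *_) (trans (∑-upTo-const p 1ℤ) (*-identityʳ (+ p))) ⟩
            + F * + p                     ∎
          lower : - (+ F * + p) ≤ f x
          lower = 0≤i-j⇒j≤i (subst (0ℤ ≤_) (lemma (+ F * + p) (+ length V) z (+ p) (e x))
            (+-mono-≤ (+-mono-≤ (i≤j⇒0≤j-i v≤Fp) (0≤i*j {+ length V} (+≤+ ℕ.z≤n) 0≤z)) (0≤i*j 0≤p-1 0≤e)))
            where
            lemma : ∀ b v z p e → (b - v) + v * z + (p - 1ℤ) * e ≡ (p - 1ℤ) * e - v * (1ℤ - z) - (- b)
            lemma = solve-∀
          -- `F p - f x` is the sum of the nonnegative terms `v (1 - z)`, `(p - 1) (F - e)` and F.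
          upper : f x ≤ + F * + p
          upper = 0≤i-j⇒j≤i (subst (0ℤ ≤_) (lemma (+ F) (+ length V) z (+ p) (e x))
            (+-mono-≤ (+-mono-≤ (0≤i*j {+ length V} (+≤+ ℕ.z≤n) (i≤j⇒0≤j-i z≤1))
              (0≤i*j 0≤p-1 (i≤j⇒0≤j-i e≤F))) (+≤+ (ℕ.z≤n {F}))))
            where
            lemma : ∀ F v z p e → v * (1ℤ - z) + (p - 1ℤ) * (F - e) + F ≡ F * p - ((p - 1ℤ) * e - v * (1ℤ - z))
            lemma = solve-∀

-- From a missed residue class to a function correlating with products from P.

module Correlation where

  open Choices
  open import Data.Integer.Base hiding (suc; NonZero; ∣_∣; _/_; _%_)
  open import Data.Integer.Properties
  open import Data.Integer.Tactic.RingSolver using (solve-∀)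
  open import Data.List.Base using (List; length; replicate; upTo)
  open import Data.List.Membership.Propositional using (_∈_)
  open import Data.List.Relation.Unary.All as All using (All)
  open import Data.Nat.Base as ℕ using (ℕ; suc)
  open import Data.Nat.DivMod using (_%_)
  open import Data.Nat.Divisibility using (_∣_; _∣?_; ∣n⇒∣m*n)
  open import Data.Nat.Primality using (Prime; euclidsLemma; prime⇒nonZero)
  import Data.Nat.Properties as ℕ
  open import Data.Sum.Base using (inj₁; inj₂)
  open BalancedIndicator
  open Dilations
  open FiniteSums
  open import Function.Base using (case_of_)
  open import Relation.Binary.PropositionalEquality
    using (_≡_; _≢_; sym; trans; cong; subst; module ≡-Reasoning)
  open import Relation.Nullary using (yes; no; ¬_)
  open ResidueSums

  -- All that the sieve has to know about p. The lower bound for the correlation is L / C, with the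
  -- denominator moved to the other side.
  record Detector (P : List ℕ) (B L C : ℤ) (r p : ℕ) : Set where
    field
      φ          : ℕ → ℤ
      periodic   : Periodic p φ
      mean-zero  : ∑ (upTo p) φ ≡ 0ℤ
      bounded    : ∀ n → φ n ² ≤ B
      detects    : L ≤ C * ∑ (choices (replicate r P)) φ

  -- `P₀` bounds all the moduli at once, so that the constants B, L and C of the detectors do not
  -- depend on p.
  module _ {p a F P₀ : ℕ} (p-prime : Prime p) {P U V : List ℕ}
    (1≤F : 1 ℕ.≤ F) (p≤P₀ : p ℕ.≤ P₀)
    (p∤P : All (λ l → ¬ p ∣ l) P) (p∤U : All (λ u → ¬ p ∣ u) U) (p∤V : All (λ v → ¬ p ∣ v) V)
    (U-mult : ∀ n → ∑ U (λ u → δ u n) ≤ + F) (U<p : ∀ {u} → u ∈ U → u ℕ.< p)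
    (V-mult : ∀ n → ∑ V (λ v → δ v n) ≤ + F) (V<p : ∀ {v} → v ∈ V → v ℕ.< p)
    (0<a : 0 ℕ.< a) (a<p : a ℕ.< p) where

    private
      instance
        p≢0 : ℕ.NonZero p
        p≢0 = prime⇒nonZero p-prime

      f : ℕ → ℤ
      f = balanced p-prime V a
      f-per : Periodic p f
      f-per = balanced-periodic p-prime V a
      R = upTo p
      m : ℕ → ℤ
      m = moment p-prime p∤P f-per
      Fp = + F * + p
      -- ‖f‖² ≤ p (F p)² and ‖T f‖² ≥ c / F give a ratio of at least c / (F p)³, hence at least c /
      -- q with q = X³ free of p.
      X = + F * + P₀
      q = X * X ²
      c = (+ length P) ² * (+ length U * (+ length V) ²)

      f² : ∀ x → f x ² ≤ Fp ²
      f² = balanced-² p-prime p∤V 0<a a<p V-mult V<p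

      0≤Fp : 0ℤ ≤ Fp
      0≤Fp = 0≤i*j {+ F} {+ p} (+≤+ ℕ.z≤n) (+≤+ ℕ.z≤n)
      0≤X : 0ℤ ≤ X
      0≤X = 0≤i*j {+ F} {+ P₀} (+≤+ ℕ.z≤n) (+≤+ ℕ.z≤n)
      Fp≤X : Fp ≤ X
      Fp≤X = *-monoˡ-≤-nonNeg (+ F) (+≤+ p≤P₀)
      p≤Fp : + p ≤ Fp
      p≤Fp = subst (_≤ Fp) (*-identityˡ (+ p)) (*-monoʳ-≤-nonNeg (+ p) (+≤+ 1≤F))
      Fp²≤X² : Fp ² ≤ X ²
      Fp²≤X² = *-mono-≤-0≤ 0≤Fp 0≤X Fp≤X Fp≤X
      0≤q : 0ℤ ≤ q
      0≤q = 0≤i*j 0≤X (0≤i² X)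
      0≤c : 0ℤ ≤ c
      0≤c = 0≤i*j (0≤i² (+ length P)) (0≤i*j {+ length U} (+≤+ ℕ.z≤n) (0≤i² (+ length V)))
      FpFp²≤q : Fp * Fp ² ≤ q
      FpFp²≤q = *-mono-≤-0≤ 0≤Fp (0≤i² X) Fp≤X Fp²≤X²
      pFp²≤q : + p * Fp ² ≤ q
      pFp²≤q = ≤-trans (*-monoʳ-≤-nonNeg (Fp ²) {{nonNegative (0≤i² Fp)}} p≤Fp) FpFp²≤q

      ∑f² : ∀ (g : ℕ → ℤ) {C} → (∀ x → g x ² ≤ C) → ∑ R (λ x → g x ²) ≤ + p * C
      ∑f² g {C} g²≤C = ≤-trans (∑-mono R g²≤C) (≤-reflexive (∑-upTo-const p C))

      h₀ : ∀ x → dilations P f 0 x ≡ f x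
      h₀ x = trans (+-identityʳ (f (1 ℕ.* x))) (cong f (ℕ.*-identityˡ x))

      m₀≤ : m 0 ≤ + p * Fp ²
      m₀≤ = ≤-trans (≤-reflexive (∑-cong R (λ x → cong _² (h₀ x)))) (∑f² f f²)

    module _ (missed : ∀ {u v l} → u ∈ U → v ∈ V → l ∈ P → (v ℕ.* (l ℕ.* u)) % p ≢ a) where

      private
        h₁ : ∀ {u} → u ∈ U → dilations P f 1 u ≡ + length P * - + length V
        h₁ {u} u∈U = begin
          dilations P f 1 u
            ≡⟨ dilations-suc P f 0 u ⟩
          ∑ P (λ l → dilations P f 0 (l ℕ.* u))
            ≡⟨ ∑-cong P (λ l → h₀ (l ℕ.* u)) ⟩
          ∑ P (λ l → f (l ℕ.* u))
            ≡⟨ ∑-cong-∈ P (λ {l} l∈P → balanced-off-support p-prime p∤V 0<a a<p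
                 (λ p∣lu → case euclidsLemma l u p-prime p∣lu of λ where
                   (inj₁ p∣l) → All.lookup p∤P l∈P p∣l
                   (inj₂ p∣u) → All.lookup p∤U u∈U p∣u)
                 (λ v∈V → missed u∈U v∈V l∈P)) ⟩
          ∑ P (λ _ → - + length V)
            ≡⟨ ∑-const P (- + length V) ⟩
          + length P * - + length V ∎
          where open ≡-Reasoning

        -- Only the points of U are kept in ‖T f‖². There T f is constant, and each residue is met
        -- by at most F entries of U.
        c≤Fm₁ : c ≤ + F * m 1
        c≤Fm₁ = begin
          c
            ≡⟨ lemma (+ length P) (+ length U) (+ length V) ⟩
          + length U * (+ length P * - + length V) ²
            ≡⟨ ∑-const U ((+ length P * - + length V) ²) ⟨
          ∑ U (λ _ → (+ length P * - + length V) ²)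
            ≡⟨ ∑-cong-∈ U (λ u∈U → cong _² (sym (h₁ u∈U))) ⟩
          ∑ U (λ u → dilations P f 1 u ²)
            ≤⟨ ∑-≤-multiplicity U {G = λ u → dilations P f 1 u ²} U-mult U<p (λ n → 0≤i² (dilations P f 1 n)) ⟩
          + F * m 1 ∎
          where
          open ≤-Reasoning
          lemma : ∀ b u v → (b * b) * (u * (v * v)) ≡ u * ((b * - v) * (b * - v))
          lemma = solve-∀

        ratio : c * m 0 ≤ q * m 1
        ratio = begin
          c * m 0
            ≤⟨ *-monoʳ-≤-0≤ 0≤c m₀≤ ⟩
          c * (+ p * Fp ²)
            ≤⟨ *-monoʳ-≤-nonNeg (+ p * Fp ²) {{nonNegative (0≤i*j {+ p} (+≤+ ℕ.z≤n) (0≤i² Fp))}} c≤Fm₁ ⟩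
          + F * m 1 * (+ p * Fp ²)
            ≡⟨ lemma (+ F) (m 1) (+ p) (Fp ²) ⟩
          (Fp * Fp ²) * m 1
            ≤⟨ *-monoʳ-≤-nonNeg (m 1) {{nonNegative (0≤moment p-prime p∤P f-per 1)}} FpFp²≤q ⟩
          q * m 1 ∎
          where
          open ≤-Reasoning
          lemma : ∀ F m p s → F * m * (p * s) ≡ (F * p * s) * m
          lemma = solve-∀

      -- φ n = ⟨f (n ·), T^(r+1) f⟩ for the balanced indicator f, so that the sum of φ over the
      -- products of r + 1 elements of P is ‖T^(r+1) f‖².
      detector : ∀ r → Detector P ((+ length (choices (replicate (suc r) P))) ² * q ²)
                         (c ^ suc r) (+ F * q ^ r) (suc r) p
      detector r = record
        { φ         = φ
        ; periodic  = λ n → ∑-cong R (λ x → cong (_* h x) (f-per* x n))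
        ; mean-zero = mean-zero
        ; bounded   = bounded
        ; detects   = subst (λ i → c ^ suc r ≤ + F * q ^ r * i) (sym ∑φ)
                        (moment-lower-bound p-prime p∤P f-per {F = + F} 0≤c 0≤q (+≤+ ℕ.z≤n) ratio c≤Fm₁ r)
        }
        where
        ts = choices (replicate (suc r) P)
        h : ℕ → ℤ
        h = dilations P f (suc r)
        φ : ℕ → ℤ
        φ n = ∑ R (λ x → f (n ℕ.* x) * h x)
        f-per* : ∀ x → Periodic p (λ n → f (n ℕ.* x))
        f-per* x n = begin
          f ((p ℕ.+ n) ℕ.* x)  ≡⟨ cong f (ℕ.*-comm (p ℕ.+ n) x) ⟩
          f (x ℕ.* (p ℕ.+ n))  ≡⟨ periodic-dilate {p} {f} f-per x n ⟩
          f (x ℕ.* n)          ≡⟨ cong f (ℕ.*-comm x n) ⟩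
          f (n ℕ.* x)          ∎
          where open ≡-Reasoning
        ∑f-dilate : ∀ x → ∑ R (λ n → f (n ℕ.* x)) ≡ 0ℤ
        ∑f-dilate x with p ∣? x
        ... | yes p∣x = trans (∑-cong R (λ n → balanced-0 p-prime p∤V 0<a a<p (∣n⇒∣m*n n p∣x))) (∑-0 R)
        ... | no  p∤x = begin
          ∑ R (λ n → f (n ℕ.* x))  ≡⟨ ∑-cong R (λ n → cong f (ℕ.*-comm n x)) ⟩
          ∑ R (λ n → f (x ℕ.* n))  ≡⟨ ∑-dilate {f = f} f-per (prime∤⇒coprime p-prime p∤x) ⟩
          ∑ R f                    ≡⟨ ∑-balanced p-prime p∤V 0<a a<p ⟩
          0ℤ                       ∎
          where open ≡-Reasoning
        mean-zero : ∑ R φ ≡ 0ℤ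
        mean-zero = begin
          ∑ R (λ n → ∑ R (λ x → f (n ℕ.* x) * h x))
            ≡⟨ ∑-swap R R (λ n x → f (n ℕ.* x) * h x) ⟩
          ∑ R (λ x → ∑ R (λ n → f (n ℕ.* x) * h x))
            ≡⟨ ∑-cong R (λ x → trans (∑-*ʳ R (h x) (λ n → f (n ℕ.* x)))
                 (trans (cong (_* h x) (∑f-dilate x)) (*-zeroˡ (h x)))) ⟩
          ∑ R (λ _ → 0ℤ)
            ≡⟨ ∑-0 R ⟩
          0ℤ ∎
          where open ≡-Reasoning
        -- Cauchy-Schwarz in x. The norm of x ↦ f (n x) is estimated pointwise, which treats all n
        -- alike, multiples of p included.
        bounded : ∀ n → φ n ² ≤ (+ length ts) ² * q ²
        bounded n = begin
          φ n ²
            ≤⟨ cauchy-schwarz R (λ x → f (n ℕ.* x)) h ⟩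
          ∑ R (λ x → f (n ℕ.* x) ²) * ∑ R (λ x → h x ²)
            ≤⟨ *-mono-≤-0≤ (∑-0≤ R (λ x → 0≤i² (f (n ℕ.* x)))) (0≤i*j (0≤i² (+ length ts)) 0≤q) ∑₁ ∑₂ ⟩
          q * ((+ length ts) ² * q)
            ≡⟨ lemma q ((+ length ts) ²) ⟩
          (+ length ts) ² * q ² ∎
          where
          open ≤-Reasoning
          lemma : ∀ q b → q * (b * q) ≡ b * (q * q)
          lemma = solve-∀
          lemma₂ : ∀ p b s → p * (b * s) ≡ b * (p * s)
          lemma₂ = solve-∀
          ∑₁ : ∑ R (λ x → f (n ℕ.* x) ²) ≤ q
          ∑₁ = ≤-trans (∑f² (λ x → f (n ℕ.* x)) (λ x → f² (n ℕ.* x))) pFp²≤q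
          ∑₂ : ∑ R (λ x → h x ²) ≤ (+ length ts) ² * q
          ∑₂ = begin
            ∑ R (λ x → h x ²)
              ≤⟨ ∑f² h (dilations-² P {f} f² (suc r)) ⟩
            + p * ((+ length ts) ² * Fp ²)
              ≡⟨ lemma₂ (+ p) ((+ length ts) ²) (Fp ²) ⟩
            (+ length ts) ² * (+ p * Fp ²)
              ≤⟨ *-monoʳ-≤-0≤ (0≤i² (+ length ts)) pFp²≤q ⟩
            (+ length ts) ² * q ∎
        ∑φ : ∑ ts φ ≡ m (suc r)
        ∑φ = begin
          ∑ ts (λ n → ∑ R (λ x → f (n ℕ.* x) * h x))
            ≡⟨ ∑-swap ts R (λ n x → f (n ℕ.* x) * h x) ⟩
          ∑ R (λ x → ∑ ts (λ n → f (n ℕ.* x) * h x))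
            ≡⟨ ∑-cong R (λ x → ∑-*ʳ ts (h x) (λ n → f (n ℕ.* x))) ⟩
          m (suc r) ∎
          where open ≡-Reasoning

-- The large sieve bound for the number of primes with a detector.

module Counting where

  open Choices
  open Correlation
  open import Data.Integer.Base hiding (suc; NonZero; ∣_∣; _/_; _%_)
  open import Data.Integer.Properties
  open import Data.List.Base using (List; []; _∷_; length; map; replicate; upTo)
  open import Data.List.Membership.Propositional using (_∈_)
  open import Data.List.Properties using (length-map; length-replicate)
  open import Data.List.Relation.Unary.All as All using (All; []; _∷_)
  import Data.List.Relation.Unary.All.Properties as All
  open import Data.List.Relation.Unary.AllPairs as AllPairs using (AllPairs)
  import Data.List.Relation.Unary.AllPairs.Properties as AllPairs
  open import Data.List.Relation.Unary.Unique.Propositional using (Unique)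
  open import Data.Nat.Base as ℕ using (ℕ; zero; suc; _!)
  open import Data.Nat.Divisibility using (_∣_)
  open import Data.Nat.Primality using (Prime; prime⇒nonZero)
  import Data.Nat.Properties as ℕ
  open import Data.Product.Base using (_×_; _,_; proj₁; ∃; ∃-syntax)
  open FiniteSums
  open import Function.Base using (_∘_)
  open LargeSieve
  open import Relation.Binary.PropositionalEquality
    using (_≡_; _≢_; refl; trans; cong; cong₂; subst)
  open BalancedIndicator using (∑-upTo-const)
  open ResidueSums

  -- Each prime is paired with its own detector, so that sums over the primes may use the functions
  -- φ.
  All⇒list : ∀ {A : Set} {Q : A → Set} {xs} → All Q xs → ∃[ ws ] map (proj₁ {B = Q}) ws ≡ xs
  All⇒list []         = [] , refl
  All⇒list (qx ∷ qxs) with ws , refl ← All⇒list qxs = (_ , qx) ∷ ws , refl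

  module _ {P : List ℕ} {B L C r P₀ y : ℕ} (P-block : PrimeBlock P) (P≤y : All (ℕ._≤ y) P) where

    private
      D : ℕ → Set
      D p = Prime p × p ℕ.≤ P₀ × Detector P (+ B) (+ L) (+ C) r p
      ts = choices (replicate r P)
      -- One more than the bound y^r for the products, as `upTo N` excludes N.
      N = suc (y ℕ.^ r)

    module _ (ws : List (∃ D)) (ws! : Unique (map proj₁ ws)) where

      private
        T = + length ws
        φ : ∃ D → ℕ → ℤ
        φ (_ , _ , _ , d) = Detector.φ d
        S : ℕ → ℤ
        S n = ∑ ws (λ w → φ w n)
        E = + (P₀ ℕ.* P₀) * + B

        sieve : ∑ (upTo N) (λ n → S n ²) ≤ T * (+ N * + B) + T * T * E
        sieve = ∑-∑² (upTo N) φ (0≤i*j {+ (P₀ ℕ.* P₀)} {+ B} (+≤+ ℕ.z≤n) (+≤+ ℕ.z≤n)) ws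
          (All.tabulate (λ {w} _ → diagonal w)) (AllPairs.map (λ {w} {v} → off-diagonal {w} {v}) (AllPairs.map⁻ ws!))
          where
          diagonal : ∀ w → ∑ (upTo N) (λ n → φ w n ²) ≤ + N * + B
          diagonal (_ , _ , _ , d) = ≤-trans (∑-mono (upTo N) (Detector.bounded d))
            (≤-reflexive (∑-upTo-const N (+ B)))
          off-diagonal : ∀ {w v} → proj₁ w ≢ proj₁ v → ∑ (upTo N) (λ n → φ w n * φ v n) ≤ E
          off-diagonal {p , p-prime , p≤ , d} {q , q-prime , q≤ , d′} p≢q = ≤-trans
            (∑-periodic-*-periodic-≤ {p} {q} {{prime⇒nonZero p-prime}} {{prime⇒nonZero q-prime}}
              (prime∤⇒coprime p-prime (p≢q ∘ prime∣prime⇒≡ p-prime q-prime))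
              (Detector.periodic d) (Detector.periodic d′) (Detector.mean-zero d)
              (Detector.bounded d) (Detector.bounded d′) N)
            (*-monoʳ-≤-nonNeg (+ B) (+≤+ (ℕ.*-mono-≤ p≤ q≤)))

        detected : T * + L ≤ + C * ∑ ts S
        detected = begin
          T * + L                              ≡⟨ ∑-const ws (+ L) ⟨
          ∑ ws (λ _ → + L)                     ≤⟨ ∑-mono ws (λ { (_ , _ , _ , d) → Detector.detects d }) ⟩
          ∑ ws (λ w → + C * ∑ ts (φ w))        ≡⟨ ∑-*ˡ ws (+ C) (λ w → ∑ ts (φ w)) ⟩
          + C * ∑ ws (λ w → ∑ ts (φ w))        ≡⟨ cong (+ C *_) (∑-swap ws ts φ) ⟩
          + C * ∑ ts S                         ∎
          where open ≤-Reasoning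

        spread : ∑ ts (λ n → S n ²) ≤ + (r !) * ∑ (upTo N) (λ n → S n ²)
        spread = ∑-≤-multiplicity ts {G = λ n → S n ²}
          (subst (λ k → ∀ n → ∑ ts (λ t → δ t n) ≤ + (k !)) (length-replicate r)
            (choices-multiplicity (replicate r P) (All.replicate⁺ r P-block)))
          (λ {x} x∈ → ℕ.s≤s (subst (λ k → x ℕ.≤ y ℕ.^ k) (length-replicate r)
            (choices-≤ (replicate r P) (All.replicate⁺ r P≤y) x∈)))
          (λ n → 0≤i² (S n))

        -- The duality step: all detectors are added on the same products, Cauchy-Schwarz is applied
        -- there, and only then is the square extended to the full interval, where `sieve` applies.
        bound : (T * + L) ² ≤ (+ C) ² * (+ length ts * (+ (r !) * (T * (+ N * + B) + T * T * E)))
        bound = begin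
          (T * + L) ²
            ≤⟨ *-mono-≤-0≤ 0≤TL (≤-trans 0≤TL detected) detected detected ⟩
          (+ C * ∑ ts S) ²
            ≡⟨ square (+ C) (∑ ts S) ⟩
          (+ C) ² * (∑ ts S) ²
            ≤⟨ *-monoʳ-≤-0≤ (0≤i² (+ C)) (begin
              (∑ ts S) ²
                ≤⟨ ∑²≤length*∑² ts S ⟩
              + length ts * ∑ ts (λ n → S n ²)
                ≤⟨ *-monoˡ-≤-nonNeg (+ length ts) (≤-trans spread (*-monoˡ-≤-nonNeg (+ (r !)) sieve)) ⟩
              + length ts * (+ (r !) * (T * (+ N * + B) + T * T * E)) ∎) ⟩
          (+ C) ² * (+ length ts * (+ (r !) * (T * (+ N * + B) + T * T * E))) ∎
          where
          open ≤-Reasoning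
          open import Data.Integer.Tactic.RingSolver using (solve-∀)
          square : ∀ a b → (a * b) * (a * b) ≡ (a * a) * (b * b)
          square = solve-∀
          0≤TL : 0ℤ ≤ T * + L
          0≤TL = 0≤i*j {T} {+ L} (+≤+ ℕ.z≤n) (+≤+ ℕ.z≤n)

      detectors-bound′ : let T = length ws in
        (T ℕ.* L) ℕ.* (T ℕ.* L) ℕ.≤
        (C ℕ.* C) ℕ.* (length ts ℕ.* (r ! ℕ.* (T ℕ.* (N ℕ.* B) ℕ.+ T ℕ.* T ℕ.* (P₀ ℕ.* P₀ ℕ.* B))))
      detectors-bound′ = drop‿+≤+ (begin
        + (t ℕ.* L ℕ.* (t ℕ.* L))
          ≡⟨ trans (pos-* (t ℕ.* L) (t ℕ.* L)) (cong _² (pos-* t L)) ⟩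
        (T * + L) ²
          ≤⟨ bound ⟩
        (+ C) ² * (+ length ts * (+ (r !) * (T * (+ N * + B) + T * T * E)))
          ≡⟨ pos-eq ⟨
        + (C ℕ.* C ℕ.* (length ts ℕ.* (r ! ℕ.* (t ℕ.* (N ℕ.* B) ℕ.+ t ℕ.* t ℕ.* (P₀ ℕ.* P₀ ℕ.* B))))) ∎)
        where
        open ≤-Reasoning
        t = length ws
        pos-eq : + (C ℕ.* C ℕ.* (length ts ℕ.* (r ! ℕ.* (t ℕ.* (N ℕ.* B) ℕ.+ t ℕ.* t ℕ.* (P₀ ℕ.* P₀ ℕ.* B))))) ≡
                 (+ C) ² * (+ length ts * (+ (r !) * (T * (+ N * + B) + T * T * E)))
        pos-eq = trans (pos-* (C ℕ.* C) _) (cong₂ _*_ (pos-* C C)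
          (trans (pos-* (length ts) _) (cong (+ length ts *_)
          (trans (pos-* (r !) _) (cong (+ (r !) *_)
          (trans (pos-+ (t ℕ.* (N ℕ.* B)) _) (cong₂ _+_
            (trans (pos-* t (N ℕ.* B)) (cong (T *_) (pos-* N B)))
            (trans (pos-* (t ℕ.* t) (P₀ ℕ.* P₀ ℕ.* B)) (cong₂ _*_ (pos-* t t) (pos-* (P₀ ℕ.* P₀) B))))))))))

    detectors-bound : ∀ {ps} → Unique ps → All D ps → let T = length ps in
      (T ℕ.* L) ℕ.* (T ℕ.* L) ℕ.≤
      (C ℕ.* C) ℕ.* (length ts ℕ.* (r ! ℕ.* (T ℕ.* (N ℕ.* B) ℕ.+ T ℕ.* T ℕ.* (P₀ ℕ.* P₀ ℕ.* B))))
    detectors-bound ps! ds with ws , refl ← All⇒list ds rewrite length-map proj₁ ws = detectors-bound′ ws ps!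

-- Chebyshev's lower bound for the number of primes.

module PrimeCount where

  open Choices
  open import Data.List.Base using (List; []; _∷_; filter; length; map; upTo)
  open import Data.List.Membership.Propositional using (_∈_)
  open import Data.List.Membership.Propositional.Properties using (∈-filter⁺; ∈-map⁺; ∈-upTo⁺)
  open import Data.Nat.Base
  open import Data.Nat.Coprimality as Coprimality using (coprime-divisor)
  open import Data.Nat.Divisibility
  open import Data.Nat.Induction using (<-rec)
  open import Data.Nat.ListAction using (product)
  open import Data.Nat.ListAction.Properties using (∈⇒∣product)
  open import Data.Nat.Primality
  open import Data.Nat.Primality.Factorisation using (factorise)
  open import Data.Nat.Properties
  open import Data.Nat.Tactic.RingSolver using (solve-∀)
  open import Data.List.Relation.Unary.All using ([]; _∷_)
  open import Data.Product.Base using (_×_; _,_; ∃-syntax)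
  open import Relation.Binary.PropositionalEquality
    using (_≡_; _≢_; refl; sym; trans; cong; cong₂; subst; module ≡-Reasoning)
  open import Relation.Nullary using (yes; no; ¬_; contradiction)

  -- (i + j) choose i
  binom : ℕ → ℕ → ℕ
  binom zero    j       = 1
  binom (suc i) zero    = 1
  binom (suc i) (suc j) = binom i (suc j) + binom (suc i) j

  binom-zeroʳ : ∀ i → binom i 0 ≡ 1
  binom-zeroʳ zero    = refl
  binom-zeroʳ (suc i) = refl

  -- The two absorption identities need each other: together, at (i, j), they turn the two summands
  -- of Pascal's rule into multiples of one binomial coefficient.
  binom-sucˡ : ∀ i j → suc i * binom (suc i) j ≡ suc (i + j) * binom i j
  binom-sucʳ : ∀ i j → suc j * binom i (suc j) ≡ suc (i + j) * binom i j

  binom-sucˡ i zero    = cong₂ (λ k b → suc k * b) (sym (+-identityʳ i)) (sym (binom-zeroʳ i))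
  binom-sucˡ i (suc j) = begin
    suc i * (binom i (suc j) + binom (suc i) j)
      ≡⟨ *-distribˡ-+ (suc i) (binom i (suc j)) (binom (suc i) j) ⟩
    suc i * binom i (suc j) + suc i * binom (suc i) j
      ≡⟨ cong (suc i * binom i (suc j) +_) (trans (binom-sucˡ i j) (sym (binom-sucʳ i j))) ⟩
    suc i * binom i (suc j) + suc j * binom i (suc j)
      ≡⟨ *-distribʳ-+ (binom i (suc j)) (suc i) (suc j) ⟨
    suc (i + suc j) * binom i (suc j) ∎
    where open ≡-Reasoning

  binom-sucʳ zero    j = refl
  binom-sucʳ (suc i) j = begin
    suc j * (binom i (suc j) + binom (suc i) j)
      ≡⟨ *-distribˡ-+ (suc j) (binom i (suc j)) (binom (suc i) j) ⟩
    suc j * binom i (suc j) + suc j * binom (suc i) j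
      ≡⟨ cong (_+ suc j * binom (suc i) j) (trans (binom-sucʳ i j) (sym (binom-sucˡ i j))) ⟩
    suc i * binom (suc i) j + suc j * binom (suc i) j
      ≡⟨ *-distribʳ-+ (binom (suc i) j) (suc i) (suc j) ⟨
    (suc i + suc j) * binom (suc i) j
      ≡⟨ cong (_* binom (suc i) j) (+-suc (suc i) j) ⟩
    suc (suc i + j) * binom (suc i) j ∎
    where open ≡-Reasoning

  binom-≤-sucʳ : ∀ i j → binom i j ≤ binom i (suc j)
  binom-≤-sucʳ zero    j = ≤-refl
  binom-≤-sucʳ (suc i) j = m≤n+m (binom (suc i) j) (binom i (suc j))

  binom-≤-sucˡ : ∀ i j → binom i j ≤ binom (suc i) j
  binom-≤-sucˡ i zero    = ≤-reflexive (binom-zeroʳ i)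
  binom-≤-sucˡ i (suc j) = m≤m+n (binom i (suc j)) (binom (suc i) j)

  -- The next central coefficient is, by Pascal's rule, a sum of two terms, each at least the
  -- present one.
  2^m≤binom : ∀ m → 2 ^ m ≤ binom m m
  2^m≤binom zero    = ≤-refl
  2^m≤binom (suc m) = begin
    2 * 2 ^ m                            ≤⟨ *-monoʳ-≤ 2 (2^m≤binom m) ⟩
    binom m m + (binom m m + 0)          ≡⟨ cong (binom m m +_) (+-identityʳ (binom m m)) ⟩
    binom m m + binom m m                ≤⟨ +-mono-≤ (binom-≤-sucʳ m m) (binom-≤-sucˡ m m) ⟩
    binom m (suc m) + binom (suc m) m    ∎
    where open ≤-Reasoning

  -- The numbers (i + j + 1) binom i j are the denominators of Leibniz's harmonic triangle:
  -- each reciprocal is the sum of the two below it.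
  leibniz-∣ : ∀ {D} j i → (∀ {k} → 1 ≤ k → k ≤ suc (i + j) → k ∣ D) → suc (i + j) * binom i j ∣ D
  leibniz-∣ {D} zero i all∣D = subst (_∣ D) (sym (trans (cong (suc (i + 0) *_) (binom-zeroʳ i))
    (*-identityʳ (suc (i + 0))))) (all∣D (s≤s z≤n) ≤-refl)
  leibniz-∣ {D} (suc j) i all∣D
    with divides x D≡xa₁ ← leibniz-∣ j i (λ 1≤k k≤ → all∣D 1≤k (≤-trans k≤ (s≤s (+-monoʳ-≤ i (n≤1+n j)))))
    with divides z D≡za₂ ← leibniz-∣ j (suc i) (λ {k} 1≤k k≤ → all∣D 1≤k (subst (k ≤_) (cong suc (sym (+-suc i j))) k≤)) =
    -- The triangle gives `D / a₃ = D / a₁ - D / a₂ = x - z`, used in the form `x a₃ = z a₃ + D`.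
    ∣m+n∣m⇒∣n (divides x (sym x*a₃)) (divides z refl)
    where
    a₁ = suc (i + j) * binom i j
    a₂ = suc (suc i + j) * binom (suc i) j
    a₃ = suc (i + suc j) * binom i (suc j)
    a₃-a₁ : suc j * a₃ ≡ suc (i + suc j) * a₁
    a₃-a₁ = trans (lemma (suc j) (suc (i + suc j)) (binom i (suc j))) (cong (suc (i + suc j) *_) (binom-sucʳ i j))
      where
      lemma : ∀ a b c → a * (b * c) ≡ b * (a * c)
      lemma = solve-∀
    a₂-a₁ : suc i * a₂ ≡ suc (i + suc j) * a₁
    a₂-a₁ = begin
      suc i * (suc (suc i + j) * binom (suc i) j)  ≡⟨ lemma (suc i) (suc (suc i + j)) (binom (suc i) j) ⟩
      suc (suc i + j) * (suc i * binom (suc i) j)  ≡⟨ cong₂ _*_ (cong suc (sym (+-suc i j))) (binom-sucˡ i j) ⟩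
      suc (i + suc j) * a₁                         ∎
      where
      open ≡-Reasoning
      lemma : ∀ a b c → a * (b * c) ≡ b * (a * c)
      lemma = solve-∀
    x*a₃ : x * a₃ ≡ z * a₃ + D
    x*a₃ = *-cancelˡ-≡ (x * a₃) (z * a₃ + D) (suc j) (begin
      suc j * (x * a₃)                ≡⟨ swap (suc j) x a₃ ⟩
      x * (suc j * a₃)                ≡⟨ cong (x *_) a₃-a₁ ⟩
      x * (suc (i + suc j) * a₁)      ≡⟨ swap x (suc (i + suc j)) a₁ ⟩
      suc (i + suc j) * (x * a₁)      ≡⟨ cong (suc (i + suc j) *_) D≡xa₁ ⟨
      suc (i + suc j) * D             ≡⟨ *-distribʳ-+ D (suc i) (suc j) ⟩
      suc i * D + suc j * D           ≡⟨ cong (λ n → suc i * n + suc j * D) D≡za₂ ⟩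
      suc i * (z * a₂) + suc j * D    ≡⟨ cong (_+ suc j * D) (trans (swap (suc i) z a₂)
                                          (cong (z *_) (trans a₂-a₁ (sym a₃-a₁)))) ⟩
      z * (suc j * a₃) + suc j * D    ≡⟨ cong (_+ suc j * D) (swap z (suc j) a₃) ⟩
      suc j * (z * a₃) + suc j * D    ≡⟨ *-distribˡ-+ (suc j) (z * a₃) D ⟨
      suc j * (z * a₃ + D)            ∎)
      where
      open ≡-Reasoning
      swap : ∀ a b c → a * (b * c) ≡ b * (a * c)
      swap = solve-∀

  ∃-log : ∀ {b} → 1 < b → ∀ n → ∃[ e ] b ^ e ≤ suc n × suc n < b ^ suc e
  ∃-log {b} 1<b zero = 0 , ≤-refl , subst (1 <_) (sym (*-identityʳ b)) 1<b
  ∃-log {b} 1<b (suc n) with e , b^e≤ , <b^ ← ∃-log 1<b n with suc (suc n) <? b ^ suc e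
  ... | yes <b^′ = e , m≤n⇒m≤1+n b^e≤ , <b^′
  ... | no  ≮b^  = suc e , ≮⇒≥ ≮b^ , (begin-strict
    suc (suc n)        ≤⟨ <b^ ⟩
    b ^ suc e          <⟨ ^-monoʳ-< b 1<b (n<1+n (suc e)) ⟩
    b ^ suc (suc e)    ∎)
    where open ≤-Reasoning

  primesUpTo : ℕ → List ℕ
  primesUpTo n = filter prime? (upTo (suc n))

  ∈-primesUpTo : ∀ {p n} → Prime p → p ≤ n → p ∈ primesUpTo n
  ∈-primesUpTo p-prime p≤n = ∈-filter⁺ prime? (∈-upTo⁺ (s≤s p≤n)) p-prime

  -- The bound is n + 1 rather than n; the value 1 for p ≤ 1 is junk.
  largestPower : ℕ → ℕ → ℕ
  largestPower n p with 1 <? p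
  ... | yes 1<p = let e , _ = ∃-log 1<p n in p ^ e
  ... | no  _   = 1

  largestPower-≤ : ∀ n p → largestPower n p ≤ suc n
  largestPower-≤ n p with 1 <? p
  ... | yes 1<p = let _ , p^e≤ , _ = ∃-log 1<p n in p^e≤
  ... | no  _   = s≤s z≤n

  ∣largestPower : ∀ {n p} k → Prime p → p ^ k ≤ suc n → p ^ k ∣ largestPower n p
  ∣largestPower {n} {p} k p-prime p^k≤ with 1 <? p
  ... | no  1≮p = contradiction (nonTrivial⇒n>1 p {{prime⇒nonTrivial p-prime}}) 1≮p
  ... | yes 1<p with e , _ , <p^ ← ∃-log 1<p n = p^k∣p^e
    where
    k≤e : k ≤ e
    k≤e = ≮⇒≥ λ e<k → <⇒≱ <p^ (≤-trans (^-monoʳ-≤ p {{prime⇒nonZero p-prime}} e<k) p^k≤)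
    p^k∣p^e : p ^ k ∣ p ^ e
    p^k∣p^e = divides (p ^ (e ∸ k)) (trans (cong (p ^_) (sym (m∸n+n≡m k≤e))) (^-distribˡ-+-* p (e ∸ k) k))

  -- This is lcm(1, ..., n + 1), factored so that each of the π(n + 1) factors is visibly at most n
  -- + 1.
  powersProduct : ℕ → ℕ
  powersProduct n = product (map (largestPower n) (primesUpTo (suc n)))

  powersProduct-≤ : ∀ n → powersProduct n ≤ suc n ^ length (primesUpTo (suc n))
  powersProduct-≤ n = go (primesUpTo (suc n))
    where
    go : ∀ ps → product (map (largestPower n) ps) ≤ suc n ^ length ps
    go []       = ≤-refl
    go (p ∷ ps) = *-mono-≤ (largestPower-≤ n p) (go ps)

  powersProduct≢0 : ∀ n → NonZero (powersProduct n)
  powersProduct≢0 n = go (primesUpTo (suc n))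
    where
    largestPower≢0 : ∀ p → NonZero (largestPower n p)
    largestPower≢0 p with 1 <? p
    ... | yes 1<p = let e , _ = ∃-log 1<p n in m^n≢0 p e {{>-nonZero (<-trans z<s 1<p)}}
    ... | no  _   = _
    go : ∀ ps → NonZero (product (map (largestPower n) ps))
    go []       = _
    go (p ∷ ps) = m*n≢0 _ _ {{largestPower≢0 p}} {{go ps}}

  prime-power-part : ∀ {p} → Prime p → ∀ n → .{{NonZero n}} → ∃[ k ] ∃[ m ] n ≡ p ^ k * m × ¬ p ∣ m
  prime-power-part {p} p-prime = <-rec _ step
    where
    instance _ = prime⇒nonTrivial p-prime
    step : ∀ n → (∀ {m} → m < n → .{{NonZero m}} → ∃[ k ] ∃[ o ] m ≡ p ^ k * o × ¬ p ∣ o) →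
           .{{NonZero n}} → ∃[ k ] ∃[ m ] n ≡ p ^ k * m × ¬ p ∣ m
    step n rec with p ∣? n
    ... | no p∤n = 0 , n , sym (+-identityʳ n) , p∤n
    ... | yes (divides q refl)
      with k , m , q≡ , p∤m ← rec (m<m*n q p {{m*n≢0⇒m≢0 q}} (nonTrivial⇒n>1 p)) {{m*n≢0⇒m≢0 q}} =
      suc k , m , trans (cong (_* p) q≡) (lemma (p ^ k) m p) , p∤m
      where
      lemma : ∀ a m p → a * m * p ≡ p * a * m
      lemma = solve-∀

  -- Strong induction: n = p^k m with k ≥ 1 and p not dividing m. The power p^k divides its own
  -- factor of the product, m < n divides the product by induction, and coprimality combines the
  -- two.
  ∣powersProduct : ∀ N n → .{{NonZero n}} → n ≤ suc N → n ∣ powersProduct N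
  ∣powersProduct N = <-rec _ step
    where
    D = powersProduct N
    step : ∀ n → (∀ {m} → m < n → .{{NonZero m}} → m ≤ suc N → m ∣ D) → .{{NonZero n}} → n ≤ suc N → n ∣ D
    step n rec n≤ with factorise n
    ... | record { factors = [] ; isFactorisation = refl } = 1∣ D
    ... | record { factors = p ∷ ps ; isFactorisation = n≡ ; factorsPrime = p-prime ∷ _ } =
      helper (prime-power-part p-prime n)
      where
      instance _ = prime⇒nonTrivial p-prime
      p∣n : p ∣ n
      p∣n = subst (p ∣_) (sym n≡) (m∣m*n (product ps))
      strip : ∀ k {m t} → ¬ p ∣ m → m ∣ p ^ k * t → m ∣ t
      strip zero    {m} {t} p∤m m∣ = subst (m ∣_) (+-identityʳ t) m∣
      strip (suc k) {m} {t} p∤m m∣ = strip k p∤m (coprime-divisor (Coprimality.sym (prime∤⇒coprime p-prime p∤m))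
        (subst (m ∣_) (*-assoc p (p ^ k) t) m∣))
      helper : ∃[ k ] ∃[ m ] n ≡ p ^ k * m × ¬ p ∣ m → n ∣ D
      helper (zero , m , n≡m , p∤m) = contradiction (subst (p ∣_) (trans n≡m (+-identityʳ m)) p∣n) p∤m
      helper (k@(suc k′) , m , n≡p^k*m , p∤m) = subst (_∣ D) (sym n≡p^k*m) (combine p^k∣D)
        where
        instance
          m≢0 : NonZero m
          m≢0 = m*n≢0⇒n≢0 (p ^ k) {{subst NonZero n≡p^k*m it}}
            where it : NonZero n
                  it = ≢-nonZero (λ n≡0 → ≢-nonZero⁻¹ n n≡0)
        m<n : m < n
        m<n = subst (m <_) (sym (trans n≡p^k*m (*-comm (p ^ k) m)))
          (m<m*n m (p ^ k) (≤-trans (nonTrivial⇒n>1 p) (≤-trans (≤-reflexive (sym (*-identityʳ p)))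
            (*-monoʳ-≤ p (m^n>0 p {{prime⇒nonZero p-prime}} k′)))))
        p^k∣n : p ^ k ∣ n
        p^k∣n = subst (p ^ k ∣_) (sym n≡p^k*m) (m∣m*n m)
        p≤ : p ≤ suc N
        p≤ = ≤-trans (∣⇒≤ p∣n) n≤
        p^k∣D : p ^ k ∣ D
        p^k∣D = ∣-trans (∣largestPower k p-prime (≤-trans (∣⇒≤ p^k∣n) n≤))
          (∈⇒∣product (∈-map⁺ (largestPower N) (∈-primesUpTo p-prime p≤)))
        combine : p ^ k ∣ D → p ^ k * m ∣ D
        combine (divides t D≡) = subst (p ^ k * m ∣_) (sym (trans D≡ (*-comm t (p ^ k))))
          (*-monoʳ-∣ (p ^ k) (strip k p∤m (subst (m ∣_) (trans D≡ (*-comm t (p ^ k)))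
            (rec m<n (≤-trans (<⇒≤ m<n) n≤)))))

  -- With n = 2^s and y = 2n, 2^n ≤ lcm(1, ..., y) ≤ y^π(y) = 2^((s + 1) π(y)), and the exponents
  -- are compared. For y a power of 2 its logarithm is an integer.
  chebyshev : ∀ s → 2 ^ suc s ≤ 2 * (suc s * length (primesUpTo (2 ^ suc s)))
  chebyshev s = *-monoʳ-≤ 2 (2^-cancel-≤ {2 ^ s} {suc s * π} (go (2 ^ s) refl))
    where
    π = length (primesUpTo (2 ^ suc s))
    open ≤-Reasoning
    2^-cancel-≤ : ∀ {a b} → 2 ^ a ≤ 2 ^ b → a ≤ b
    2^-cancel-≤ {a} {b} 2^a≤2^b = ≮⇒≥ λ b<a → <⇒≱ (^-monoʳ-< 2 (s≤s (s≤s z≤n)) b<a) 2^a≤2^b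
    go : ∀ n → n ≡ 2 ^ s → 2 ^ n ≤ 2 ^ (suc s * length (primesUpTo (2 ^ suc s)))
    go zero    n≡ = contradiction (sym n≡) (≢-nonZero⁻¹ (2 ^ s) {{m^n≢0 2 s}})
    go (suc m) n≡ = begin
      2 * 2 ^ m                                ≤⟨ *-mono-≤ (s≤s (s≤s (z≤n {m + m}))) (≤-trans (2^m≤binom m) (binom-≤-sucˡ m m)) ⟩
      suc (suc m + m) * binom (suc m) m        ≤⟨ ∣⇒≤ {{powersProduct≢0 (suc m + m)}} (leibniz-∣ m (suc m)
                                                    (λ {k} 1≤k k≤ → ∣powersProduct (suc m + m) k {{>-nonZero 1≤k}} k≤)) ⟩
      powersProduct (suc m + m)                ≤⟨ powersProduct-≤ (suc m + m) ⟩
      suc (suc m + m) ^ length (primesUpTo (suc (suc m + m)))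
                                               ≡⟨ cong (λ y → y ^ length (primesUpTo y)) y≡ ⟩
      (2 ^ suc s) ^ length (primesUpTo (2 ^ suc s))
                                               ≡⟨ ^-*-assoc 2 (suc s) π ⟩
      2 ^ (suc s * length (primesUpTo (2 ^ suc s))) ∎
      where
      y≡ : suc (suc m + m) ≡ 2 ^ suc s
      y≡ = trans (lemma m) (cong (2 *_) n≡)
        where
        lemma : ∀ m → suc (suc m + m) ≡ 2 * suc m
        lemma = solve-∀

-- Polynomials against powers of 2, and the arithmetic of the sieve bound.

module Growth where

  open import Data.Nat.Base
  open import Data.Nat.DivMod using (m/n*n≤m; m≡m%n+[m/n]*n; m%n<n)
  open import Data.Nat.Properties
  open import Data.Nat.Tactic.RingSolver using (solve-∀)
  open import Data.Product.Base using (_,_; ∃-syntax)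
  open import Relation.Binary.PropositionalEquality
    using (_≡_; refl; sym; trans; cong; cong₂; subst)

  ^-distribʳ-* : ∀ m n o → (m * n) ^ o ≡ m ^ o * n ^ o
  ^-distribʳ-* m n zero    = refl
  ^-distribʳ-* m n (suc o) = trans (cong (m * n *_) (^-distribʳ-* m n o)) (lemma m n (m ^ o) (n ^ o))
    where
    lemma : ∀ m n a b → m * n * (a * b) ≡ m * a * (n * b)
    lemma = solve-∀

  ^-swap : ∀ m n o → (m ^ n) ^ o ≡ (m ^ o) ^ n
  ^-swap m n o = trans (^-*-assoc m n o) (trans (cong (m ^_) (*-comm n o)) (sym (^-*-assoc m o n)))

  suc[n]≤2^n : ∀ n → suc n ≤ 2 ^ n
  suc[n]≤2^n zero    = ≤-refl
  suc[n]≤2^n (suc n) = begin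
    suc (suc n)          ≤⟨ +-mono-≤ (s≤s (z≤n {n})) (suc[n]≤2^n n) ⟩
    suc n + 2 ^ n        ≤⟨ +-monoˡ-≤ (2 ^ n) (suc[n]≤2^n n) ⟩
    2 ^ n + 2 ^ n        ≡⟨ cong (2 ^ n +_) (+-identityʳ (2 ^ n)) ⟨
    2 ^ suc n            ∎
    where open ≤-Reasoning

  -- With n = k + 1 and m the integer part of s / n, 2^s ≥ (2^m)^n ≥ (m + 1)^n ≥ (s / n)^n. This has
  -- one power of s to spare, which absorbs C n^n.
  C*s^k≤2^s : ∀ C k → ∃[ s₀ ] (∀ s → s₀ ≤ s → C * s ^ k ≤ 2 ^ s)
  C*s^k≤2^s C k = C * n ^ n , bound
    where
    n = suc k
    bound : ∀ s → C * n ^ n ≤ s → C * s ^ k ≤ 2 ^ s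
    bound s C*n^n≤s = *-cancelʳ-≤ (C * s ^ k) (2 ^ s) (n ^ n) {{m^n≢0 n n}} (begin
      C * s ^ k * n ^ n         ≡⟨ lemma C (s ^ k) (n ^ n) ⟩
      C * n ^ n * s ^ k         ≤⟨ *-monoˡ-≤ (s ^ k) C*n^n≤s ⟩
      s ^ n                     ≤⟨ ^-monoˡ-≤ n s≤ ⟩
      (n * suc m) ^ n           ≡⟨ ^-distribʳ-* n (suc m) n ⟩
      n ^ n * suc m ^ n         ≤⟨ *-monoʳ-≤ (n ^ n) (^-monoˡ-≤ n (suc[n]≤2^n m)) ⟩
      n ^ n * (2 ^ m) ^ n       ≡⟨ cong (n ^ n *_) (^-*-assoc 2 m n) ⟩
      n ^ n * 2 ^ (m * n)       ≤⟨ *-monoʳ-≤ (n ^ n) (^-monoʳ-≤ 2 (m/n*n≤m s n)) ⟩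
      n ^ n * 2 ^ s             ≡⟨ *-comm (n ^ n) (2 ^ s) ⟩
      2 ^ s * n ^ n             ∎)
      where
      open ≤-Reasoning
      m = s / n
      lemma : ∀ a b c → a * b * c ≡ a * c * b
      lemma = solve-∀
      s≤ : s ≤ n * suc m
      s≤ = begin
        s                   ≡⟨ m≡m%n+[m/n]*n s n ⟩
        s % n + m * n       ≤⟨ +-monoˡ-≤ (m * n) (<⇒≤ (m%n<n s n)) ⟩
        suc m * n           ≡⟨ *-comm (suc m) n ⟩
        n * suc m           ∎

  module _ {T b F X D r N P₀ : ℕ} .{{T≢0 : NonZero T}} .{{b≢0 : NonZero b}} where

    private
      R = suc r
      t = b ^ R
      u = t ^ D
      q = X * (X * X)

    -- Since c = b² (b^D)³, L = c^R equals t² u³. Then T t³ is a common factor of both sides.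
    cancel-detectors-bound :
      let c = b * b * (b ^ D * (b ^ D * b ^ D)); L = c ^ R; C = F * q ^ r; B = t * t * (q * q) in
      (T * L) * (T * L) ≤ (C * C) * (t * (R ! * (T * (N * B) + T * T * (P₀ * P₀ * B)))) →
      T * t * u ^ 6 ≤ F * F * R ! * (q ^ R * q ^ R) * (N + T * (P₀ * P₀))
    cancel-detectors-bound bound = *-cancelˡ-≤ (T * (t * t * t)) {{nz}} (begin
      T * (t * t * t) * (T * t * u ^ 6)
        ≡⟨ lhs T t u ⟩
      (T * (t * t * (u * (u * u)))) * (T * (t * t * (u * (u * u))))
        ≡⟨ cong (λ i → (T * i) * (T * i)) L≡ ⟨
      _
        ≤⟨ bound ⟩
      _
        ≡⟨ rhs F (q ^ r) t (R !) T N P₀ q ⟩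
      T * (t * t * t) * (F * F * R ! * (q ^ R * q ^ R) * (N + T * (P₀ * P₀))) ∎)
      where
      open ≤-Reasoning
      instance
        t≢0 : NonZero t
        t≢0 = m^n≢0 b R
      nz : NonZero (T * (t * t * t))
      nz = m*n≢0 T (t * t * t) {{T≢0}} {{m*n≢0 (t * t) t {{m*n≢0 t t}}}}
      L≡ : (b * b * (b ^ D * (b ^ D * b ^ D))) ^ R ≡ t * t * (u * (u * u))
      L≡ = trans (^-distribʳ-* (b * b) _ R) (cong₂ _*_ (^-distribʳ-* b b R)
        (trans (^-distribʳ-* (b ^ D) _ R) (cong₂ _*_ (^-swap b D R)
          (trans (^-distribʳ-* (b ^ D) (b ^ D) R) (cong₂ _*_ (^-swap b D R) (^-swap b D R))))))
      lhs : ∀ T t u → T * (t * t * t) * (T * t * (u * (u * (u * (u * (u * (u * 1))))))) ≡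
            (T * (t * t * (u * (u * u)))) * (T * (t * t * (u * (u * u))))
      lhs = solve-∀
      rhs : ∀ F a t f T N P q →
            (F * a * (F * a)) * (t * (f * (T * (N * (t * t * (q * q))) + T * T * (P * P * (t * t * (q * q)))))) ≡
            T * (t * t * t) * (F * F * f * (q * a * (q * a)) * (N + T * (P * P)))
      rhs = solve-∀

    module _ {y σ G : ℕ} (X≤ : X ≤ F * P₀) (P₀≤ : P₀ ≤ G * y ^ D) (y≤ : y ≤ σ * b) where

      private
        H = ((F * G) ^ R) ^ 3

      -- q^R is at most H ((y^R)^D)³, and y^R ≤ σ^R t makes this u³ up to constants and powers of σ.
      -- So the loss q^(2R) cancels the gain u^6 exactly, leaving only σ, which will be logarithmic.
      substitute-density :
        T * t * u ^ 6 ≤ F * F * R ! * (q ^ R * q ^ R) * (N + T * (P₀ * P₀)) →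
        T * y ^ R ≤ σ ^ R * ((σ ^ R) ^ D) ^ 6 * (F * F * R ! * (H * H)) * (N + T * (P₀ * P₀))
      substitute-density bound = *-cancelʳ-≤ _ _ (u ^ 6) {{m^n≢0 u 6 {{m^n≢0 t D {{m^n≢0 b R}}}}}} (begin
        T * y ^ R * u ^ 6
          ≤⟨ *-monoˡ-≤ (u ^ 6) (*-monoʳ-≤ T y^R≤) ⟩
        T * (Σ * t) * u ^ 6
          ≡⟨ lemma₁ T Σ t (u ^ 6) ⟩
        Σ * (T * t * u ^ 6)
          ≤⟨ *-monoʳ-≤ Σ bound ⟩
        Σ * (F * F * R ! * (q ^ R * q ^ R) * M)
          ≤⟨ *-monoʳ-≤ Σ (*-monoˡ-≤ M (*-monoʳ-≤ (F * F * R !) (*-mono-≤ q^R≤ q^R≤))) ⟩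
        Σ * (F * F * R ! * (H * (Σ ^ D * u) ^ 3 * (H * (Σ ^ D * u) ^ 3)) * M)
          ≡⟨ lemma₂ Σ (F * F * R !) H (Σ ^ D) u M ⟩
        Σ * (Σ ^ D) ^ 6 * (F * F * R ! * (H * H)) * M * u ^ 6 ∎)
        where
        open ≤-Reasoning
        Σ = σ ^ R
        M = N + T * (P₀ * P₀)
        lemma₁ : ∀ T s t u → T * (s * t) * u ≡ s * (T * t * u)
        lemma₁ = solve-∀
        lemma₂ : ∀ s f h d u m → s * (f * (h * ((d * u) * ((d * u) * ((d * u) * 1))) * (h * ((d * u) * ((d * u) * ((d * u) * 1))))) * m) ≡
                 s * (d * (d * (d * (d * (d * (d * 1)))))) * (f * (h * h)) * m * (u * (u * (u * (u * (u * (u * 1))))))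
        lemma₂ = solve-∀
        cube : ∀ x → x * (x * x) ≡ (x * (x * (x * 1)))
        cube = solve-∀
        y^R≤ : y ^ R ≤ Σ * t
        y^R≤ = ≤-trans (^-monoˡ-≤ R y≤) (≤-reflexive (^-distribʳ-* σ b R))
        q^R≤ : q ^ R ≤ H * (Σ ^ D * u) ^ 3
        q^R≤ = begin
          q ^ R
            ≡⟨ cong (_^ R) (cube X) ⟩
          (X ^ 3) ^ R
            ≡⟨ ^-swap X 3 R ⟩
          (X ^ R) ^ 3
            ≤⟨ ^-monoˡ-≤ 3 (^-monoˡ-≤ R (≤-trans X≤ (*-monoʳ-≤ F P₀≤))) ⟩
          ((F * (G * y ^ D)) ^ R) ^ 3
            ≡⟨ cong (λ z → (z ^ R) ^ 3) (*-assoc F G (y ^ D)) ⟨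
          ((F * G * y ^ D) ^ R) ^ 3
            ≡⟨ trans (cong (_^ 3) (^-distribʳ-* (F * G) (y ^ D) R)) (^-distribʳ-* ((F * G) ^ R) ((y ^ D) ^ R) 3) ⟩
          H * ((y ^ D) ^ R) ^ 3
            ≡⟨ cong (λ z → H * z ^ 3) (^-swap y D R) ⟩
          H * ((y ^ R) ^ D) ^ 3
            ≤⟨ *-monoʳ-≤ H (^-monoˡ-≤ 3 (^-monoˡ-≤ D y^R≤)) ⟩
          H * ((Σ * t) ^ D) ^ 3
            ≡⟨ cong (λ z → H * z ^ 3) (^-distribʳ-* Σ t D) ⟩
          H * (Σ ^ D * u) ^ 3 ∎

  -- With v = y^(2D), both y^R / y and P₀² are at most of order v. Division by v leaves
  -- `T y ≤ Z (y + T)`, and `4 Z ≤ y` turns it into 4T ≤ y + T.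
  few-exceptions : ∀ {T y D G K P₀ : ℕ} .{{_ : NonZero y}} → 2 ≤ G * G → P₀ ≤ G * y ^ D →
    T * y ^ suc (D + D) ≤ K * (suc (y ^ suc (D + D)) + T * (P₀ * P₀)) →
    4 * (K * (G * G)) ≤ y → 3 * T ≤ y
  few-exceptions {T} {y} {D} {G} {K} {P₀} 2≤G² P₀≤ bound 4Z≤y = +-cancelʳ-≤ T (3 * T) y
    (*-cancelˡ-≤ y (begin
      y * (3 * T + T)          ≡⟨ lemma₃ y T ⟩
      4 * (T * y)              ≤⟨ *-monoʳ-≤ 4 Ty≤ ⟩
      4 * (Z * (y + T))        ≡⟨ *-assoc 4 Z (y + T) ⟨
      4 * Z * (y + T)          ≤⟨ *-monoˡ-≤ (y + T) 4Z≤y ⟩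
      y * (y + T)              ∎))
    where
    open ≤-Reasoning
    Z = K * (G * G)
    v = y ^ D * y ^ D
    v≢0 : NonZero v
    v≢0 = m*n≢0 (y ^ D) (y ^ D) {{m^n≢0 y D}} {{m^n≢0 y D}}
    y^R : y ^ suc (D + D) ≡ y * v
    y^R = cong (y *_) (^-distribˡ-+-* y D D)
    lemma₁ : ∀ K g y v T → K * (g * (y * v) + T * (g * v)) ≡ K * g * (y + T) * v
    lemma₁ = solve-∀
    lemma₂ : ∀ G a → G * a * (G * a) ≡ G * G * (a * a)
    lemma₂ = solve-∀
    lemma₃ : ∀ y T → y * (3 * T + T) ≡ 4 * (T * y)
    lemma₃ = solve-∀
    1+n≤2n : ∀ n .{{_ : NonZero n}} → suc n ≤ 2 * n
    1+n≤2n n = subst (suc n ≤_) (cong (n +_) (sym (+-identityʳ n))) (+-monoˡ-≤ n (>-nonZero⁻¹ n))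
    Ty≤ : T * y ≤ Z * (y + T)
    Ty≤ = *-cancelʳ-≤ (T * y) (Z * (y + T)) v {{v≢0}} (begin
      T * y * v
        ≡⟨ *-assoc T y v ⟩
      T * (y * v)
        ≡⟨ cong (T *_) y^R ⟨
      T * y ^ suc (D + D)
        ≤⟨ bound ⟩
      K * (suc (y ^ suc (D + D)) + T * (P₀ * P₀))
        ≡⟨ cong (λ z → K * (suc z + T * (P₀ * P₀))) y^R ⟩
      K * (suc (y * v) + T * (P₀ * P₀))
        ≤⟨ *-monoʳ-≤ K (+-mono-≤ (≤-trans (1+n≤2n (y * v) {{m*n≢0 y v {{it}} {{v≢0}}}}) (*-monoˡ-≤ (y * v) 2≤G²))
             (*-monoʳ-≤ T (≤-trans (*-mono-≤ P₀≤ P₀≤) (≤-reflexive (lemma₂ G (y ^ D)))))) ⟩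
      K * (G * G * (y * v) + T * (G * G * v))
        ≡⟨ lemma₁ K (G * G) y v T ⟩
      Z * (y + T) * v ∎)
      where
      it : NonZero y
      it = ≢-nonZero (≢-nonZero⁻¹ y)

  few-detectors : ∀ {T b F D G σ y P₀ : ℕ} .{{T≢0 : NonZero T}} .{{b≢0 : NonZero b}} .{{y≢0 : NonZero y}} →
    let R = suc (D + D); t = b ^ R; c = b * b * (b ^ D * (b ^ D * b ^ D))
        q = F * P₀ * (F * P₀ * (F * P₀)); L = c ^ R; C = F * q ^ (D + D); B = t * t * (q * q)
        H = ((F * G) ^ R) ^ 3 in
    2 ≤ G * G → P₀ ≤ G * y ^ D → y ≤ σ * b →
    4 * (σ ^ R * ((σ ^ R) ^ D) ^ 6 * (F * F * R ! * (H * H)) * (G * G)) ≤ y →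
    (T * L) * (T * L) ≤ (C * C) * (t * (R ! * (T * (suc (y ^ R) * B) + T * T * (P₀ * P₀ * B)))) →
    3 * T ≤ y
  few-detectors {T} {b} {F} {D} {G} {σ} {y} {P₀} 2≤G² P₀≤ y≤ large bound =
    few-exceptions {T} {y} {D} {G} {K} {P₀} 2≤G² P₀≤
      (substitute-density {T} {b} {F} {F * P₀} {D} {D + D} {suc (y ^ suc (D + D))} {P₀} {y} {σ} {G} ≤-refl P₀≤ y≤
        (cancel-detectors-bound {T} {b} {F} {F * P₀} {D} {D + D} {suc (y ^ suc (D + D))} {P₀} bound))
      large
    where
    R = suc (D + D)
    H = ((F * G) ^ R) ^ 3
    K = σ ^ R * ((σ ^ R) ^ D) ^ 6 * (F * F * R ! * (H * H))

-- Residue classes represented by products over the blocks.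

module Representation where

  open Choices
  open Correlation
  open import Data.Integer.Base as ℤ using (ℤ; +_)
  import Data.Integer.Properties as ℤ
  open import Data.List.Base using (List; []; _∷_; _++_; concat; length; replicate)
  open import Data.List.Membership.Propositional using (_∈_)
  open import Data.List.Membership.Propositional.Properties using (∈-cartesianProductWith⁺)
  open import Data.List.Properties using (length-++; length-replicate; concat-++)
  open import Data.List.Relation.Unary.All as All using (All; []; _∷_)
  import Data.List.Relation.Unary.All.Properties as All
  open import Data.List.Relation.Unary.AllPairs using ([]; _∷_)
  open import Data.List.Relation.Unary.Any as Any using (Any)
  open import Data.List.Relation.Unary.Unique.Propositional using (Unique)
  open import Data.List.Membership.Propositional using (find; lose)
  open import Data.Nat.Base
  open import Data.Nat.DivMod using (m≡m%n+[m/n]*n)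
  open import Data.Nat.Divisibility using (_∣_; ∣⇒≤)
  open import Data.Nat.ListAction using (product)
  open import Data.Nat.Primality
  open import Data.Nat.Primality.Factorisation using (factorisationHasAllPrimeFactors)
  open import Data.Nat.Properties
  open import Data.Product.Base using (_×_; _,_; proj₂; ∃-syntax)
  open import Defs using (SquareFree)
  open Dilations using (prime∤product)
  open FiniteSums using (_²)
  open Growth using (^-swap)
  open import Relation.Binary.PropositionalEquality
    using (_≡_; _≢_; refl; sym; trans; cong; cong₂; subst)
  open import Relation.Nullary using (yes; no; ¬_; contradiction; ¬?; _×-dec_; decidable-stable)

  -- M*_(1/D)(p) ≤ p^(2 + 1/D) with all exponents cleared of denominators.
  Represented : ℕ → ℕ → Set
  Represented D p = ∃[ M ] M ^ D ≤ p ^ suc (D + D) ×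
    (∀ {a} → 0 < a → a < p → ∃[ k ] 1 ≤ k × k ≤ M × (∃[ c ] k ≡ a + c * p) ×
      (∀ {r} → Prime r → r ∣ k → r ^ D ≤ p) × SquareFree k)

  unique-++⁻ˡ : ∀ {A : Set} (xs : List A) {ys} → Unique (xs ++ ys) → Unique xs
  unique-++⁻ˡ []       u        = []
  unique-++⁻ˡ (x ∷ xs) (x∉ ∷ u) = All.++⁻ˡ xs x∉ ∷ unique-++⁻ˡ xs u

  unique-concat⁻ : ∀ {A : Set} (xss : List (List A)) → Unique (concat xss) → All Unique xss
  unique-concat⁻ []         u = []
  unique-concat⁻ (xs ∷ xss) u = unique-++⁻ˡ xs u ∷ unique-concat⁻ xss (unique-++⁻ʳ xs u)

  pos-^ : ∀ m n → + (m ^ n) ≡ (+ m) ℤ.^ n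
  pos-^ m zero    = refl
  pos-^ m (suc n) = trans (ℤ.pos-* m (m ^ n)) (cong (+ m ℤ.*_) (pos-^ m n))

  module _ {D y b : ℕ} {Vs Us : List (List ℕ)} {P : List ℕ}
    (∣Vs∣≡D : length Vs ≡ D) (∣Us∣≡D : length Us ≡ D)
    (∣Bs∣≡b : All (λ B → length B ≡ b) (Vs ++ P ∷ Us))
    (unique : Unique (concat (Vs ++ P ∷ Us)))
    (primes : All Prime (concat (Vs ++ P ∷ Us)))
    (bounded : All (_≤ y) (concat (Vs ++ P ∷ Us))) where

    private
      Bs = Vs ++ P ∷ Us
      V = choices Vs
      U = choices Us
      ∣Bs∣ : length Bs ≡ suc (D + D)
      ∣Bs∣ = trans (length-++ Vs) (trans (cong₂ (λ m n → m + suc n) ∣Vs∣≡D ∣Us∣≡D) (+-suc D D))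

      blocks : All PrimeBlock Bs
      blocks = All.zip (unique-concat⁻ Bs unique , All.concat⁻ {xss = Bs} primes)

    P-block : PrimeBlock P
    P-block = All.head (All.++⁻ʳ Vs blocks)

    P≤y : All (_≤ y) P
    P≤y = All.head (All.++⁻ʳ Vs (All.concat⁻ {xss = Bs} bounded))

    module _ {p : ℕ} (p-prime : Prime p) (y<p : y < p) (y^D<p : y ^ D < p) where

      private
        instance
          p≢0 : NonZero p
          p≢0 = prime⇒nonZero p-prime

        Hit : ℕ → Set
        Hit a = Any (λ k → k % p ≡ a) (choices Bs)

        -- M = y^(2D + 1) serves, since y^D < p gives M^D = (y^D)^(2D + 1) ≤ p^(2D + 1); the prime
        -- factors are at most y, so their D-th powers stay below p.
        hits⇒represented : (∀ {a} → 0 < a → a < p → Hit a) → Represented D p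
        hits⇒represented hits = y ^ suc (D + D) , M^D≤ , represent
          where
          y^D≤p : y ^ D ≤ p
          y^D≤p = <⇒≤ y^D<p
          M^D≤ : (y ^ suc (D + D)) ^ D ≤ p ^ suc (D + D)
          M^D≤ = subst (_≤ p ^ suc (D + D)) (^-swap y D (suc (D + D))) (^-monoˡ-≤ (suc (D + D)) y^D≤p)
          represent : ∀ {a} → 0 < a → a < p → ∃[ k ] 1 ≤ k × k ≤ y ^ suc (D + D) ×
            (∃[ c ] k ≡ a + c * p) × (∀ {r} → Prime r → r ∣ k → r ^ D ≤ p) × SquareFree k
          represent 0<a a<p
            with k , k∈ , refl ← find (hits 0<a a<p)
            with ls , refl , ls! , ls⊆ ← choices-factors Bs unique k∈ =
            k , productOfPrimes≥1 ls-primes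
              , subst (λ m → k ≤ y ^ m) ∣Bs∣ (choices-≤ Bs (All.concat⁻ {xss = Bs} bounded) k∈)
              , (k / p , m≡m%n+[m/n]*n k p)
              , (λ r-prime r∣k → ≤-trans (^-monoˡ-≤ D (All.lookup bounded
                  (ls⊆ (factorisationHasAllPrimeFactors r-prime r∣k ls-primes)))) y^D≤p)
              , product-squareFree ls-primes ls!
            where
            ls-primes : All Prime ls
            ls-primes = All.tabulate (λ l∈ → All.lookup primes (ls⊆ l∈))

        p∤-prime : ∀ {l} → Prime l → l ≤ y → ¬ p ∣ l
        p∤-prime l-prime l≤y p∣l = <⇒≱ (≤-<-trans l≤y y<p) (∣⇒≤ {{prime⇒nonZero l-prime}} p∣l)

        p∤-choices : ∀ Cs → Unique (concat Cs) → All Prime (concat Cs) → All (_≤ y) (concat Cs) →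
                     All (λ n → ¬ p ∣ n) (choices Cs)
        p∤-choices Cs u q ≤y = All.tabulate λ n∈ → case-factors (choices-factors Cs u n∈)
          where
          case-factors : ∀ {n} → ∃[ ls ] n ≡ product ls × Unique ls × (∀ {l} → l ∈ ls → l ∈ concat Cs) → ¬ p ∣ n
          case-factors (ls , refl , _ , ls⊆) = prime∤product p-prime
            (All.tabulate (λ l∈ → p∤-prime (All.lookup q (ls⊆ l∈)) (All.lookup ≤y (ls⊆ l∈))))

        concat-split : ∀ {Q : List ℕ → Set} → Q (concat Bs) → Q (concat Vs ++ P ++ concat Us)
        concat-split {Q} = subst Q (sym (concat-++ Vs (P ∷ Us)))

      module _ {P₀ : ℕ} (p≤P₀ : p ≤ P₀) (r : ℕ) where

        private
          F = D !
          X = F * P₀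
          q = X * (X * X)
          c = b * b * (b ^ D * (b ^ D * b ^ D))
          t = b ^ suc r

        -- The choices from Us and Vs are at most y^D < p with multiplicity at most D!, as
        -- `detector` requires. The rest carries its constants from the integers to ℕ.
        missed⇒detector : ∀ {a} → 0 < a → a < p → ¬ Hit a →
          Detector P (+ (t * t * (q * q))) (+ (c ^ suc r)) (+ (F * q ^ r)) (suc r) p
        missed⇒detector {a} 0<a a<p ¬hit = subst₃ (λ B L C → Detector P B L C (suc r) p) B≡ L≡ C≡
          (detector p-prime {P} {U} {V} (1≤n! D) p≤P₀ p∤P p∤U p∤V
            (subst (λ k → ∀ n → _ ℤ.≤ + (k !)) ∣Us∣≡D (choices-multiplicity Us (All.tail (All.++⁻ʳ Vs blocks))))
            (λ u∈ → ≤-<-trans (subst (λ k → _ ≤ y ^ k) ∣Us∣≡D (choices-≤ Us (All.concat⁻ {xss = Us} Us≤y) u∈)) y^D<p)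
            (subst (λ k → ∀ n → _ ℤ.≤ + (k !)) ∣Vs∣≡D (choices-multiplicity Vs (All.++⁻ˡ Vs blocks)))
            (λ v∈ → ≤-<-trans (subst (λ k → _ ≤ y ^ k) ∣Vs∣≡D (choices-≤ Vs (All.concat⁻ {xss = Vs} Vs≤y) v∈)) y^D<p)
            0<a a<p missed r)
          where
          subst₃ : ∀ (Q : ℤ → ℤ → ℤ → Set) {a b c d e f} → a ≡ b → c ≡ d → e ≡ f → Q a c e → Q b d f
          subst₃ Q refl refl refl q = q
          Vs! = unique-++⁻ˡ (concat Vs) (concat-split {Unique} unique)
          Us! = unique-++⁻ʳ P (unique-++⁻ʳ (concat Vs) (concat-split {Unique} unique))
          Vs-primes = All.++⁻ˡ (concat Vs) (concat-split {All Prime} primes)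
          Us-primes = All.++⁻ʳ P (All.++⁻ʳ (concat Vs) (concat-split {All Prime} primes))
          Vs≤y = All.++⁻ˡ (concat Vs) (concat-split {All (_≤ y)} bounded)
          Us≤y = All.++⁻ʳ P (All.++⁻ʳ (concat Vs) (concat-split {All (_≤ y)} bounded))
          p∤P = All.tabulate (λ l∈ → p∤-prime (All.lookup (proj₂ P-block) l∈) (All.lookup P≤y l∈))
          p∤U = p∤-choices Us Us! Us-primes Us≤y
          p∤V = p∤-choices Vs Vs! Vs-primes Vs≤y
          missed : ∀ {u v l} → u ∈ U → v ∈ V → l ∈ P → (v * (l * u)) % p ≢ a
          missed u∈ v∈ l∈ hit = ¬hit (lose
            (choices-++ Vs v∈ (∈-cartesianProductWith⁺ _*_ l∈ u∈)) hit)
          ∣V∣ : length V ≡ b ^ D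
          ∣V∣ = trans (length-choices Vs (All.++⁻ˡ Vs ∣Bs∣≡b)) (cong (b ^_) ∣Vs∣≡D)
          ∣U∣ : length U ≡ b ^ D
          ∣U∣ = trans (length-choices Us (All.tail (All.++⁻ʳ Vs ∣Bs∣≡b))) (cong (b ^_) ∣Us∣≡D)
          ∣P∣ : length P ≡ b
          ∣P∣ = All.head (All.++⁻ʳ Vs ∣Bs∣≡b)
          ∣ts∣ : length (choices (replicate (suc r) P)) ≡ t
          ∣ts∣ = trans (length-choices (replicate (suc r) P) (All.replicate⁺ (suc r) ∣P∣))
            (cong (b ^_) (length-replicate (suc r)))
          pos-² : ∀ n → + (n * n) ≡ (+ n) ²
          pos-² n = ℤ.pos-* n n
          q≡ : (+ F ℤ.* + P₀) ℤ.* (+ F ℤ.* + P₀) ² ≡ + q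
          q≡ = sym (trans (ℤ.pos-* X (X * X)) (cong₂ ℤ._*_ (ℤ.pos-* F P₀)
            (trans (pos-² X) (cong _² (ℤ.pos-* F P₀)))))
          B≡ : (+ length (choices (replicate (suc r) P))) ² ℤ.* ((+ F ℤ.* + P₀) ℤ.* (+ F ℤ.* + P₀) ²) ² ≡
               + (t * t * (q * q))
          B≡ = trans (cong₂ (λ i j → (+ i) ² ℤ.* j ²) ∣ts∣ q≡)
            (sym (trans (ℤ.pos-* (t * t) (q * q)) (cong₂ ℤ._*_ (pos-² t) (pos-² q))))
          c≡ : (+ length P) ² ℤ.* (+ length U ℤ.* (+ length V) ²) ≡ + c
          c≡ rewrite ∣P∣ | ∣U∣ | ∣V∣ = sym (trans (ℤ.pos-* (b * b) (b ^ D * (b ^ D * b ^ D)))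
            (cong₂ ℤ._*_ (pos-² b) (trans (ℤ.pos-* (b ^ D) (b ^ D * b ^ D)) (cong (+ (b ^ D) ℤ.*_) (pos-² (b ^ D))))))
          L≡ : ((+ length P) ² ℤ.* (+ length U ℤ.* (+ length V) ²)) ℤ.^ suc r ≡ + (c ^ suc r)
          L≡ = trans (cong (ℤ._^ suc r) c≡) (sym (pos-^ c (suc r)))
          C≡ : + F ℤ.* ((+ F ℤ.* + P₀) ℤ.* (+ F ℤ.* + P₀) ²) ℤ.^ r ≡ + (F * q ^ r)
          C≡ = trans (cong (λ i → + F ℤ.* i ℤ.^ r) q≡)
            (sym (trans (ℤ.pos-* F (q ^ r)) (cong (+ F ℤ.*_) (pos-^ q r))))

        -- Being hit is decidable, so a search over a < p finds a missed class or establishes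
        -- `Represented`.
        unrepresented⇒detector : ¬ Represented D p →
          Detector P (+ (t * t * (q * q))) (+ (c ^ suc r)) (+ (F * q ^ r)) (suc r) p
        unrepresented⇒detector ¬rep with anyUpTo? (λ a → (0 <? a) ×-dec ¬? (Any.any? (λ k → k % p ≟ a) (choices Bs))) p
        ... | yes (a , a<p , 0<a , ¬hit) = missed⇒detector 0<a a<p ¬hit
        ... | no none = contradiction (hits⇒represented λ {a} 0<a a<p →
          decidable-stable (Any.any? (λ k → k % p ≟ a) (choices Bs)) (λ ¬hit → none (a , a<p , 0<a , ¬hit))) ¬rep

-- Choice of scale and blocks, and the bound for unrepresented primes.

module Exceptions where

  open Choices
  open Correlation
  open Counting
  open import Data.List.Base using (List; []; _∷_; _++_; concat; drop; length; replicate; take; upTo)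
  open import Data.List.Properties using (length-take; length-drop; length-replicate; ++-assoc; take++drop≡id)
  open import Data.List.Relation.Unary.All as All using (All; []; _∷_)
  import Data.List.Relation.Unary.All.Properties as All
  open import Data.List.Relation.Unary.Unique.Propositional using (Unique)
  import Data.List.Relation.Unary.Unique.Propositional.Properties as Unique
  open import Data.Nat.Base
  open import Data.Nat.DivMod using (m≡m%n+[m/n]*n; m%n<n; m/n*n≤m; m≥n⇒m/n>0)
  open import Data.Nat.Primality using (Prime; prime?)
  open import Data.Nat.Properties
  open import Data.Nat.Tactic.RingSolver using (solve-∀)
  open import Data.Product.Base using (_×_; _,_; ∃-syntax)
  open Growth
  open PrimeCount
  open import Relation.Binary.PropositionalEquality
    using (_≡_; refl; sym; trans; cong; cong₂; subst; module ≡-Reasoning)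
  open import Relation.Nullary using (¬_)
  open Representation

  split-blocks : ∀ {A : Set} m b (xs : List A) → m * b ≤ length xs →
                 ∃[ Bs ] ∃[ rest ] concat Bs ++ rest ≡ xs × length Bs ≡ m × All (λ B → length B ≡ b) Bs
  split-blocks zero    b xs _ = [] , xs , refl , refl , []
  split-blocks (suc m) b xs m*b≤
    with Bs , rest , eq , ∣Bs∣≡m , ∣Bs∣≡b ← split-blocks m b (drop b xs)
      (subst (m * b ≤_) (sym (length-drop b xs)) (subst (_≤ length xs ∸ b) (m+n∸m≡n b (m * b)) (∸-monoˡ-≤ b m*b≤))) =
    take b xs ∷ Bs , rest
      , trans (++-assoc (take b xs) (concat Bs) rest) (trans (cong (take b xs ++_) eq) (take++drop≡id b xs))
      , cong suc ∣Bs∣≡m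
      , trans (length-take b xs) (m≤n⇒m⊓n≡m (≤-trans (m≤m+n b (m * b)) m*b≤)) ∷ ∣Bs∣≡b

  split-middle : ∀ {A : Set} m {n} (xs : List A) → length xs ≡ suc (m + n) →
                 ∃[ as ] ∃[ x ] ∃[ bs ] xs ≡ as ++ x ∷ bs × length as ≡ m × length bs ≡ n
  split-middle zero    (x ∷ bs) len = [] , x , bs , refl , refl , suc-injective len
  split-middle (suc m) (a ∷ xs) len with as , x , bs , refl , ∣as∣ , ∣bs∣ ← split-middle m xs (suc-injective len) =
    a ∷ as , x , bs , refl , cong suc ∣as∣ , ∣bs∣

  -- b is the integer part of π / m. The hypothesis forces m ≤ π, so b ≥ 1 and π ≤ 2 b m;
  -- Chebyshev's bound 2^s ≤ 2 s π then gives the constant 4.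
  prime-blocks : ∀ m .{{_ : NonZero m}} s .{{_ : NonZero s}} → 2 * (s * m) ≤ 2 ^ s →
    ∃[ b ] 1 ≤ b × m * b ≤ length (primesUpTo (2 ^ s)) × 2 ^ s ≤ 4 * m * s * b
  prime-blocks m (suc s) small = b , m≥n⇒m/n>0 m≤π , subst (_≤ π) (*-comm b m) (m/n*n≤m π m) , (begin
    2 ^ suc s                    ≤⟨ chebyshev s ⟩
    2 * (suc s * π)              ≤⟨ *-monoʳ-≤ 2 (*-monoʳ-≤ (suc s) π≤) ⟩
    2 * (suc s * (b * m + b * m)) ≡⟨ lemma (suc s) b m ⟩
    4 * m * suc s * b            ∎)
    where
    open ≤-Reasoning
    π = length (primesUpTo (2 ^ suc s))
    b = π / m
    m≤π : m ≤ π
    m≤π = *-cancelˡ-≤ (suc s) (*-cancelˡ-≤ 2 (≤-trans small (chebyshev s)))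
    lemma : ∀ s b m → 2 * (s * (b * m + b * m)) ≡ 4 * m * s * b
    lemma = solve-∀
    π≤ : π ≤ b * m + b * m
    π≤ = begin
      π                  ≡⟨ m≡m%n+[m/n]*n π m ⟩
      π % m + b * m      ≤⟨ +-monoˡ-≤ (b * m) (≤-trans (<⇒≤ (m%n<n π m)) (m≤n*m m b {{>-nonZero (m≥n⇒m/n>0 m≤π)}})) ⟩
      b * m + b * m      ∎

  -- For fixed parameters the left side is a monomial in s, of degree R + 6 R D.
  polylog≤2^s : ∀ a R D E g → ∃[ s₀ ] (∀ s → s₀ ≤ s →
    4 * ((a * s) ^ R * (((a * s) ^ R) ^ D) ^ 6 * E * g) ≤ 2 ^ s)
  polylog≤2^s a R D E g with s₀ , bound ← C*s^k≤2^s (4 * (a ^ R * ((a ^ R) ^ D) ^ 6 * E * g)) (R + R * D * 6) =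
    s₀ , λ s s₀≤s → subst (_≤ 2 ^ s) (eq s) (bound s s₀≤s)
    where
    open ≡-Reasoning
    powers : ∀ s → a ^ R * ((a ^ R) ^ D) ^ 6 * s ^ (R + R * D * 6) ≡ (a * s) ^ R * (((a * s) ^ R) ^ D) ^ 6
    powers s = begin
      a ^ R * A ^ 6 * s ^ (R + R * D * 6)
        ≡⟨ cong (a ^ R * A ^ 6 *_) (trans (^-distribˡ-+-* s R (R * D * 6))
             (cong (s ^ R *_) (trans (sym (^-*-assoc s (R * D) 6)) (cong (_^ 6) (sym (^-*-assoc s R D)))))) ⟩
      a ^ R * A ^ 6 * (s ^ R * S ^ 6)
        ≡⟨ lemma (a ^ R) (A ^ 6) (s ^ R) (S ^ 6) ⟩
      a ^ R * s ^ R * (A ^ 6 * S ^ 6)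
        ≡⟨ cong₂ _*_ (sym (^-distribʳ-* a s R)) (sym (^-distribʳ-* A S 6)) ⟩
      (a * s) ^ R * (A * S) ^ 6
        ≡⟨ cong (λ i → (a * s) ^ R * i ^ 6) (trans (sym (^-distribʳ-* (a ^ R) (s ^ R) D))
             (cong (_^ D) (sym (^-distribʳ-* a s R)))) ⟩
      (a * s) ^ R * (((a * s) ^ R) ^ D) ^ 6 ∎
      where
      A = (a ^ R) ^ D
      S = (s ^ R) ^ D
      lemma : ∀ a b c d → a * b * (c * d) ≡ a * c * (b * d)
      lemma = solve-∀
    eq : ∀ s → 4 * (a ^ R * ((a ^ R) ^ D) ^ 6 * E * g) * s ^ (R + R * D * 6) ≡
               4 * ((a * s) ^ R * (((a * s) ^ R) ^ D) ^ 6 * E * g)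
    eq s = trans (lemma (a ^ R * ((a ^ R) ^ D) ^ 6) E g (s ^ (R + R * D * 6)))
      (cong (λ i → 4 * (i * E * g)) (powers s))
      where
      lemma : ∀ x E g y → 4 * (x * E * g) * y ≡ 4 * (x * y * E * g)
      lemma = solve-∀

  module _ (D : ℕ) (1≤D : 1 ≤ D) where

    private
      R = suc (D + D)
      F = D !
      -- From p ≤ 2n ≤ 2 (2y)^D = G y^D.
      G = 2 * 2 ^ D
      E = F * F * R ! * (((F * G) ^ R) ^ 3 * ((F * G) ^ R) ^ 3)

      K : ℕ → ℕ
      K σ = σ ^ R * ((σ ^ R) ^ D) ^ 6 * E

      -- σ = 4 R s is the factor between y = 2^s and b that `prime-blocks` provides for R blocks.
      4KG²≤ : ∃[ s₀ ] (∀ s → s₀ ≤ s → 4 * (K (4 * R * s) * (G * G)) ≤ 2 ^ s)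
      4KG²≤ = polylog≤2^s (4 * R) R D E (G * G)

      2≤G² : 2 ≤ G * G
      2≤G² = begin
        2 * 1         ≤⟨ *-monoʳ-≤ 2 (m^n>0 2 D) ⟩
        G             ≤⟨ m≤n*m G G {{m*n≢0 2 (2 ^ D) {{_}} {{m^n≢0 2 D}}}} ⟩
        G * G         ∎
        where open ≤-Reasoning

      Exception : ℕ → ℕ → Set
      Exception n p = Prime p × n ≤ p × p ≤ 2 * n × ¬ Represented D p

      module _ (σ y n : ℕ) .{{y≢0 : NonZero y}} (y^D<n : y ^ D < n) (n≤ : n ≤ 2 ^ D * y ^ D)
               {b : ℕ} (1≤b : 1 ≤ b) (R*b≤ : R * b ≤ length (primesUpTo y)) (y≤ : y ≤ σ * b)
               (large : 4 * (K σ * (G * G)) ≤ y) where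

        private
          -- Every exceptional p lies in [n, 2n], so P₀ is a common bound for the moduli.
          P₀ = 2 * n

          y≤y^D : y ≤ y ^ D
          y≤y^D = subst (_≤ y ^ D) (*-identityʳ y) (^-monoʳ-≤ y 1≤D)

          P₀≤ : P₀ ≤ G * y ^ D
          P₀≤ = ≤-trans (*-monoʳ-≤ 2 n≤) (≤-reflexive (sym (*-assoc 2 (2 ^ D) (y ^ D))))

        3T≤y : ∀ ps .{{_ : NonZero (length ps)}} → Unique ps → All (Exception n) ps → 3 * length ps ≤ y
        3T≤y ps ps! exceptions
          with Bs , rest , concat≡ , ∣Bs∣ , ∣Bs∣≡b ← split-blocks R b (primesUpTo y) R*b≤
          with Vs , P , Us , refl , ∣Vs∣ , ∣Us∣ ← split-middle D Bs ∣Bs∣ =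
          few-detectors {T} {b} {F} {D} {G} {σ} {y} {P₀} {{b≢0 = >-nonZero 1≤b}} 2≤G² P₀≤ y≤ large bound
          where
          T = length ps
          q = F * P₀ * (F * P₀ * (F * P₀))
          c = b * b * (b ^ D * (b ^ D * b ^ D))
          t = b ^ R
          B = t * t * (q * q)
          L = c ^ R
          C = F * q ^ (D + D)
          primes! : Unique (concat (Vs ++ P ∷ Us))
          primes! = unique-++⁻ˡ _ (subst Unique (sym concat≡) (Unique.filter⁺ prime? (Unique.upTo⁺ (suc y))))
          primes : All Prime (concat (Vs ++ P ∷ Us))
          primes = All.++⁻ˡ _ (subst (All Prime) (sym concat≡) (All.all-filter prime? (upTo (suc y))))
          primes≤y : All (_≤ y) (concat (Vs ++ P ∷ Us))
          primes≤y = All.++⁻ˡ _ (subst (All (_≤ y)) (sym concat≡)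
            (All.filter⁺ prime? (All.map s≤s⁻¹ (All.all-upTo (suc y)))))
          P-block′ = P-block ∣Vs∣ ∣Us∣ ∣Bs∣≡b primes! primes primes≤y
          detectors : All (λ p → Prime p × p ≤ P₀ × Detector P _ _ _ R p) ps
          detectors = All.map (λ { (p-prime , n≤p , p≤2n , ¬rep) → p-prime , p≤2n ,
            unrepresented⇒detector ∣Vs∣ ∣Us∣ ∣Bs∣≡b primes! primes primes≤y p-prime
              (≤-<-trans y≤y^D (<-≤-trans y^D<n n≤p)) (<-≤-trans y^D<n n≤p) p≤2n (D + D) ¬rep }) exceptions
          ∣ts∣ : length (choices (replicate R P)) ≡ t
          ∣ts∣ = trans (length-choices (replicate R P)
              (All.replicate⁺ R (All.head (All.++⁻ʳ Vs ∣Bs∣≡b))))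
            (cong (b ^_) (length-replicate R))
          bound : (T * L) * (T * L) ≤
                  (C * C) * (t * (R ! * (T * (suc (y ^ R) * B) + T * T * (P₀ * P₀ * B))))
          bound = subst (λ k → (T * L) * (T * L) ≤
                  (C * C) * (k * (R ! * (T * (suc (y ^ R) * B) + T * T * (P₀ * P₀ * B))))) ∣ts∣
            (detectors-bound {P} {B} {L} {C} {R} {P₀} {y} P-block′
              (P≤y ∣Vs∣ ∣Us∣ ∣Bs∣≡b primes! primes primes≤y) ps! detectors)

        -- From 2T ≤ y and 2 ≤ 2^D. The factor 2 will be spent on n ≤ 2Q, so as to compare T^D with
        -- Q itself.
        2T^D≤n : ∀ {ps} → Unique ps → All (Exception n) ps → 2 * length ps ^ D ≤ n
        2T^D≤n {[]} _ _ = subst (_≤ n) (sym (trans (cong (2 *_) 0^D) (*-zeroʳ 2))) z≤n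
          where
          0^D : 0 ^ D ≡ 0
          0^D = cong (0 ^_) {D} {suc (pred D)} (sym (suc-pred D {{>-nonZero 1≤D}}))
        2T^D≤n {ps@(_ ∷ _)} ps! exceptions = begin
          2 * T ^ D          ≤⟨ *-monoˡ-≤ (T ^ D) (subst (_≤ 2 ^ D) (*-identityʳ 2) (^-monoʳ-≤ 2 1≤D)) ⟩
          2 ^ D * T ^ D      ≡⟨ ^-distribʳ-* 2 T D ⟨
          (2 * T) ^ D        ≤⟨ ^-monoˡ-≤ D (≤-trans (*-monoˡ-≤ T (s≤s (s≤s (z≤n {1})))) (3T≤y ps ps! exceptions)) ⟩
          y ^ D              ≤⟨ <⇒≤ y^D<n ⟩
          n                  ∎
          where
          open ≤-Reasoning
          T = length ps

      at-scale : ∀ e n .{{_ : NonZero e}} → (2 ^ D) ^ e < n → n ≤ 2 ^ D * (2 ^ D) ^ e →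
                 2 * R * e ^ 1 ≤ 2 ^ e → 4 * (K (4 * R * e) * (G * G)) ≤ 2 ^ e →
                 ∀ {ps} → Unique ps → All (Exception n) ps → 2 * length ps ^ D ≤ n
      at-scale e n <n n≤ small large
        with b , 1≤b , R*b≤ , y≤ ← prime-blocks R e (subst (_≤ 2 ^ e)
            (trans (cong (2 * R *_) (^-identityʳ e)) (trans (*-assoc 2 R e) (cong (2 *_) (*-comm R e)))) small) =
        2T^D≤n (4 * R * e) (2 ^ e) n {{m^n≢0 2 e}}
          (subst (_< n) (^-swap 2 D e) <n) (subst (λ z → n ≤ 2 ^ D * z) (^-swap 2 D e) n≤)
          1≤b R*b≤ y≤ large

    exceptions-bound : ∃[ n₀ ] (∀ n → n₀ ≤ n → ∀ ps → Unique ps →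
      All (λ p → Prime p × n ≤ p × p ≤ 2 * n × ¬ Represented D p) ps → 2 * length ps ^ D ≤ n)
    exceptions-bound = n₀ 4KG²≤ (C*s^k≤2^s (2 * R) 1) , λ n n₀≤n ps →
      bound 4KG²≤ (C*s^k≤2^s (2 * R) 1) n n₀≤n
      where
      Large Small : ℕ → Set
      Large s₁ = ∀ s → s₁ ≤ s → 4 * (K (4 * R * s) * (G * G)) ≤ 2 ^ s
      Small s₂ = ∀ s → s₂ ≤ s → 2 * R * s ^ 1 ≤ 2 ^ s
      n₀ : ∃[ s₁ ] Large s₁ → ∃[ s₂ ] Small s₂ → ℕ
      -- The logarithm is taken of n - 1, which makes the inequality y^D < n strict.
      n₀ (s₁ , _) (s₂ , _) = 2 + (2 ^ D) ^ suc (s₁ + s₂)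
      1<2^D : 1 < 2 ^ D
      1<2^D = subst (_≤ 2 ^ D) (*-identityʳ 2) (^-monoʳ-≤ 2 1≤D)
      bound : ∀ large small n → n₀ large small ≤ n → ∀ {ps} → Unique ps → All (Exception n) ps →
              2 * length ps ^ D ≤ n
      bound (s₁ , large) (s₂ , small) (suc (suc n)) (s≤s (s≤s n₀≤))
        with e , ≤n , n< ← ∃-log 1<2^D n = at-scale e (suc (suc n)) {{>-nonZero (≤-trans (s≤s z≤n) s₀≤e)}}
          (s≤s ≤n) n< (small e (≤-trans (≤-trans (m≤n+m s₂ s₁) (n≤1+n _)) s₀≤e))
          (large e (≤-trans (≤-trans (m≤m+n s₁ s₂) (n≤1+n _)) s₀≤e))
        where
        s₀≤e : suc (s₁ + s₂) ≤ e
        s₀≤e = ≮⇒≥ λ e<s₀ → <⇒≱ n< (≤-trans (^-monoʳ-≤ (2 ^ D) {{m^n≢0 2 D}} e<s₀) (m≤n⇒m≤1+n n₀≤))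

-- Real exponents and inequalities reduced to natural numbers.

module RealBounds where

  open import Algebra.Definitions.RawSemiring as RawSemiringDefs using ()
  open import Data.Integer.Base as ℤ using (ℤ; +_; +[1+_])
  import Data.Integer.Properties as ℤ
  open import Data.Nat.Base as ℕ using (ℕ; zero; suc)
  import Data.Nat.Properties as ℕ
  open import Data.Nat.Tactic.RingSolver using (solve-∀)
  open import Data.Product.Base using (_,_; ∃-syntax)
  open import Data.Rational.Base
  open import Data.Rational.Properties
  import Data.Rational.Unnormalised.Base as ℚᵘ
  import Data.Rational.Unnormalised.Properties as ℚᵘ
  open import Defs
  open import Function.Bundles using (module Equivalence)
  open import Relation.Binary.PropositionalEquality
    using (_≡_; refl; sym; trans; cong; cong₂; subst; subst₂)
  open import Relation.Nullary using (yes; no; contradiction)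

  open RawSemiringDefs +-*-rawSemiring using (_^_)
  open ℝ

  toℚᵘ-/ : ∀ a b → ℚᵘ._≃_ (toℚᵘ (+ a / suc b)) (ℚᵘ.mkℚᵘ (+ a) b)
  toℚᵘ-/ a b = toℚᵘ-fromℚᵘ (ℚᵘ.mkℚᵘ (+ a) b)

  /1-mono-≤ : ∀ {m n} → m ℕ.≤ n → + m / 1 ≤ + n / 1
  /1-mono-≤ {m} {n} m≤n = toℚᵘ-cancel-≤ (ℚᵘ.≤-respˡ-≃ (ℚᵘ.≃-sym (toℚᵘ-/ m 0)) (ℚᵘ.≤-respʳ-≃ (ℚᵘ.≃-sym (toℚᵘ-/ n 0))
    (ℚᵘ.*≤* (ℤ.*-monoʳ-≤-nonNeg (+ 1) (ℤ.+≤+ m≤n)))))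

  /1-mono-< : ∀ {m n} → m ℕ.< n → + m / 1 < + n / 1
  /1-mono-< {m} {n} m<n = toℚᵘ-cancel-< (ℚᵘ.<-respˡ-≃ (ℚᵘ.≃-sym (toℚᵘ-/ m 0)) (ℚᵘ.<-respʳ-≃ (ℚᵘ.≃-sym (toℚᵘ-/ n 0))
    (ℚᵘ.*<* (ℤ.*-monoʳ-<-pos (+ 1) (ℤ.+<+ m<n)))))

  /1-* : ∀ m n → + (m ℕ.* n) / 1 ≡ + m / 1 * (+ n / 1)
  /1-* m n = toℚᵘ-injective (ℚᵘ.≃-trans (toℚᵘ-/ (m ℕ.* n) 0) (ℚᵘ.≃-trans
    (ℚᵘ.*≡* (cong (ℤ._* + 1) (ℤ.pos-* m n)))
    (ℚᵘ.≃-trans (ℚᵘ.≃-sym (ℚᵘ.*-cong (toℚᵘ-/ m 0) (toℚᵘ-/ n 0)))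
      (ℚᵘ.≃-sym (toℚᵘ-homo-* (+ m / 1) (+ n / 1))))))

  /1-^ : ∀ m n → + (m ℕ.^ n) / 1 ≡ (+ m / 1) ^ n
  /1-^ m zero    = refl
  /1-^ m (suc n) = trans (/1-* m (m ℕ.^ n)) (cong (λ i → + m / 1 * i) (/1-^ m n))

  /1-nonNeg : ∀ m → NonNegative (+ m / 1)
  /1-nonNeg m = nonNegative (/1-mono-≤ (ℕ.z≤n {m}))

  ^-mono-≤ : ∀ {x y} n .{{_ : NonNegative x}} → x ≤ y → x ^ n ≤ y ^ n
  ^-mono-≤         zero    x≤y = ≤-refl
  ^-mono-≤ {x} {y} (suc n) x≤y = ≤-trans (*-monoˡ-≤-nonNeg x (^-mono-≤ n x≤y))
    (*-monoʳ-≤-nonNeg (y ^ n) {{nonNegative (≤-trans 0≤x^n (^-mono-≤ n x≤y))}} x≤y)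
    where
    0≤^ : ∀ n → 0ℚ ≤ x ^ n
    0≤^ zero    = /1-mono-≤ (ℕ.z≤n {1})
    0≤^ (suc n) = subst (_≤ x * x ^ n) (*-zeroʳ x) (*-monoˡ-≤-nonNeg x (0≤^ n))
    0≤x^n = 0≤^ n

  -- The base s of the infimum defining a real power enters only through a natural number m below
  -- it, so the estimate itself takes place in ℕ.
  power-≤ : ∀ {n m s} a b → n ℕ.^ b ℕ.≤ m ℕ.^ a → + m / 1 ≤ s → (+ n / 1) ^ b ≤ s ^ a
  power-≤ {n} {m} {s} a b n^b≤m^a m≤s = begin
    (+ n / 1) ^ b        ≡⟨ /1-^ n b ⟨
    + (n ℕ.^ b) / 1      ≤⟨ /1-mono-≤ n^b≤m^a ⟩
    + (m ℕ.^ a) / 1      ≡⟨ /1-^ m a ⟩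
    (+ m / 1) ^ a        ≤⟨ ^-mono-≤ a {{/1-nonNeg m}} m≤s ⟩
    s ^ a                ∎
    where open ≤-Reasoning

  Lower<Upper : ∀ (x : ℝ) {q r} → Lower x q → Upper x r → q < r
  Lower<Upper x {q} {r} l u with q <? r
  ... | yes q<r = q<r
  ... | no  q≮r = contradiction (down (≮⇒≥ q≮r) , u) (disjoint x r)
    where
    down : r ≤ q → Lower x r
    down r≤q with Equivalence.to (rounded-low x q) l
    ... | t , q<t , lt = Equivalence.from (rounded-low x r) (t , ≤-<-trans r≤q q<t , lt)

  fromℕ-≤ᵣ : ∀ {x m n} → fromℕ m ≤ᵣ x → x ≤ᵣ fromℕ n → m ℕ.≤ n
  fromℕ-≤ᵣ {x} {m} {n} m≤x x≤n = ℕ.≮⇒≥ λ n<m → <-irrefl refl (x≤n (+ n / 1) (m≤x (+ n / 1) (/1-mono-< n<m)))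

  *ᵣ-cancel : ∀ q → (q * 2ℚ) * 1/ 2ℚ ≡ q
  *ᵣ-cancel q = trans (*-assoc q 2ℚ (1/ 2ℚ)) (trans (cong (q *_) (*-inverseʳ 2ℚ)) (*-identityʳ q))

  n≤2ᵣx⇒n≤2s : ∀ {x n s} → fromℕ n ≤ᵣ 2ℚ *ᵣ x → Upper x s → + n / 1 ≤ s * 2ℚ
  n≤2ᵣx⇒n≤2s {x} {n} {s} n≤2x x<s = ≮⇒≥ λ 2s<n →
    disjoint x s (subst (Lower x) (*ᵣ-cancel s) (n≤2x (s * 2ℚ) 2s<n) , x<s)

  n≤2x≤2m⇒n≤2m : ∀ {x m n} → fromℕ n ≤ᵣ 2ℚ *ᵣ x → x ≤ᵣ fromℕ m → n ℕ.≤ 2 ℕ.* m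
  n≤2x≤2m⇒n≤2m {x} {m} {n} n≤2x x≤m = ℕ.≮⇒≥ λ 2m<n → <-irrefl refl (x≤m (+ m / 1)
    (subst (Lower x) (*ᵣ-cancel (+ m / 1)) (n≤2x (+ m / 1 * 2ℚ)
      (subst (_< + n / 1) (trans (/1-* 2 m) (*-comm 2ℚ (+ m / 1))) (/1-mono-< 2m<n)))))

  -- 1/d < x, and the same bound shifted by 2, read off from the rationals above x and cleared of
  -- denominators.
  record ExceedsReciprocal (d : ℕ) (x : ℝ) : Set where
    field
      1≤d  : 1 ℕ.≤ d
      <a/b : ∀ a b .{{_ : ℕ.NonZero b}} → Upper x (+ a / b) → b ℕ.≤ a ℕ.* d
      2+   : ∀ a b .{{_ : ℕ.NonZero b}} → Upper x (+ a / b - 2ℚ) → suc (d ℕ.+ d) ℕ.* b ℕ.≤ a ℕ.* d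

  -- The denominator of a rational q with `0 < q < x` serves as d, since the numerator of q is at
  -- least 1.
  0<x⇒1/d<x : ∀ {x} → 0ᵣ <ᵣ x → ∃[ d ] ExceedsReciprocal d x
  0<x⇒1/d<x {x} (q@(mkℚ +[1+ n ] d-1 _) , _ , q<x) = suc d-1 , record
    { 1≤d  = ℕ.s≤s ℕ.z≤n
    ; <a/b = λ { a (suc b) x<a/b → <a/b a b (Lower<Upper x q<x x<a/b) }
    ; 2+   = λ { a (suc b) x<a/b-2 → 2+ a b (Lower<Upper x q<x x<a/b-2) }
    }
    where
    d = suc d-1
    <a/b : ∀ a b → q < + a / suc b → suc b ℕ.≤ a ℕ.* d
    <a/b a b q<a/b with ℚᵘ.<-respʳ-≃ (toℚᵘ-/ a b) (toℚᵘ-mono-< q<a/b)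
    ... | ℚᵘ.*<* lt = ℕ.≤-trans (ℕ.m≤n*m (suc b) (suc n)) (ℕ.<⇒≤ (ℤ.drop‿+<+
      (subst₂ ℤ._<_ (sym (ℤ.pos-* (suc n) (suc b))) (sym (ℤ.pos-* a d)) lt)))
    2+ : ∀ a b → q < + a / suc b - 2ℚ → suc (d ℕ.+ d) ℕ.* suc b ℕ.≤ a ℕ.* d
    2+ a b q<a/b-2 with ℚᵘ.<-respʳ-≃ (toℚᵘ-/ a b) (ℚᵘ.<-respˡ-≃ (toℚᵘ-homo-+ q 2ℚ) (toℚᵘ-mono-< q+2<a/b))
      where
      q+2<a/b : q + 2ℚ < + a / suc b
      q+2<a/b = subst (q + 2ℚ <_) (trans (+-assoc (+ a / suc b) (- 2ℚ) 2ℚ)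
        (trans (cong (λ i → + a / suc b + i) (+-inverseˡ 2ℚ)) (+-identityʳ (+ a / suc b)))) (+-monoˡ-< 2ℚ q<a/b-2)
    ... | ℚᵘ.*<* lt = ℕ.≤-trans (ℕ.*-monoˡ-≤ (suc b) (ℕ.s≤s (ℕ.≤-trans (ℕ.≤-reflexive (lemma₁ d)) (ℕ.m≤n+m (2 ℕ.* d) n))))
      (ℕ.<⇒≤ (subst₂ ℕ._<_ refl (cong (a ℕ.*_) (ℕ.*-identityʳ d)) (ℤ.drop‿+<+
        (subst₂ ℤ._<_ lhs (sym (ℤ.pos-* a (d ℕ.* 1))) lt))))
      where
      lemma₁ : ∀ d → d ℕ.+ d ≡ 2 ℕ.* d
      lemma₁ = solve-∀
      lhs : (+ suc n ℤ.* + 1 ℤ.+ + 2 ℤ.* + d) ℤ.* + suc b ≡ + ((suc n ℕ.+ 2 ℕ.* d) ℕ.* suc b)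
      lhs = trans (cong (ℤ._* + suc b) (trans (cong₂ ℤ._+_ (ℤ.*-identityʳ (+ suc n)) (sym (ℤ.pos-* 2 d)))
        (sym (ℤ.pos-+ (suc n) (2 ℕ.* d))))) (sym (ℤ.pos-* (suc n ℕ.+ 2 ℕ.* d) (suc b)))
  0<x⇒1/d<x (mkℚ (+ 0) _ _ , *<* (ℤ.+<+ ()) , _)
  0<x⇒1/d<x (mkℚ ℤ.-[1+ _ ] _ _ , *<* () , _)

  -- Enlarging d is what lets a single D serve α, δ and κ. In the shifted bound, a / b ≥ 2 pays for
  -- the increase of d.
  1/d<x⇒1/[d+e]<x : ∀ {d x} e → ExceedsReciprocal d x → ExceedsReciprocal (d ℕ.+ e) x
  1/d<x⇒1/[d+e]<x {d} {x} e 1/d<x = record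
    { 1≤d  = ℕ.≤-trans 1≤d (ℕ.m≤m+n d e)
    ; <a/b = λ a b x<a/b → ℕ.≤-trans (<a/b a b x<a/b) (ℕ.*-monoʳ-≤ a (ℕ.m≤m+n d e))
    ; 2+   = λ a b x<a/b-2 → enlarge a b (2+ a b x<a/b-2)
    }
    where
    open ExceedsReciprocal 1/d<x
    enlarge : ∀ a b → suc (d ℕ.+ d) ℕ.* b ℕ.≤ a ℕ.* d → suc (d ℕ.+ e ℕ.+ (d ℕ.+ e)) ℕ.* b ℕ.≤ a ℕ.* (d ℕ.+ e)
    enlarge a b le = begin
      suc (d ℕ.+ e ℕ.+ (d ℕ.+ e)) ℕ.* b         ≡⟨ lemma₁ d e b ⟩
      suc (d ℕ.+ d) ℕ.* b ℕ.+ 2 ℕ.* b ℕ.* e     ≤⟨ ℕ.+-mono-≤ le (ℕ.*-monoˡ-≤ e 2b≤a) ⟩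
      a ℕ.* d ℕ.+ a ℕ.* e                       ≡⟨ ℕ.*-distribˡ-+ a d e ⟨
      a ℕ.* (d ℕ.+ e)                           ∎
      where
      open ℕ.≤-Reasoning
      lemma₁ : ∀ d e b → suc (d ℕ.+ e ℕ.+ (d ℕ.+ e)) ℕ.* b ≡ suc (d ℕ.+ d) ℕ.* b ℕ.+ 2 ℕ.* b ℕ.* e
      lemma₁ = solve-∀
      lemma₂ : ∀ d b → suc (d ℕ.+ d) ℕ.* b ≡ b ℕ.+ 2 ℕ.* b ℕ.* d
      lemma₂ = solve-∀
      2b≤a : 2 ℕ.* b ℕ.≤ a
      2b≤a = ℕ.*-cancelʳ-≤ (2 ℕ.* b) a d {{ℕ.>-nonZero 1≤d}}
        (ℕ.≤-trans (ℕ.m≤n+m (2 ℕ.* b ℕ.* d) b) (ℕ.≤-trans (ℕ.≤-reflexive (sym (lemma₂ d b))) le))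

-- From `Represented` to the smallest modulus bound, and from n back to Q.

module ExceptionalPrimes where

  open import Data.Integer.Base as ℤ using (ℤ; +_)
  import Data.Integer.Coprimality as ℤ
  import Data.Integer.Divisibility as ℤ
  import Data.Integer.Divisibility.Signed as Signed
  open import Data.Integer.DivMod using (_%ℕ_; _/ℕ_; n%ℕd<d; a≡a%ℕn+[a/ℕn]*n)
  import Data.Integer.Properties as ℤ
  open import Data.Integer.Tactic.RingSolver using (solve-∀)
  open import Data.List.Base using ([]; _∷_; length)
  open import Data.List.Membership.Propositional using (_∈_)
  open import Data.List.Relation.Unary.All as All using (All; []; _∷_)
  open import Data.List.Relation.Unary.Any using (here; there)
  open import Data.List.Relation.Unary.Unique.Propositional using (Unique)
  open import Data.Nat.Base
  open import Data.Nat.Divisibility using (_∣_; ∣-refl)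
  open import Data.Nat.Induction using (<-rec)
  open import Data.Nat.Primality using (Prime; prime⇒nonZero; ¬prime[1])
  open import Data.Nat.Properties
  open import Data.Product.Base using (_×_; _,_; ∃-syntax)
  import Data.Rational.Base as ℚ
  import Data.Rational.Properties as ℚ
  open import Data.Sum.Base using (inj₁; inj₂)
  open import Defs
  open Exceptions
  open Growth using (^-swap)
  open RealBounds
  open import Relation.Binary.PropositionalEquality
    using (_≡_; refl; sym; trans; cong; subst; module ≡-Reasoning)
  open import Relation.Nullary using (¬_)
  open Representation

  open ℝ

  r^D≤p⇒r^b≤p^a : ∀ {r p} D a b .{{_ : NonZero r}} → r ^ D ≤ p → b ≤ a * D → r ^ b ≤ p ^ a
  r^D≤p⇒r^b≤p^a {r} {p} D a b r^D≤p b≤aD = begin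
    r ^ b          ≤⟨ ^-monoʳ-≤ r b≤aD ⟩
    r ^ (a * D)    ≡⟨ cong (r ^_) (*-comm a D) ⟩
    r ^ (D * a)    ≡⟨ ^-*-assoc r D a ⟨
    (r ^ D) ^ a    ≤⟨ ^-monoˡ-≤ a r^D≤p ⟩
    p ^ a          ∎
    where open ≤-Reasoning

  ^-cancelʳ-≤ : ∀ {m n} o .{{_ : NonZero o}} → m ^ o ≤ n ^ o → m ≤ n
  ^-cancelʳ-≤ o m^o≤n^o = ≮⇒≥ λ n<m → <⇒≱ (^-monoˡ-< o n<m) m^o≤n^o

  module _ {α : ℝ} {D p : ℕ} (p-prime : Prime p) (1/D<α : ExceedsReciprocal D α) where

    private
      instance
        p≢0 : NonZero p
        p≢0 = prime⇒nonZero p-prime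

      0<a% : ∀ a → ℤ.Coprime a (+ p) → 0 < a %ℕ p
      0<a% a a⊥p = n≢0⇒n>0 λ r≡0 → ¬prime[1] (subst Prime (a⊥p (p∣a r≡0 , ∣-refl)) p-prime)
        where
        p∣a : a %ℕ p ≡ 0 → p ∣ ℤ.∣ a ∣
        p∣a r≡0 = Signed.∣⇒∣ᵤ {+ p} {a} (Signed.divides (a /ℕ p)
          (trans (a≡a%ℕn+[a/ℕn]*n a p) (trans (cong (λ i → + i ℤ.+ a /ℕ p ℤ.* + p) r≡0) (ℤ.+-identityˡ _))))

    represented⇒represents : ((M , _) : Represented D p) → Represents α p M
    represented⇒represents (M , _ , represent) a a⊥p
      with k , 1≤k , k≤M , (c , k≡) , smooth , squareFree ← represent (0<a% a a⊥p) (n%ℕd<d a p) =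
      k , 1≤k , k≤M , smooth′ , squareFree , Signed.∣⇒∣ᵤ (Signed.divides (+ c ℤ.- q) (begin
        + k ℤ.- a
          ≡⟨ cong (λ i → + k ℤ.- i) (a≡a%ℕn+[a/ℕn]*n a p) ⟩
        + k ℤ.- (+ r ℤ.+ q ℤ.* + p)
          ≡⟨ cong (λ i → i ℤ.- (+ r ℤ.+ q ℤ.* + p)) (trans (cong +_ k≡)
               (trans (ℤ.pos-+ r (c * p)) (cong (λ i → + r ℤ.+ i) (ℤ.pos-* c p)))) ⟩
        (+ r ℤ.+ + c ℤ.* + p) ℤ.- (+ r ℤ.+ q ℤ.* + p)
          ≡⟨ lemma (+ r) (+ c) q (+ p) ⟩
        (+ c ℤ.- q) ℤ.* + p ∎))
      where
      open ≡-Reasoning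
      r = a %ℕ p
      q = a /ℕ p
      lemma : ∀ r c q p → (r ℤ.+ c ℤ.* p) ℤ.- (r ℤ.+ q ℤ.* p) ≡ (c ℤ.- q) ℤ.* p
      lemma = solve-∀
      smooth′ : Smooth α p k
      smooth′ {l} l-prime l∣k s a b p<s α<a/b = power-≤ a b
        (r^D≤p⇒r^b≤p^a D a b {{prime⇒nonZero l-prime}} (smooth l-prime l∣k)
          (ExceedsReciprocal.<a/b 1/D<α a b α<a/b)) (ℚ.<⇒≤ p<s)

    module _ {δ : ℝ} (1/D<δ : ExceedsReciprocal D δ) where

      private
        ≤^2+δ : ∀ {M M′} → M′ ≤ M → M ^ D ≤ p ^ suc (D + D) → M′ ≤ fromℕ p ^ᵣ (2ℚ +ᵣ δ)
        ≤^2+δ {M} {M′} M′≤M M^D≤ s a b p<s 2+δ<a/b = power-≤ a b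
          (^-cancelʳ-≤ D {{>-nonZero (ExceedsReciprocal.1≤d 1/D<δ)}} (begin
            (M′ ^ b) ^ D              ≡⟨ ^-swap M′ b D ⟩
            (M′ ^ D) ^ b              ≤⟨ ^-monoˡ-≤ b (≤-trans (^-monoˡ-≤ D M′≤M) M^D≤) ⟩
            (p ^ suc (D + D)) ^ b     ≡⟨ ^-*-assoc p (suc (D + D)) b ⟩
            p ^ (suc (D + D) * b)     ≤⟨ ^-monoʳ-≤ p (ExceedsReciprocal.2+ 1/D<δ a b 2+δ<a/b) ⟩
            p ^ (a * D)               ≡⟨ ^-*-assoc p a D ⟨
            (p ^ a) ^ D               ∎))
          (ℚ.<⇒≤ p<s)
          where open ≤-Reasoning

        -- A least M exists only up to double negation, as Represents α p is not decidable.
        ¬¬least : ∀ M → Represents α p M → ¬ ¬ (∃[ M′ ] M′ ≤ M × IsM* α p M′)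
        ¬¬least = <-rec _ λ M rec represents ¬least → ¬least (M , ≤-refl , represents ,
          λ M′ represents′ → ≮⇒≥ λ M′<M → rec M′<M represents′
            λ (M″ , M″≤M′ , least) → ¬least (M″ , ≤-trans M″≤M′ (<⇒≤ M′<M) , least))

      -- The double negation suffices, because `Exceptional` asserts a negation.
      represented⇒¬¬M*≤ : Represented D p → ¬ ¬ (M*[ α , p ]≤^ (2ℚ +ᵣ δ))
      represented⇒¬¬M*≤ rep@(M , M^D≤ , _) ¬M*≤ = ¬¬least M (represented⇒represents rep)
        λ (M′ , M′≤M , least) → ¬M*≤ (M′ , least , ≤^2+δ M′≤M M^D≤)

  -- The least exceptional prime n replaces the real number Q: the others are at most 2Q ≤ 2n, and n
  -- ≤ 2Q leads back to Q.
  minimum : ∀ p ps → ∃[ n ] n ∈ p ∷ ps × All (n ≤_) (p ∷ ps)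
  minimum p []       = p , here refl , ≤-refl ∷ []
  minimum p (q ∷ ps) with n , n∈ , n≤ ← minimum q ps with ≤-total p n
  ... | inj₁ p≤n = p , here refl , ≤-refl ∷ All.map (≤-trans p≤n) n≤
  ... | inj₂ n≤p = n , there n∈ , n≤p ∷ n≤

  exceedsReciprocal-common : ∀ {x y z} → 0ᵣ <ᵣ x → 0ᵣ <ᵣ y → 0ᵣ <ᵣ z →
    ∃[ d ] ExceedsReciprocal d x × ExceedsReciprocal d y × ExceedsReciprocal d z
  exceedsReciprocal-common {x} {y} {z} 0<x 0<y 0<z
    with a , 1/a<x ← 0<x⇒1/d<x 0<x
    with b , 1/b<y ← 0<x⇒1/d<x 0<y
    with c , 1/c<z ← 0<x⇒1/d<x 0<z =
    a + b + c
      , 1/d<x⇒1/[d+e]<x c (1/d<x⇒1/[d+e]<x b 1/a<x)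
      , 1/d<x⇒1/[d+e]<x c (subst (λ d → ExceedsReciprocal d y) (+-comm b a) (1/d<x⇒1/[d+e]<x a 1/b<y))
      , subst (λ d → ExceedsReciprocal d z) (+-comm c (a + b)) (1/d<x⇒1/[d+e]<x (a + b) 1/c<z)

  m/1≤s : ∀ {m n s} → 2 * m ≤ n → + n ℚ./ 1 ℚ.≤ s ℚ.* 2ℚ → + m ℚ./ 1 ℚ.≤ s
  m/1≤s {m} {n} {s} 2m≤n n≤2s = ℚ.*-cancelʳ-≤-pos 2ℚ (begin
    + m ℚ./ 1 ℚ.* 2ℚ       ≡⟨ ℚ.*-comm (+ m ℚ./ 1) 2ℚ ⟩
    2ℚ ℚ.* (+ m ℚ./ 1)     ≡⟨ /1-* 2 m ⟨
    + (2 * m) ℚ./ 1        ≤⟨ /1-mono-≤ 2m≤n ⟩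
    + n ℚ./ 1              ≤⟨ n≤2s ⟩
    s ℚ.* 2ℚ               ∎)
    where open ℚ.≤-Reasoning

  fromℕ-≤-Upper : ∀ {x m s} → fromℕ m ≤ᵣ x → Upper x s → + m ℚ./ 1 ℚ.≤ s
  fromℕ-≤-Upper {x} {s = s} m≤x x<s = ℚ.≮⇒≥ λ s<m → disjoint x s (m≤x s s<m , x<s)

  module _ {α δ κ : ℝ} {D n₀ : ℕ} (1/D<α : ExceedsReciprocal D α)
    (1/D<δ : ExceedsReciprocal D δ) (1/D<κ : ExceedsReciprocal D κ)
    (few : ∀ n → n₀ ≤ n → ∀ ps → Unique ps →
      All (λ p → Prime p × n ≤ p × p ≤ 2 * n × ¬ Represented D p) ps → 2 * length ps ^ D ≤ n)
    {Q : ℝ} (n₀≤Q : fromℕ n₀ ≤ᵣ Q) where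

    private
      nonempty : ∀ {ps n} .{{_ : NonZero (length ps)}} → n ∈ ps → All (n ≤_) ps →
                 Unique ps → All (Exceptional α δ Q) ps → length ps ≤ Q ^ᵣ κ
      nonempty {ps} {n} n∈ps n≤ps ps! exceptional s a b Q<s κ<a/b =
        power-≤ {length ps} {T^D} a b (r^D≤p⇒r^b≤p^a {length ps} D a b ≤-refl (ExceedsReciprocal.<a/b 1/D<κ a b κ<a/b)) T^D≤s
        where
        T^D = length ps ^ D
        Q≤n : Q ≤ᵣ fromℕ n
        Q≤n = let _ , Q≤n , _ = All.lookup exceptional n∈ps in Q≤n
        n≤2Q : fromℕ n ≤ᵣ 2ℚ *ᵣ Q
        n≤2Q = let _ , _ , n≤2Q , _ = All.lookup exceptional n∈ps in n≤2Q
        2T^D≤n : 2 * T^D ≤ n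
        2T^D≤n = few n (fromℕ-≤ᵣ {Q} {n₀} {n} n₀≤Q Q≤n) ps ps! (All.zipWith
          (λ {p} (n≤p , p-prime , Q≤p , p≤2Q , ¬M*≤) → p-prime , n≤p , n≤2x≤2m⇒n≤2m {Q} {n} {p} p≤2Q Q≤n ,
            λ rep → represented⇒¬¬M*≤ {α} p-prime 1/D<α {δ} 1/D<δ rep ¬M*≤)
          (n≤ps , exceptional))
        T^D≤s : + T^D ℚ./ 1 ℚ.≤ s
        T^D≤s = m/1≤s {T^D} {n} 2T^D≤n (n≤2ᵣx⇒n≤2s {Q} {n} n≤2Q Q<s)

    length-exceptional : ∀ ps → Unique ps → All (Exceptional α δ Q) ps → length ps ≤ Q ^ᵣ κ
    -- Even the empty list requires `0 ≤ s ^ a`, which follows from n₀ ≤ Q < s.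
    length-exceptional [] _ _ s a b Q<s κ<a/b =
      power-≤ {0} {n₀} a b (subst (_≤ n₀ ^ a) (sym 0^b≡0) z≤n) (fromℕ-≤-Upper {Q} {n₀} n₀≤Q Q<s)
      where
      0^b≡0 : 0 ^ b ≡ 0
      0^b≡0 = cong (0 ^_) (sym (suc-pred b))
    length-exceptional (p ∷ ps) ps! exceptional =
      let n , n∈ , n≤ = minimum p ps in nonempty {p ∷ ps} {n} n∈ n≤ ps! exceptional

open Exceptions using (exceptions-bound)
open ExceptionalPrimes using (exceedsReciprocal-common; length-exceptional)
open RealBounds using (ExceedsReciprocal)

theorem1p3 : ∀ (α : ℝ) → 0ᵣ <ᵣ α →
    ∀ (δ κ : ℝ) → 0ᵣ <ᵣ δ → 0ᵣ <ᵣ κ →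
    ∃[ Q₀ ] ∀ (Q : ℝ) → Q₀ ≤ᵣ Q →
    ∀ (ps : List ℕ) → Unique ps → All (Exceptional α δ Q) ps →
    length ps ≤ Q ^ᵣ κ
theorem1p3 α 0<α δ κ 0<δ 0<κ =
  let D , 1/D<α , 1/D<δ , 1/D<κ = exceedsReciprocal-common 0<α 0<δ 0<κ
      n₀ , few = exceptions-bound D (ExceedsReciprocal.1≤d 1/D<α)
  in fromℕ n₀ , λ Q n₀≤Q → length-exceptional {α} {δ} {κ} 1/D<α 1/D<δ 1/D<κ few {Q} n₀≤Q
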